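{- Let $G$ be a connected graph with a cluster $(C,S)$, $|C|=c$, let $H$ be a regular graph with vertex set $C$, let $G(H)$ be the graph obtained from $G$ by adding the edges of $H$ on $C$, and let $K$ be a regular graph. Suppose $H$ admits PST between $\mathbf{x}$ and $\mathbf{y}$ at time $\tau$, where $\mathbf{x},\mathbf{y}\in\mathbb{R}^c$ and $\mathbf{1}_c^T\mathbf{x}=\mathbf{1}_c^T\mathbf{y}=0$. The following hold for all $M\in\{A,L,Q\}$. 1. If $\mathbf{w}$ is periodic in $K$ at time $\tau$, then $G(H)\,\square\,K$ exhibits PST between $\widetilde{\mathbf{x}}\otimes\mathbf{w}$ and $\widetilde{\mathbf{y}}\otimes\mathbf{w}$ at $\tau$. 2. If $K$ admits PST between $\mathbf{w}_1$ and $\mathbf{w}_2$ at time $\tau$, then $G(H)\,\square\,K$ admits PST between $\widetilde{\mathbf{x}}\otimes\mathbf{w}_1$ and $\widetilde{\mathbf{y}}\otimes\mathbf{w}_2$ at $\tau$.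
   Context: Graphs may have positive edge weights; $A$ is the (weighted) adjacency matrix, $\Delta$ the diagonal matrix of row sums of $A$, $L=\Delta-A$, $Q=\Delta+A$, and for $M\in\{A,L,Q\}$, $U_X(t)=\exp(itM(X))$. A graph is regular if $\Delta$ is a scalar matrix (then state transfer in it does not depend on the choice of $M$). PST between real vectors $\mathbf{x},\mathbf{y}$ in $X$ at time $\tau>0$ means $U_X(\tau)\mathbf{x}=\gamma\mathbf{y}$ for some $\gamma\in\mathbb{C}$; $\mathbf{w}$ is periodic at time $\tau$ if there is PST from $\mathbf{w}$ to itself at $\tau$. Real pure states are represented by nonzero real vectors. Cluster: for $C,S\subseteq V(G)$ with $|C|\ge2$, $(C,S)$ is a cluster in $G$ if the vertices of $C$ are pairwise non-adjacent, the neighbourhood of each $a\in C$ in $G$ is equal to $S$, and for each $v\in S$ the weight $\omega(u,v)$ is the same for all $u\in C$. $G(H)$ has vertex set $V(G)$ and edge set $E(G)\cup E(H)$, edge weights preserved, with vertices of $C$ ordered first; $\widetilde{\mathbf{x}}=[\mathbf{x}^T,\mathbf{0}]^T\in\mathbb{R}^{|V(G)|}$. $\mathbf{1}_c$ is the all-ones vector. The Cartesian product $X\square Y$ has vertex set $V(X)\times V(Y)$ and $M(X\square Y)=M(X)\otimes I+I\otimes M(Y)$. -}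

module Defs where

open import Level using (0ℓ)
open import Algebra.Bundles.Raw using (RawRing)
open import Algebra.Definitions.RawMonoid using (sum)
open import Data.Bool.Base using (if_then_else_)
open import Data.Empty using (⊥)
open import Data.Fin.Base using (Fin; toℕ; splitAt; quotient; remainder)
open import Data.Fin.Properties using () renaming (_≟_ to _≟ᶠ_)
open import Data.Fin.Subset using (Subset; inside; outside; _∈_; ∣_∣)
open import Data.Integer.Base using (+_)
open import Data.Nat.Base as ℕ using (ℕ; zero; suc; _!)
import Data.Nat.Properties as ℕₚ
open import Data.Nat.Properties using (_!≢0)
open import Data.Product.Base using (∃; _×_; _,_)
open import Data.Rational.Base as ℚ using (ℚ; 0ℚ; 1ℚ; ½)
import Data.Rational.Properties as ℚₚ
open import Data.Rational.Solver using (module +-*-Solver)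
open import Data.Sum.Base using (_⊎_; inj₁; inj₂)
open import Data.Vec.Base as Vec using ()
open import Data.Vec.Functional using (Vector; _++_; replicate)
open import Function.Base using (_on_)
open import Function.Bundles using (_⇔_)
open import Relation.Binary.Construct.Closure.ReflexiveTransitive using (Star)
open import Relation.Binary.Core using (Rel)
open import Relation.Binary.Definitions using (Decidable; Symmetric)
open import Relation.Binary.PropositionalEquality
  using (_≡_; refl; sym; trans; cong; subst; subst₂)
open import Relation.Nullary.Decidable using (Dec; yes; no; does; _⊎-dec_; _×-dec_)
open import Relation.Nullary.Negation using (¬_; contradiction)

½-pos : ∀ {ε} → 0ℚ ℚ.< ε → 0ℚ ℚ.< ½ ℚ.* ε
½-pos {ε} 0<ε =
  subst (ℚ._< ½ ℚ.* ε) (ℚₚ.*-zeroʳ ½) (ℚₚ.*-monoʳ-<-pos ½ 0<ε)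

½+½ : ∀ ε → ½ ℚ.* ε ℚ.+ ½ ℚ.* ε ≡ ε
½+½ ε = trans (sym (ℚₚ.*-distribʳ-+ ε ½ ½)) (ℚₚ.*-identityˡ ε)

x-x≡0 : ∀ x → ℚ.∣ x ℚ.- x ∣ ≡ 0ℚ
x-x≡0 x = cong ℚ.∣_∣ (ℚₚ.+-inverseʳ x)

∣-∣-swap : ∀ x y → ℚ.∣ x ℚ.- y ∣ ≡ ℚ.∣ y ℚ.- x ∣
∣-∣-swap x y = trans (sym (ℚₚ.∣-p∣≡∣p∣ (x ℚ.- y)))
  (cong ℚ.∣_∣ (solve 2 (λ a b → :- (a :- b) := b :- a) refl x y))
  where open +-*-Solver

triangle : ∀ x y z → ℚ.∣ x ℚ.- z ∣ ℚ.≤ ℚ.∣ x ℚ.- y ∣ ℚ.+ ℚ.∣ y ℚ.- z ∣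
triangle x y z = subst (ℚ._≤ ℚ.∣ x ℚ.- y ∣ ℚ.+ ℚ.∣ y ℚ.- z ∣)
  (cong ℚ.∣_∣ (solve 3 (λ a b c → (a :- b) :+ (b :- c) := a :- c) refl x y z))
  (ℚₚ.∣p+q∣≤∣p∣+∣q∣ (x ℚ.- y) (y ℚ.- z))
  where open +-*-Solver

-‿triangle : ∀ x y → ℚ.∣ x ∣ ℚ.- ℚ.∣ y ∣ ℚ.≤ ℚ.∣ x ℚ.- y ∣
-‿triangle x y = subst (ℚ.∣ x ∣ ℚ.- ℚ.∣ y ∣ ℚ.≤_)
  (solve 2 (λ d b → (d :+ b) :- b := d) refl ℚ.∣ x ℚ.- y ∣ ℚ.∣ y ∣)
  (ℚₚ.+-monoˡ-≤ (ℚ.- ℚ.∣ y ∣)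
    (subst (λ z → ℚ.∣ z ∣ ℚ.≤ ℚ.∣ x ℚ.- y ∣ ℚ.+ ℚ.∣ y ∣)
      (solve 2 (λ a b → (a :- b) :+ b := a) refl x y)
      (ℚₚ.∣p+q∣≤∣p∣+∣q∣ (x ℚ.- y) y)))
  where open +-*-Solver

reverse-triangle : ∀ x y → ℚ.∣ ℚ.∣ x ∣ ℚ.- ℚ.∣ y ∣ ∣ ℚ.≤ ℚ.∣ x ℚ.- y ∣
reverse-triangle x y with ℚₚ.∣p∣≡p∨∣p∣≡-p (ℚ.∣ x ∣ ℚ.- ℚ.∣ y ∣)
... | inj₁ eq = subst (ℚ._≤ ℚ.∣ x ℚ.- y ∣) (sym eq) (-‿triangle x y)
... | inj₂ eq = subst₂ ℚ._≤_
  (trans (solve 2 (λ a b → b :- a := :- (a :- b)) refl ℚ.∣ x ∣ ℚ.∣ y ∣) (sym eq))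
  (∣-∣-swap y x) (-‿triangle y x)
  where open +-*-Solver

-- Real numbers are Cauchy sequences of rationals, up to null sequences.
IsCauchy : (ℕ → ℚ) → Set
IsCauchy s = ∀ ε → 0ℚ ℚ.< ε →
  ∃ λ N → ∀ m n → N ℕ.≤ m → N ℕ.≤ n → ℚ.∣ s m ℚ.- s n ∣ ℚ.< ε

record ℝ : Set where
  constructor mkℝ
  field
    seq    : ℕ → ℚ
    cauchy : IsCauchy seq

open ℝ public

infix 4 _≈_ _<_

_≈_ : Rel ℝ 0ℓ
x ≈ y = ∀ ε → 0ℚ ℚ.< ε →
        ∃ λ N → ∀ n → N ℕ.≤ n → ℚ.∣ seq x n ℚ.- seq y n ∣ ℚ.< ε

_<_ : Rel ℝ 0ℓ
x < y = ∃ λ ε → 0ℚ ℚ.< ε ×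
        ∃ λ N → ∀ n → N ℕ.≤ n → seq x n ℚ.+ ε ℚ.< seq y n

fromℚ : ℚ → ℝ
fromℚ q = mkℝ (λ _ → q) λ ε 0<ε →
  0 , λ _ _ _ _ → subst (ℚ._< ε) (sym (x-x≡0 q)) 0<ε

0ℝ 1ℝ : ℝ
0ℝ = fromℚ 0ℚ
1ℝ = fromℚ 1ℚ

abstract
  +-estimate : ∀ a b c d {ε} → ℚ.∣ a ℚ.- b ∣ ℚ.< ½ ℚ.* ε →
               ℚ.∣ c ℚ.- d ∣ ℚ.< ½ ℚ.* ε →
               ℚ.∣ (a ℚ.+ c) ℚ.- (b ℚ.+ d) ∣ ℚ.< ε
  +-estimate a b c d {ε} p q = ℚₚ.≤-<-trans
    (subst (λ z → ℚ.∣ z ∣ ℚ.≤ ℚ.∣ a ℚ.- b ∣ ℚ.+ ℚ.∣ c ℚ.- d ∣)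
      (solve 4 (λ a b c d → (a :- b) :+ (c :- d) := (a :+ c) :- (b :+ d))
        refl a b c d)
      (ℚₚ.∣p+q∣≤∣p∣+∣q∣ (a ℚ.- b) (c ℚ.- d)))
    (subst (ℚ.∣ a ℚ.- b ∣ ℚ.+ ℚ.∣ c ℚ.- d ∣ ℚ.<_) (½+½ ε) (ℚₚ.+-mono-< p q))
    where open +-*-Solver

  +-cauchy : ∀ x y → IsCauchy (λ n → seq x n ℚ.+ seq y n)
  +-cauchy x y ε 0<ε =
    let (N₁ , h₁) = cauchy x (½ ℚ.* ε) (½-pos 0<ε)
        (N₂ , h₂) = cauchy y (½ ℚ.* ε) (½-pos 0<ε)
    in N₁ ℕ.⊔ N₂ , λ m n N≤m N≤n →
      +-estimate (seq x m) (seq x n) (seq y m) (seq y n)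
        (h₁ m n (ℕₚ.m⊔n≤o⇒m≤o N₁ N₂ N≤m) (ℕₚ.m⊔n≤o⇒m≤o N₁ N₂ N≤n))
        (h₂ m n (ℕₚ.m⊔n≤o⇒n≤o N₁ N₂ N≤m) (ℕₚ.m⊔n≤o⇒n≤o N₁ N₂ N≤n))

  neg-cauchy : ∀ x → IsCauchy (λ n → ℚ.- seq x n)
  neg-cauchy x ε 0<ε = let (N , h) = cauchy x ε 0<ε in
    N , λ m n N≤m N≤n → subst (ℚ._< ε)
      (trans (sym (ℚₚ.∣-p∣≡∣p∣ (seq x m ℚ.- seq x n)))
        (cong ℚ.∣_∣ (solve 2 (λ a b → :- (a :- b) := (:- a) :- (:- b))
          refl (seq x m) (seq x n))))
      (h m n N≤m N≤n)
    where open +-*-Solver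

  abs-cauchy : ∀ x → IsCauchy (λ n → ℚ.∣ seq x n ∣)
  abs-cauchy x ε 0<ε = let (N , h) = cauchy x ε 0<ε in
    N , λ m n N≤m N≤n →
      ℚₚ.≤-<-trans (reverse-triangle (seq x m) (seq x n)) (h m n N≤m N≤n)

  -- A positive bound on the tail of a Cauchy sequence.
  bounded : ∀ x → ∃ λ B → 0ℚ ℚ.< B ×
            ∃ λ N → ∀ n → N ℕ.≤ n → ℚ.∣ seq x n ∣ ℚ.≤ B
  bounded x = let (N , h) = cauchy x 1ℚ (ℚₚ.positive⁻¹ 1ℚ) in
    1ℚ ℚ.+ ℚ.∣ seq x N ∣ ,
    ℚₚ.+-mono-<-≤ (ℚₚ.positive⁻¹ 1ℚ) (ℚₚ.0≤∣p∣ (seq x N)) ,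
    N , λ n N≤n → ℚₚ.≤-trans
      (subst (λ z → ℚ.∣ z ∣ ℚ.≤ ℚ.∣ seq x n ℚ.- seq x N ∣ ℚ.+ ℚ.∣ seq x N ∣)
        (solve 2 (λ a b → (a :- b) :+ b := a) refl (seq x n) (seq x N))
        (ℚₚ.∣p+q∣≤∣p∣+∣q∣ (seq x n ℚ.- seq x N) (seq x N)))
      (ℚₚ.+-monoˡ-≤ ℚ.∣ seq x N ∣ (ℚₚ.<⇒≤ (h n N N≤n ℕₚ.≤-refl)))
    where open +-*-Solver

  -- For B > 0, multiplication by B sends some positive number below ε.
  shrink : ∀ {ε B} → 0ℚ ℚ.< ε → 0ℚ ℚ.< B →
           ∃ λ δ → 0ℚ ℚ.< δ × B ℚ.* δ ≡ ε
  shrink {ε} {B} 0<ε 0<B =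
    (ℚ.1/ B) ℚ.* ε ,
    subst (ℚ._< (ℚ.1/ B) ℚ.* ε) (ℚₚ.*-zeroʳ (ℚ.1/ B)) (ℚₚ.*-monoʳ-<-pos (ℚ.1/ B) 0<ε) ,
    trans (sym (ℚₚ.*-assoc B (ℚ.1/ B) ε))
      (trans (cong (ℚ._* ε) (ℚₚ.*-inverseʳ B)) (ℚₚ.*-identityˡ ε))
    where
    instance
      B⁺ : ℚ.Positive B
      B⁺ = ℚ.positive 0<B
      B≢0 : ℚ.NonZero B
      B≢0 = ℚₚ.pos⇒nonZero B
      B⁻¹⁺ : ℚ.Positive (ℚ.1/ B)
      B⁻¹⁺ = ℚₚ.1/pos⇒pos B

  *-estimate : ∀ a b B {δ} → 0ℚ ℚ.< B → ℚ.∣ a ∣ ℚ.≤ B → ℚ.∣ b ∣ ℚ.< δ →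
               ℚ.∣ a ℚ.* b ∣ ℚ.< B ℚ.* δ
  *-estimate a b B {δ} 0<B ∣a∣≤B ∣b∣<δ = ℚₚ.≤-<-trans
    (subst (ℚ._≤ B ℚ.* ℚ.∣ b ∣) (sym (ℚₚ.∣p*q∣≡∣p∣*∣q∣ a b))
      (ℚₚ.*-monoʳ-≤-nonNeg ℚ.∣ b ∣ {{ℚₚ.∣-∣-nonNeg b}} ∣a∣≤B))
    (ℚₚ.*-monoʳ-<-pos B {{ℚ.positive 0<B}} ∣b∣<δ)

  *-cauchy : ∀ x y → IsCauchy (λ n → seq x n ℚ.* seq y n)
  *-cauchy x y ε 0<ε =
    let (B₁ , 0<B₁ , M₁ , b₁) = bounded x
        (B₂ , 0<B₂ , M₂ , b₂) = bounded y
        (δ₁ , 0<δ₁ , e₁) = shrink (½-pos 0<ε) 0<B₂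
        (δ₂ , 0<δ₂ , e₂) = shrink (½-pos 0<ε) 0<B₁
        (N₁ , h₁) = cauchy x δ₁ 0<δ₁
        (N₂ , h₂) = cauchy y δ₂ 0<δ₂
        N = (M₁ ℕ.⊔ M₂) ℕ.⊔ (N₁ ℕ.⊔ N₂)
        M₁≤ : ∀ {n} → N ℕ.≤ n → M₁ ℕ.≤ n
        M₁≤ p = ℕₚ.m⊔n≤o⇒m≤o M₁ M₂ (ℕₚ.m⊔n≤o⇒m≤o (M₁ ℕ.⊔ M₂) (N₁ ℕ.⊔ N₂) p)
        M₂≤ : ∀ {n} → N ℕ.≤ n → M₂ ℕ.≤ n
        M₂≤ p = ℕₚ.m⊔n≤o⇒n≤o M₁ M₂ (ℕₚ.m⊔n≤o⇒m≤o (M₁ ℕ.⊔ M₂) (N₁ ℕ.⊔ N₂) p)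
        N₁≤ : ∀ {n} → N ℕ.≤ n → N₁ ℕ.≤ n
        N₁≤ p = ℕₚ.m⊔n≤o⇒m≤o N₁ N₂ (ℕₚ.m⊔n≤o⇒n≤o (M₁ ℕ.⊔ M₂) (N₁ ℕ.⊔ N₂) p)
        N₂≤ : ∀ {n} → N ℕ.≤ n → N₂ ℕ.≤ n
        N₂≤ p = ℕₚ.m⊔n≤o⇒n≤o N₁ N₂ (ℕₚ.m⊔n≤o⇒n≤o (M₁ ℕ.⊔ M₂) (N₁ ℕ.⊔ N₂) p)
    in N , λ m n N≤m N≤n →
      let a = seq x m ; b = seq x n ; c = seq y m ; d = seq y n
          p : ℚ.∣ c ℚ.* (a ℚ.- b) ∣ ℚ.< ½ ℚ.* ε
          p = subst (ℚ.∣ c ℚ.* (a ℚ.- b) ∣ ℚ.<_) e₁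
                (*-estimate c (a ℚ.- b) B₂ 0<B₂ (b₂ m (M₂≤ N≤m))
                  (h₁ m n (N₁≤ N≤m) (N₁≤ N≤n)))
          q : ℚ.∣ b ℚ.* (c ℚ.- d) ∣ ℚ.< ½ ℚ.* ε
          q = subst (ℚ.∣ b ℚ.* (c ℚ.- d) ∣ ℚ.<_) e₂
                (*-estimate b (c ℚ.- d) B₁ 0<B₁ (b₁ n (M₁≤ N≤n))
                  (h₂ m n (N₂≤ N≤m) (N₂≤ N≤n)))
      in ℚₚ.≤-<-trans
        (subst (λ z → ℚ.∣ z ∣ ℚ.≤ ℚ.∣ c ℚ.* (a ℚ.- b) ∣ ℚ.+ ℚ.∣ b ℚ.* (c ℚ.- d) ∣)
          (solve 4 (λ a b c d → c :* (a :- b) :+ b :* (c :- d) := a :* c :- b :* d)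
            refl a b c d)
          (ℚₚ.∣p+q∣≤∣p∣+∣q∣ (c ℚ.* (a ℚ.- b)) (b ℚ.* (c ℚ.- d))))
        (subst (ℚ.∣ c ℚ.* (a ℚ.- b) ∣ ℚ.+ ℚ.∣ b ℚ.* (c ℚ.- d) ∣ ℚ.<_) (½+½ ε)
          (ℚₚ.+-mono-< p q))
    where open +-*-Solver

infixl 6 _+_ _-_
infixl 7 _*_
infix  8 -_

_+_ _*_ : ℝ → ℝ → ℝ
x + y = mkℝ (λ n → seq x n ℚ.+ seq y n) (+-cauchy x y)
x * y = mkℝ (λ n → seq x n ℚ.* seq y n) (*-cauchy x y)

-_ : ℝ → ℝ
- x = mkℝ (λ n → ℚ.- seq x n) (neg-cauchy x)

_-_ : ℝ → ℝ → ℝ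
x - y = x + (- y)

abs : ℝ → ℝ
abs x = mkℝ (λ n → ℚ.∣ seq x n ∣) (abs-cauchy x)

ℝ-rawRing : RawRing 0ℓ 0ℓ
ℝ-rawRing = record
  { Carrier = ℝ ; _≈_ = _≈_ ; _+_ = _+_ ; _*_ = _*_ ; -_ = -_ ; 0# = 0ℝ ; 1# = 1ℝ }

_⟶_ : (ℕ → ℝ) → ℝ → Set
s ⟶ l = ∀ ε → 0ℝ < ε → ∃ λ N → ∀ n → N ℕ.≤ n → abs (s n - l) < ε

abstract
  ≡⇒≈ : ∀ {x y} → (∀ n → seq x n ≡ seq y n) → x ≈ y
  ≡⇒≈ {x} {y} eq ε 0<ε = 0 , λ n _ →
    subst (ℚ._< ε) (sym (trans (cong (λ z → ℚ.∣ z ℚ.- seq y n ∣) (eq n)) (x-x≡0 (seq y n)))) 0<ε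

  ≈-refl : ∀ {x} → x ≈ x
  ≈-refl {x} = ≡⇒≈ {x} {x} (λ _ → refl)

  ≈-sym : ∀ {x y} → x ≈ y → y ≈ x
  ≈-sym {x} {y} p ε 0<ε = let (N , h) = p ε 0<ε in
    N , λ n N≤n → subst (ℚ._< ε) (∣-∣-swap (seq x n) (seq y n)) (h n N≤n)

  ≈-trans : ∀ {x y z} → x ≈ y → y ≈ z → x ≈ z
  ≈-trans {x} {y} {z} p q ε 0<ε =
    let (N₁ , h₁) = p (½ ℚ.* ε) (½-pos 0<ε)
        (N₂ , h₂) = q (½ ℚ.* ε) (½-pos 0<ε)
    in N₁ ℕ.⊔ N₂ , λ n N≤n → ℚₚ.≤-<-trans
      (triangle (seq x n) (seq y n) (seq z n))
      (subst (ℚ.∣ seq x n ℚ.- seq y n ∣ ℚ.+ ℚ.∣ seq y n ℚ.- seq z n ∣ ℚ.<_) (½+½ ε)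
        (ℚₚ.+-mono-< (h₁ n (ℕₚ.m⊔n≤o⇒m≤o N₁ N₂ N≤n)) (h₂ n (ℕₚ.m⊔n≤o⇒n≤o N₁ N₂ N≤n))))

  +-cong : ∀ {x y u v} → x ≈ y → u ≈ v → x + u ≈ y + v
  +-cong {x} {y} {u} {v} p q ε 0<ε =
    let (N₁ , h₁) = p (½ ℚ.* ε) (½-pos 0<ε)
        (N₂ , h₂) = q (½ ℚ.* ε) (½-pos 0<ε)
    in N₁ ℕ.⊔ N₂ , λ n N≤n →
      +-estimate (seq x n) (seq y n) (seq u n) (seq v n)
        (h₁ n (ℕₚ.m⊔n≤o⇒m≤o N₁ N₂ N≤n)) (h₂ n (ℕₚ.m⊔n≤o⇒n≤o N₁ N₂ N≤n))

  0+0≈0 : ∀ {x y} → x ≈ 0ℝ → y ≈ 0ℝ → x + y ≈ 0ℝ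
  0+0≈0 {x} {y} p q =
    ≈-trans {x + y} {0ℝ + 0ℝ} {0ℝ} (+-cong {x} {0ℝ} {y} {0ℝ} p q)
      (≡⇒≈ {0ℝ + 0ℝ} {0ℝ} (λ _ → refl))

  <-respʳ-≈ : ∀ {x y} → 0ℝ < x → x ≈ y → 0ℝ < y
  <-respʳ-≈ {x} {y} (ε , 0<ε , N₁ , h₁) p =
    let (N₂ , h₂) = p (½ ℚ.* ε) (½-pos 0<ε) in
    ½ ℚ.* ε , ½-pos 0<ε , N₁ ℕ.⊔ N₂ , λ n N≤n →
      let a = seq x n ; b = seq y n
          ε<a : ε ℚ.< a
          ε<a = subst (ℚ._< a) (ℚₚ.+-identityˡ ε) (h₁ n (ℕₚ.m⊔n≤o⇒m≤o N₁ N₂ N≤n))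
          a-b<½ε : a ℚ.- b ℚ.< ½ ℚ.* ε
          a-b<½ε = ℚₚ.≤-<-trans (p≤∣p∣ (a ℚ.- b)) (h₂ n (ℕₚ.m⊔n≤o⇒n≤o N₁ N₂ N≤n))
          ½ε+½ε<½ε+b : ½ ℚ.* ε ℚ.+ ½ ℚ.* ε ℚ.< ½ ℚ.* ε ℚ.+ b
          ½ε+½ε<½ε+b = subst₂ ℚ._<_ (sym (½+½ ε)) refl
            (ℚₚ.<-trans ε<a
              (subst (ℚ._< ½ ℚ.* ε ℚ.+ b)
                (solve 2 (λ a b → (a :- b) :+ b := a) refl a b)
                (ℚₚ.+-monoˡ-< b a-b<½ε)))
      in subst (ℚ._< b) (sym (ℚₚ.+-identityˡ (½ ℚ.* ε)))
        (subst₂ ℚ._<_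
          (solve 1 (λ h → (:- h) :+ (h :+ h) := h) refl (½ ℚ.* ε))
          (solve 2 (λ h b → (:- h) :+ (h :+ b) := b) refl (½ ℚ.* ε) b)
          (ℚₚ.+-monoʳ-< (ℚ.- (½ ℚ.* ε)) ½ε+½ε<½ε+b))
    where
    open +-*-Solver
    p≤∣p∣ : ∀ p → p ℚ.≤ ℚ.∣ p ∣
    p≤∣p∣ p with ℚₚ.≤-total 0ℚ p
    ... | inj₁ 0≤p = ℚₚ.≤-reflexive (sym (ℚₚ.0≤p⇒∣p∣≡p 0≤p))
    ... | inj₂ p≤0 = ℚₚ.≤-trans p≤0 (ℚₚ.0≤∣p∣ p)

  pos+zero : ∀ {x y} → 0ℝ < x → y ≈ 0ℝ → 0ℝ < x + y
  pos+zero {x} {y} p q = <-respʳ-≈ {x} {x + y} p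
    (≈-trans {x} {x + 0ℝ} {x + y}
      (≡⇒≈ {x} {x + 0ℝ} (λ n → sym (ℚₚ.+-identityʳ (seq x n))))
      (+-cong {x} {x} {0ℝ} {y} (≈-refl {x}) (≈-sym {y} {0ℝ} q)))

  zero+pos : ∀ {x y} → x ≈ 0ℝ → 0ℝ < y → 0ℝ < x + y
  zero+pos {x} {y} p q = <-respʳ-≈ {y + x} {x + y} (pos+zero {y} {x} q p)
    (≡⇒≈ {y + x} {x + y} (λ n → ℚₚ.+-comm (seq y n) (seq x n)))

  pos+pos : ∀ {x y} → 0ℝ < x → 0ℝ < y → 0ℝ < x + y
  pos+pos {x} {y} (ε , 0<ε , N₁ , h₁) (η , 0<η , N₂ , h₂) =
    ε ℚ.+ η , ℚₚ.+-mono-< 0<ε 0<η , N₁ ℕ.⊔ N₂ , λ n N≤n →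
      subst (ℚ._< seq x n ℚ.+ seq y n)
        (solve 2 (λ a b → (con 0ℚ :+ a) :+ (con 0ℚ :+ b) := con 0ℚ :+ (a :+ b)) refl ε η)
        (ℚₚ.+-mono-< (h₁ n (ℕₚ.m⊔n≤o⇒m≤o N₁ N₂ N≤n)) (h₂ n (ℕₚ.m⊔n≤o⇒n≤o N₁ N₂ N≤n)))
    where open +-*-Solver

record ℂ : Set where
  constructor _+i_
  field
    re im : ℝ

open ℂ public

infix 4 _≈ᶜ_

_≈ᶜ_ : Rel ℂ 0ℓ
z ≈ᶜ w = re z ≈ re w × im z ≈ im w

ℂ-rawRing : RawRing 0ℓ 0ℓ
ℂ-rawRing = record
  { Carrier = ℂ
  ; _≈_     = _≈ᶜ_
  ; _+_     = λ z w → (re z + re w) +i (im z + im w)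
  ; _*_     = λ z w → (re z * re w - im z * im w) +i (re z * im w + im z * re w)
  ; -_      = λ z → (- re z) +i (- im z)
  ; 0#      = 0ℝ +i 0ℝ
  ; 1#      = 1ℝ +i 0ℝ
  }

fromℝ : ℝ → ℂ
fromℝ x = x +i 0ℝ

i : ℂ
i = 0ℝ +i 1ℝ

_⟶ᶜ_ : (ℕ → ℂ) → ℂ → Set
s ⟶ᶜ l = (λ n → re (s n)) ⟶ re l × (λ n → im (s n)) ⟶ im l

module LinearAlgebra (R : RawRing 0ℓ 0ℓ) where

  open RawRing R public
    using (Carrier; 0#; 1#)
    renaming (_≈_ to _≈#_; _+_ to _+#_; _*_ to _*#_; -_ to -#_)

  Matrix : ℕ → Set
  Matrix n = Fin n → Fin n → Carrier

  infix  4 _≋_ _≋ₘ_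
  infixl 6 _+ₘ_ _-ₘ_
  infixl 7 _·_ _*ᵥ_ _*ₘ_ _•_ _•ₘ_ _⊗_ _⊗ₘ_
  infixr 8 _^ₘ_

  _≋_ : ∀ {n} → Rel (Vector Carrier n) 0ℓ
  x ≋ y = ∀ u → x u ≈# y u

  _≋ₘ_ : ∀ {n} → Rel (Matrix n) 0ℓ
  A ≋ₘ B = ∀ u v → A u v ≈# B u v

  ∑ : ∀ {n} → Vector Carrier n → Carrier
  ∑ = sum (RawRing.+-rawMonoid R)

  _·_ : ∀ {n} → Vector Carrier n → Vector Carrier n → Carrier
  x · y = ∑ λ u → x u *# y u

  𝟎 𝟏 : ∀ {n} → Vector Carrier n
  𝟎 {n} = replicate n 0#
  𝟏 {n} = replicate n 1#

  _•_ : ∀ {n} → Carrier → Vector Carrier n → Vector Carrier n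
  (a • x) u = a *# x u

  diagonal : ∀ {n} → Vector Carrier n → Matrix n
  diagonal d u v = if does (u ≟ᶠ v) then d u else 0#

  I : ∀ {n} → Matrix n
  I = diagonal 𝟏

  _+ₘ_ _-ₘ_ _*ₘ_ : ∀ {n} → Matrix n → Matrix n → Matrix n
  (A +ₘ B) u v = A u v +# B u v
  (A -ₘ B) u v = A u v +# (-# B u v)
  (A *ₘ B) u v = A u · λ w → B w v

  _•ₘ_ : ∀ {n} → Carrier → Matrix n → Matrix n
  (a •ₘ A) u v = a *# A u v

  _*ᵥ_ : ∀ {n} → Matrix n → Vector Carrier n → Vector Carrier n
  (A *ᵥ x) u = A u · x

  _^ₘ_ : ∀ {n} → Matrix n → ℕ → Matrix n
  A ^ₘ zero  = I
  A ^ₘ suc k = A *ₘ A ^ₘ k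

  -- Kronecker products, with the pair (u , v) encoded as combine u v.
  _⊗_ : ∀ {n k} → Vector Carrier n → Vector Carrier k → Vector Carrier (n ℕ.* k)
  _⊗_ {n} {k} x y p = x (quotient k p) *# y (remainder {n} k p)

  _⊗ₘ_ : ∀ {n k} → Matrix n → Matrix k → Matrix (n ℕ.* k)
  _⊗ₘ_ {n} {k} A B p q =
    A (quotient k p) (quotient k q) *# B (remainder {n} k p) (remainder {n} k q)

module Real    = LinearAlgebra ℝ-rawRing
module Complex = LinearAlgebra ℂ-rawRing

open Real using (_≋ₘ_; _·_; 𝟎; 𝟏; ∑; diagonal; _+ₘ_; _-ₘ_; _⊗_; _⊗ₘ_)

Matrixℝ Matrixℂ : ℕ → Set
Matrixℝ = Real.Matrix
Matrixℂ = Complex.Matrix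

-- Σ_{k < N} Z^k / k!
expPartial : ∀ {n} → Matrixℂ n → ℕ → Matrixℂ n
expPartial Z N u v = Complex.∑ {N} λ k →
  fromℝ (fromℚ ((+ 1 ℚ./ (toℕ k !)) {{toℕ k !≢0}})) Complex.*# (Z Complex.^ₘ toℕ k) u v

-- E = exp Z, entrywise; such an E always exists and is unique up to _≈ᶜ_.
IsExp : ∀ {n} → Matrixℂ n → Matrixℂ n → Set
IsExp Z E = ∀ u v → (λ N → expPartial Z N u v) ⟶ᶜ E u v

-- Finite simple graphs on Fin n with positive edge weights; `weight` is the
-- weighted adjacency matrix.
record Graph (n : ℕ) : Set₁ where
  field
    Adj         : Rel (Fin n) 0ℓ
    adj?        : Decidable Adj
    adj-sym     : Symmetric Adj
    adj-irrefl  : ∀ {u} → ¬ Adj u u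
    weight      : Matrixℝ n
    weight-sym  : ∀ u v → weight u v ≈ weight v u
    weight-pos  : ∀ {u v} → Adj u v → 0ℝ < weight u v
    weight-zero : ∀ {u v} → ¬ Adj u v → weight u v ≈ 0ℝ

open Graph public

Connected : ∀ {n} → Graph n → Set
Connected X = ∀ u v → Star (Adj X) u v

data MatrixKind : Set where
  adjacency laplacian signlessLaplacian : MatrixKind

degrees : ∀ {n} → Graph n → Matrixℝ n
degrees X = diagonal λ u → ∑ (weight X u)

⟦_⟧ : MatrixKind → ∀ {n} → Graph n → Matrixℝ n
⟦ adjacency         ⟧ X = weight X
⟦ laplacian         ⟧ X = degrees X -ₘ weight X
⟦ signlessLaplacian ⟧ X = degrees X +ₘ weight X

Regular : ∀ {n} → Graph n → Set
Regular X = ∃ λ d → degrees X ≋ₘ d Real.•ₘ Real.I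

record IsCluster {n} (G : Graph n) (C S : Subset n) : Set where
  field
    size        : 2 ℕ.≤ ∣ C ∣
    independent : ∀ {a b} → a ∈ C → b ∈ C → ¬ Adj G a b
    neighbours  : ∀ {a} → a ∈ C → ∀ v → Adj G a v ⇔ v ∈ S
    constant    : ∀ {v} → v ∈ S → ∀ {a b} → a ∈ C → b ∈ C →
                  weight G a v ≈ weight G b v

first : ∀ c m → Subset (c ℕ.+ m)
first c m = Vec.replicate c inside Vec.++ Vec.replicate m outside

module _ {c m : ℕ} where

  liftAdj : Rel (Fin c) 0ℓ → Rel (Fin c ⊎ Fin m) 0ℓ
  liftAdj R (inj₁ a) (inj₁ b) = R a b
  liftAdj R _        _        = ⊥

  liftWeight : Matrixℝ c → Fin c ⊎ Fin m → Fin c ⊎ Fin m → ℝ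
  liftWeight ω (inj₁ a) (inj₁ b) = ω a b
  liftWeight ω _        _        = 0ℝ

  module _ (H : Graph c) where

    lift-dec : Decidable (liftAdj (Adj H))
    lift-dec (inj₁ a) (inj₁ b) = adj? H a b
    lift-dec (inj₁ _) (inj₂ _) = no λ ()
    lift-dec (inj₂ _) (inj₁ _) = no λ ()
    lift-dec (inj₂ _) (inj₂ _) = no λ ()

    lift-sym : ∀ p q → liftAdj (Adj H) p q → liftAdj (Adj H) q p
    lift-sym (inj₁ a) (inj₁ b) e = adj-sym H e

    lift-irrefl : ∀ p → ¬ liftAdj (Adj H) p p
    lift-irrefl (inj₁ a) e = adj-irrefl H e

    lift-weight-sym : ∀ p q → liftWeight (weight H) p q ≈ liftWeight (weight H) q p
    lift-weight-sym (inj₁ a) (inj₁ b) = weight-sym H a b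
    lift-weight-sym (inj₁ _) (inj₂ _) = ≈-refl {0ℝ}
    lift-weight-sym (inj₂ _) (inj₁ _) = ≈-refl {0ℝ}
    lift-weight-sym (inj₂ _) (inj₂ _) = ≈-refl {0ℝ}

    lift-pos : ∀ p q → liftAdj (Adj H) p q → 0ℝ < liftWeight (weight H) p q
    lift-pos (inj₁ a) (inj₁ b) e = weight-pos H e

    lift-zero : ∀ p q → ¬ liftAdj (Adj H) p q → liftWeight (weight H) p q ≈ 0ℝ
    lift-zero (inj₁ a) (inj₁ b) ¬e = weight-zero H ¬e
    lift-zero (inj₁ _) (inj₂ _) _ = ≈-refl {0ℝ}
    lift-zero (inj₂ _) (inj₁ _) _ = ≈-refl {0ℝ}
    lift-zero (inj₂ _) (inj₂ _) _ = ≈-refl {0ℝ}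

-- H together with m isolated vertices, placed after those of H.
withIsolated : ∀ {c} m → Graph c → Graph (c ℕ.+ m)
withIsolated {c} m H = record
  { Adj         = liftAdj (Adj H) on splitAt c {m}
  ; adj?        = λ u v → lift-dec H (splitAt c u) (splitAt c v)
  ; adj-sym     = λ {u} {v} → lift-sym H (splitAt c u) (splitAt c v)
  ; adj-irrefl  = λ {u} → lift-irrefl H (splitAt c u)
  ; weight      = liftWeight (weight H) on splitAt c {m}
  ; weight-sym  = λ u v → lift-weight-sym H (splitAt c u) (splitAt c v)
  ; weight-pos  = λ {u} {v} → lift-pos H (splitAt c u) (splitAt c v)
  ; weight-zero = λ {u} {v} → lift-zero H (splitAt c u) (splitAt c v)
  }

-- Adding weights preserves them when the edge sets are disjoint, as they are
-- when H is placed on an independent set of G.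
_∪_ : ∀ {n} → Graph n → Graph n → Graph n
G ∪ H = record
  { Adj         = λ u v → Adj G u v ⊎ Adj H u v
  ; adj?        = λ u v → adj? G u v ⊎-dec adj? H u v
  ; adj-sym     = λ { (inj₁ e) → inj₁ (adj-sym G e) ; (inj₂ e) → inj₂ (adj-sym H e) }
  ; adj-irrefl  = λ { (inj₁ e) → adj-irrefl G e ; (inj₂ e) → adj-irrefl H e }
  ; weight      = weight G +ₘ weight H
  ; weight-sym  = λ u v → +-cong {weight G u v} {weight G v u} {weight H u v} {weight H v u}
                    (weight-sym G u v) (weight-sym H u v)
  ; weight-pos  = λ {u} {v} → pos u v
  ; weight-zero = λ {u} {v} ¬e → 0+0≈0 {weight G u v} {weight H u v}
                    (weight-zero G λ e → ¬e (inj₁ e)) (weight-zero H λ e → ¬e (inj₂ e))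
  }
  where
  pos : ∀ u v → Adj G u v ⊎ Adj H u v → 0ℝ < weight G u v + weight H u v
  pos u v e with adj? G u v | adj? H u v
  ... | yes g | yes h = pos+pos {weight G u v} {weight H u v} (weight-pos G g) (weight-pos H h)
  ... | yes g | no ¬h = pos+zero {weight G u v} {weight H u v} (weight-pos G g) (weight-zero H ¬h)
  ... | no ¬g | yes h = zero+pos {weight G u v} {weight H u v} (weight-zero G ¬g) (weight-pos H h)
  pos u v (inj₁ g) | no ¬g | no ¬h = contradiction g ¬g
  pos u v (inj₂ h) | no ¬g | no ¬h = contradiction h ¬h

-- G(H), where H lives on the first c vertices of G.
_⟨_⟩ : ∀ {c m} → Graph (c ℕ.+ m) → Graph c → Graph (c ℕ.+ m)
_⟨_⟩ {m = m} G H = G ∪ withIsolated m H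

-- x̃ = [xᵀ , 0ᵀ]ᵀ
extend : ∀ {c} m → Vector ℝ c → Vector ℝ (c ℕ.+ m)
extend m x = x ++ 𝟎 {m}

module _ {n : ℕ} where

  I-sym : ∀ (u v : Fin n) → Real.I u v ≡ Real.I v u
  I-sym u v with u ≟ᶠ v | v ≟ᶠ u
  ... | yes _ | yes _ = refl
  ... | no  _ | no  _ = refl
  ... | yes p | no ¬p = contradiction (sym p) ¬p
  ... | no ¬p | yes p = contradiction (sym p) ¬p

  I-diag : ∀ {u v : Fin n} → u ≡ v → Real.I u v ≡ 1ℝ
  I-diag {u} {v} p with u ≟ᶠ v
  ... | yes _ = refl
  ... | no ¬p = contradiction p ¬p

  I-off : ∀ {u v : Fin n} → ¬ u ≡ v → Real.I u v ≡ 0ℝ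
  I-off {u} {v} ¬p with u ≟ᶠ v
  ... | yes p = contradiction p ¬p
  ... | no _  = refl

*-I-zero : ∀ {n} x (u v : Fin n) → (u ≡ v → x ≈ 0ℝ) → x * Real.I u v ≈ 0ℝ
*-I-zero x u v h = go (u ≟ᶠ v)
  where
  go : Dec (u ≡ v) → x * Real.I u v ≈ 0ℝ
  go (yes p) = ≈-trans {x * Real.I u v} {x} {0ℝ}
    (≡⇒≈ {x * Real.I u v} {x} λ k →
      trans (cong (λ z → seq x k ℚ.* seq z k) (I-diag p)) (ℚₚ.*-identityʳ (seq x k)))
    (h p)
  go (no ¬p) = ≡⇒≈ {x * Real.I u v} {0ℝ} λ k →
    trans (cong (λ z → seq x k ℚ.* seq z k) (I-off ¬p)) (ℚₚ.*-zeroʳ (seq x k))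

*-I-pos : ∀ {n} x {u v : Fin n} → u ≡ v → 0ℝ < x → 0ℝ < x * Real.I u v
*-I-pos x {u} {v} p 0<x = <-respʳ-≈ {x} {x * Real.I u v} 0<x
  (≡⇒≈ {x} {x * Real.I u v} λ k → sym
    (trans (cong (λ z → seq x k ℚ.* seq z k) (I-diag p)) (ℚₚ.*-identityʳ (seq x k))))

*-I-sym : ∀ {n} x y (u v : Fin n) → x ≈ y → x * Real.I u v ≈ y * Real.I v u
*-I-sym x y u v x≈y = go (u ≟ᶠ v)
  where
  at : ∀ z (w : Fin _) {w′} → w ≡ w′ → z * Real.I w w′ ≈ z
  at z w {w′} p = ≡⇒≈ {z * Real.I w w′} {z} λ k →
    trans (cong (λ r → seq z k ℚ.* seq r k) (I-diag p)) (ℚₚ.*-identityʳ (seq z k))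
  go : Dec (u ≡ v) → x * Real.I u v ≈ y * Real.I v u
  go (yes p) = ≈-trans {x * Real.I u v} {x} {y * Real.I v u} (at x u p)
    (≈-trans {x} {y} {y * Real.I v u} x≈y
      (≈-sym {y * Real.I v u} {y} (at y v (sym p))))
  go (no ¬p) = ≈-trans {x * Real.I u v} {0ℝ} {y * Real.I v u}
    (*-I-zero x u v λ p → contradiction p ¬p)
    (≈-sym {y * Real.I v u} {0ℝ} (*-I-zero y v u λ p → contradiction (sym p) ¬p))

*-comm : ∀ x y → x * y ≈ y * x
*-comm x y = ≡⇒≈ {x * y} {y * x} λ k → ℚₚ.*-comm (seq x k) (seq y k)

-- The Cartesian product, given by A(X □ Y) = A(X) ⊗ I + I ⊗ A(Y).
infixl 7 _□_

_□_ : ∀ {n k} → Graph n → Graph k → Graph (n ℕ.* k)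
_□_ {n} {k} X Y = record
  { Adj         = λ p q → (Adj X (π₁ p) (π₁ q) × π₂ p ≡ π₂ q)
                        ⊎ (π₁ p ≡ π₁ q × Adj Y (π₂ p) (π₂ q))
  ; adj?        = λ p q → (adj? X (π₁ p) (π₁ q) ×-dec (π₂ p ≟ᶠ π₂ q))
                  ⊎-dec ((π₁ p ≟ᶠ π₁ q) ×-dec adj? Y (π₂ p) (π₂ q))
  ; adj-sym     = λ { (inj₁ (e , r)) → inj₁ (adj-sym X e , sym r)
                    ; (inj₂ (r , e)) → inj₂ (sym r , adj-sym Y e) }
  ; adj-irrefl  = λ { (inj₁ (e , _)) → adj-irrefl X e ; (inj₂ (_ , e)) → adj-irrefl Y e }
  ; weight      = weight X ⊗ₘ Real.I {k} +ₘ Real.I {n} ⊗ₘ weight Y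
  ; weight-sym  = λ p q → +-cong {X⊗I p q} {X⊗I q p} {I⊗Y p q} {I⊗Y q p} (X-sym p q) (Y-sym p q)
  ; weight-pos  = λ {p} {q} → pos p q
  ; weight-zero = λ {p} {q} ¬e → 0+0≈0 {X⊗I p q} {I⊗Y p q}
      (X-zero p q λ r → weight-zero X λ e → ¬e (inj₁ (e , r)))
      (Y-zero p q λ r → weight-zero Y λ e → ¬e (inj₂ (r , e)))
  }
  where
  π₁ : Fin (n ℕ.* k) → Fin n
  π₁ = quotient k
  π₂ : Fin (n ℕ.* k) → Fin k
  π₂ = remainder {n} k
  X⊗I I⊗Y : Matrixℝ (n ℕ.* k)
  X⊗I = weight X ⊗ₘ Real.I {k}
  I⊗Y = Real.I {n} ⊗ₘ weight Y
  Y⊗I : Matrixℝ (n ℕ.* k)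
  Y⊗I p q = weight Y (π₂ p) (π₂ q) * Real.I (π₁ p) (π₁ q)

  comm : ∀ p q → I⊗Y p q ≈ Y⊗I p q
  comm p q = *-comm (Real.I (π₁ p) (π₁ q)) (weight Y (π₂ p) (π₂ q))

  X-sym : ∀ p q → X⊗I p q ≈ X⊗I q p
  X-sym p q = *-I-sym (weight X (π₁ p) (π₁ q)) (weight X (π₁ q) (π₁ p)) (π₂ p) (π₂ q)
    (weight-sym X (π₁ p) (π₁ q))

  Y-sym : ∀ p q → I⊗Y p q ≈ I⊗Y q p
  Y-sym p q = ≈-trans {I⊗Y p q} {Y⊗I p q} {I⊗Y q p} (comm p q)
    (≈-trans {Y⊗I p q} {Y⊗I q p} {I⊗Y q p}
      (*-I-sym (weight Y (π₂ p) (π₂ q)) (weight Y (π₂ q) (π₂ p)) (π₁ p) (π₁ q)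
        (weight-sym Y (π₂ p) (π₂ q)))
      (≈-sym {I⊗Y q p} {Y⊗I q p} (comm q p)))

  X-zero : ∀ p q → (π₂ p ≡ π₂ q → weight X (π₁ p) (π₁ q) ≈ 0ℝ) → X⊗I p q ≈ 0ℝ
  X-zero p q = *-I-zero (weight X (π₁ p) (π₁ q)) (π₂ p) (π₂ q)

  Y-zero : ∀ p q → (π₁ p ≡ π₁ q → weight Y (π₂ p) (π₂ q) ≈ 0ℝ) → I⊗Y p q ≈ 0ℝ
  Y-zero p q h = ≈-trans {I⊗Y p q} {Y⊗I p q} {0ℝ} (comm p q)
    (*-I-zero (weight Y (π₂ p) (π₂ q)) (π₁ p) (π₁ q) h)

  Y-pos : ∀ p q → π₁ p ≡ π₁ q → Adj Y (π₂ p) (π₂ q) → 0ℝ < I⊗Y p q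
  Y-pos p q r e = <-respʳ-≈ {Y⊗I p q} {I⊗Y p q}
    (*-I-pos (weight Y (π₂ p) (π₂ q)) r (weight-pos Y e))
    (≈-sym {I⊗Y p q} {Y⊗I p q} (comm p q))

  pos : ∀ p q → (Adj X (π₁ p) (π₁ q) × π₂ p ≡ π₂ q) ⊎ (π₁ p ≡ π₁ q × Adj Y (π₂ p) (π₂ q)) →
        0ℝ < X⊗I p q + I⊗Y p q
  pos p q (inj₁ (e , r)) = pos+zero {X⊗I p q} {I⊗Y p q}
    (*-I-pos (weight X (π₁ p) (π₁ q)) r (weight-pos X e))
    (Y-zero p q λ s → contradiction (subst (Adj X (π₁ p)) (sym s) e) (adj-irrefl X))
  pos p q (inj₂ (s , e)) = zero+pos {X⊗I p q} {I⊗Y p q}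
    (X-zero p q λ r → contradiction (subst (Adj Y (π₂ p)) (sym r) e) (adj-irrefl Y))
    (Y-pos p q s e)

complexify : ∀ {n} → Vector ℝ n → Vector ℂ n
complexify x u = fromℝ (x u)

IsTransition : ∀ {n} → Matrixℝ n → ℝ → Matrixℂ n → Set
IsTransition M t = IsExp ((i Complex.*# fromℝ t) Complex.•ₘ λ u v → fromℝ (M u v))

record PST {n} (M : MatrixKind) (X : Graph n) (x y : Vector ℝ n) (τ : ℝ) : Set where
  field
    source≢0     : ¬ x Real.≋ 𝟎
    target≢0     : ¬ y Real.≋ 𝟎
    τ-positive   : 0ℝ < τ
    U            : Matrixℂ n
    isTransition : IsTransition (⟦ M ⟧ X) τ U
    γ            : ℂ
    transfer     : (U Complex.*ᵥ complexify x) Complex.≋ (γ Complex.• complexify y)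

Periodic : ∀ {n} → MatrixKind → Graph n → Vector ℝ n → ℝ → Set
Periodic M X w τ = PST M X w w τ

{-# OPTIONS --safe #-}

-- In each regular graph the three matrices M differ by a sign and a scalar
-- matrix. The scalar contributes a phase, and as the vectors are real, the sign
-- amounts to complex conjugation; so state transfer does not depend on M. A
-- vector on C with zero sum is annihilated by A(G), and all vertices of C have
-- equal degree in G, so M(G(H)) x̃ is the padding of M(H) x + μ x, again of zero
-- sum. Hence exp(iτ M(G(H))) x̃ = e^{iτμ} (exp(iτ M(H)) x)~, and the exponential
-- of M(X) ⊗ I + I ⊗ M(K) acts as a tensor product. Both products of
-- exponentials come from the Cauchy product of exponential series.
module Submission where

open import Level using (0ℓ)
import Algebra.Properties.Ring as RingProperties
import Algebra.Properties.Semiring.Mult as SemiringMult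
import Algebra.Properties.Semiring.Sum as SemiringSum
import Algebra.Solver.Ring.NaturalCoefficients.Default as SemiringSolver
open import Algebra.Bundles using (CommutativeRing)
open import Algebra.Bundles.Raw using (RawRing)
open import Data.Fin.Base
  using (Fin; zero; suc; toℕ; splitAt; quotient; remainder; combine; _↑ˡ_; _↑ʳ_)
import Data.Fin.Properties as Finₚ
open import Data.Fin.Subset using (Subset; _∈_; inside; outside)
open import Data.Integer.Base as ℤ using (+_)
import Data.Integer.Properties as ℤₚ
open import Data.Nat.Base as ℕ using (ℕ; zero; suc; _!; z≤n; s≤s) renaming (_+_ to _+ℕ_)
open import Data.Nat.GeneralisedArithmetic using (iterate)
import Data.Nat.Properties as ℕₚ
open import Data.Product.Base using (∃; _×_; _,_; proj₁; proj₂)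
open import Data.Rational.Base as ℚ using (ℚ; 0ℚ; 1ℚ; ½)
import Data.Rational.Properties as ℚₚ
import Data.Rational.Solver as ℚSolver
import Data.Rational.Unnormalised.Base as ℚᵘ
import Data.Rational.Unnormalised.Properties as ℚᵘₚ
open import Data.Sum.Base using (_⊎_; inj₁; inj₂)
import Data.Vec.Base as Vec
open import Data.Vec.Functional using (Vector; _++_)
import Data.Vec.Functional.Properties as Vectorₚ
import Data.Vec.Properties as Vecₚ
open import Defs
  using (½-pos; ½+½; module LinearAlgebra; MatrixKind; adjacency; laplacian; signlessLaplacian)
open import Function.Base using (_∘_)
open import Function.Bundles using (module Equivalence)
import Relation.Binary.PropositionalEquality as ≡
open ≡ using (_≡_)
import Relation.Binary.Reasoning.Setoid as SetoidReasoning
open import Relation.Nullary.Decidable using (yes; no)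
open import Relation.Nullary.Negation using (¬_)

-- No identity exp (A + B) = exp A exp B between matrices is proved. A coordinate of exp (cA) x is
-- the sum of c^k (A^k x)_u / k!, so each claim about an evolution becomes one about a scalar
-- sequence and the value of its exponential series. If one application of a matrix acts like a
-- derivation on two ingredients (a scalar and a vector, or two tensor factors), then iterating it
-- yields a binomial convolution of the two orbits, whose value is the product of their values. The
-- orbit A^k x stays real and the powers of c = iτ stay outside: conjugation then touches only c,
-- and the cluster argument is one about real matrices. Convergence is quantitative throughout.
-- Orbits grow at most like C B^k, so division by k! leaves a multiple of 4^-k: one factor 2^-k
-- makes the partial sums converge, the other pays for the terms that a product of partial sums has
-- beyond the Cauchy product. A second obstacle is that a state is only known not to be the zero
-- vector; constructively this provides no coordinate with an inverse, so that tensor products are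
-- shown to be non-zero by a separate argument.

-- Rational bounds

module Rational where

  open ≡ using (refl; sym; trans; cong; subst; subst₂)
  open ℚSolver using (module +-*-Solver)

  module ℚMult = SemiringMult (CommutativeRing.semiring ℚₚ.+-*-commutativeRing)

  -- As a multiple of 1 it satisfies its successor rule by definition and is multiplicative by
  -- `×1-homo-*`, which the fraction n / 1 would not give directly.
  fromℕ : ℕ → ℚ
  fromℕ n = n ℚMult.× 1ℚ

  toℚᵘ-fromℕ : ∀ n → ℚ.toℚᵘ (fromℕ n) ℚᵘ.≃ ℚᵘ.mkℚᵘ (+ n) 0
  toℚᵘ-fromℕ zero    = ℚᵘₚ.≃-refl
  toℚᵘ-fromℕ (suc n) = ℚᵘₚ.≃-trans (ℚₚ.toℚᵘ-homo-+ 1ℚ (fromℕ n))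
    (ℚᵘₚ.≃-trans (ℚᵘₚ.+-congʳ ℚᵘ.1ℚᵘ (toℚᵘ-fromℕ n))
      (ℚᵘ.*≡* (cong (λ m → (+ 1 ℤ.+ m) ℤ.* + 1) (ℤₚ.*-identityʳ (+ n)))))

  fromℕ*1/ : ∀ n .{{_ : ℕ.NonZero n}} → fromℕ n ℚ.* (+ 1 ℚ./ n) ≡ 1ℚ
  fromℕ*1/ (suc n) = ℚₚ.toℚᵘ-injective
    (ℚᵘₚ.≃-trans (ℚₚ.toℚᵘ-homo-* (fromℕ (suc n)) (+ 1 ℚ./ suc n))
      (ℚᵘₚ.≃-trans
        (ℚᵘₚ.*-cong (toℚᵘ-fromℕ (suc n)) (ℚₚ.toℚᵘ-fromℚᵘ (ℚᵘ.mkℚᵘ (+ 1) n)))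
        (ℚᵘ.*≡* (trans (ℤₚ.*-identityʳ (+ suc n ℤ.* + 1)) (trans (ℤₚ.*-identityʳ (+ suc n))
          (sym (trans (ℤₚ.*-identityˡ _) (cong (λ m → + suc m) (ℕₚ.+-identityʳ n)))))))))

  archimedean : ∀ q → ∃ λ n → q ℚ.≤ fromℕ n
  archimedean (ℚ.mkℚ m d _) = ℤ.∣ m ∣ , ℚₚ.toℚᵘ-cancel-≤
    (ℚᵘₚ.≤-respʳ-≃ (ℚᵘₚ.≃-sym (toℚᵘ-fromℕ ℤ.∣ m ∣)) (ℚᵘ.*≤* (bound m d)))
    where
    bound : ∀ m d → m ℤ.* + 1 ℤ.≤ + ℤ.∣ m ∣ ℤ.* + suc d
    bound (+ m)      d = subst₂ ℤ._≤_ (ℤₚ.pos-* m 1) (ℤₚ.pos-* m (suc d))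
                           (ℤ.+≤+ (ℕₚ.*-monoʳ-≤ m (s≤s z≤n)))
    bound (ℤ.-[1+ m ]) d = ℤ.-≤+

  0≤1 : 0ℚ ℚ.≤ 1ℚ
  0≤1 = ℚₚ.nonNegative⁻¹ 1ℚ

  *-mono-≤ : ∀ {p q r s} → 0ℚ ℚ.≤ p → 0ℚ ℚ.≤ s → p ℚ.≤ q → r ℚ.≤ s → p ℚ.* r ℚ.≤ q ℚ.* s
  *-mono-≤ {p} {q} {r} {s} 0≤p 0≤s p≤q r≤s = ℚₚ.≤-trans
    (ℚₚ.*-monoˡ-≤-nonNeg p {{ℚ.nonNegative 0≤p}} r≤s)
    (ℚₚ.*-monoʳ-≤-nonNeg s {{ℚ.nonNegative 0≤s}} p≤q)

  *-monoʳ : ∀ {p q r} → 0ℚ ℚ.≤ p → q ℚ.≤ r → p ℚ.* q ℚ.≤ p ℚ.* r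
  *-monoʳ {p} 0≤p = ℚₚ.*-monoˡ-≤-nonNeg p {{ℚ.nonNegative 0≤p}}

  0≤* : ∀ {p q} → 0ℚ ℚ.≤ p → 0ℚ ℚ.≤ q → 0ℚ ℚ.≤ p ℚ.* q
  0≤* {p} {q} 0≤p 0≤q = subst (ℚ._≤ p ℚ.* q) (ℚₚ.*-zeroʳ p) (*-monoʳ 0≤p 0≤q)

  0≤fromℕ : ∀ n → 0ℚ ℚ.≤ fromℕ n
  0≤fromℕ zero    = ℚₚ.≤-refl
  0≤fromℕ (suc n) = ℚₚ.+-mono-≤ 0≤1 (0≤fromℕ n)

  fromℕ-mono : ∀ {m n} → m ℕ.≤ n → fromℕ m ℚ.≤ fromℕ n
  fromℕ-mono {n = n} z≤n = 0≤fromℕ n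
  fromℕ-mono (s≤s m≤n)   = ℚₚ.+-monoʳ-≤ 1ℚ (fromℕ-mono m≤n)

  ½^_ : ℕ → ℚ
  ½^ zero  = 1ℚ
  ½^ suc n = ½ ℚ.* ½^ n

  0≤½^ : ∀ n → 0ℚ ℚ.≤ ½^ n
  0≤½^ zero    = 0≤1
  0≤½^ (suc n) = 0≤* (ℚₚ.nonNegative⁻¹ ½) (0≤½^ n)

  ½^-step : ∀ n → ½^ suc n ℚ.≤ ½^ n
  ½^-step n = subst (½^ suc n ℚ.≤_) (ℚₚ.*-identityˡ (½^ n))
    (ℚₚ.*-monoʳ-≤-nonNeg (½^ n) {{ℚ.nonNegative (0≤½^ n)}} (ℚₚ.<⇒≤ {½} {1ℚ} (ℚ.*<* (ℤ.+<+ (s≤s (s≤s z≤n))))))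

  ½^-anti : ∀ {m n} → m ℕ.≤ n → ½^ n ℚ.≤ ½^ m
  ½^-anti m≤n = go (ℕₚ.≤⇒≤′ m≤n)
    where
    go : ∀ {m n} → m ℕ.≤′ n → ½^ n ℚ.≤ ½^ m
    go ℕ.≤′-refl              = ℚₚ.≤-refl
    go {n = suc n} (ℕ.≤′-step p) = ℚₚ.≤-trans (½^-step n) (go p)

  ½^≤1 : ∀ n → ½^ n ℚ.≤ 1ℚ
  ½^≤1 n = ½^-anti {0} {n} z≤n

  fromℕ*½^≤1 : ∀ n → fromℕ n ℚ.* ½^ n ℚ.≤ 1ℚ
  fromℕ*½^≤1 zero    = subst (ℚ._≤ 1ℚ) (sym (ℚₚ.*-zeroˡ 1ℚ)) 0≤1
  fromℕ*½^≤1 (suc n) = subst (ℚ._≤ 1ℚ)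
    (solve 2 (λ a h → con ½ :* h :+ con ½ :* (a :* h) := (con 1ℚ :+ a) :* (con ½ :* h)) refl
      (fromℕ n) (½^ n))
    (ℚₚ.+-mono-≤ (*-monoʳ (ℚₚ.nonNegative⁻¹ ½) (½^≤1 n))
                 (*-monoʳ (ℚₚ.nonNegative⁻¹ ½) (fromℕ*½^≤1 n)))
    where open +-*-Solver

  -- With A ≤ N ε by the Archimedean property, A 2^-N ≤ ε N 2^-N ≤ ε, because N ≤ 2^N.
  ½^-vanishes : ∀ A {ε} → 0ℚ ℚ.≤ A → 0ℚ ℚ.< ε → ∃ λ N → ∀ n → N ℕ.≤ n → A ℚ.* ½^ n ℚ.≤ ε
  ½^-vanishes A {ε} 0≤A 0<ε =
    let instance ε⁺  = ℚ.positive 0<ε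
                 ε≢0 = ℚₚ.pos⇒nonZero ε
        N , q≤N = archimedean (A ℚ.* ℚ.1/ ε)
        A≤N*ε : A ℚ.≤ fromℕ N ℚ.* ε
        A≤N*ε = subst (ℚ._≤ fromℕ N ℚ.* ε)
          (trans (ℚₚ.*-assoc A (ℚ.1/ ε) ε)
            (trans (cong (A ℚ.*_) (ℚₚ.*-inverseˡ ε)) (ℚₚ.*-identityʳ A)))
          (ℚₚ.*-monoʳ-≤-nonNeg ε {{ℚₚ.pos⇒nonNeg ε}} q≤N)
    in N , λ n N≤n → ℚₚ.≤-trans (*-monoʳ 0≤A (½^-anti N≤n))
      (ℚₚ.≤-trans (ℚₚ.*-monoʳ-≤-nonNeg (½^ N) {{ℚ.nonNegative (0≤½^ N)}} A≤N*ε)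
        (subst₂ ℚ._≤_
          (solve 3 (λ a e h → e :* (a :* h) := (a :* e) :* h) refl (fromℕ N) ε (½^ N))
          (ℚₚ.*-identityʳ ε)
          (*-monoʳ (ℚₚ.<⇒≤ 0<ε) (fromℕ*½^≤1 N))))
    where open +-*-Solver

  inv! : ℕ → ℚ
  inv! n = (+ 1 ℚ./ (n !)) {{n ℕₚ.!≢0}}

  fromℕ*inv! : ∀ n → fromℕ (n !) ℚ.* inv! n ≡ 1ℚ
  fromℕ*inv! n = fromℕ*1/ (n !) {{n ℕₚ.!≢0}}

  inv!-suc : ∀ n → fromℕ (suc n) ℚ.* inv! (suc n) ≡ inv! n
  inv!-suc n = trans
    (trans (sym (ℚₚ.*-identityˡ _)) (trans (cong (ℚ._* (fromℕ (suc n) ℚ.* inv! (suc n))) (sym (fromℕ*inv! n)))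
      (trans (solve 4 (λ a b c d → (a :* b) :* (c :* d) := b :* ((c :* a) :* d)) refl
          (fromℕ (n !)) (inv! n) (fromℕ (suc n)) (inv! (suc n)))
        (cong (λ z → inv! n ℚ.* (z ℚ.* inv! (suc n))) (sym (ℚMult.×1-homo-* (suc n) (n !)))))))
    (trans (cong (inv! n ℚ.*_) (fromℕ*inv! (suc n))) (ℚₚ.*-identityʳ (inv! n)))
    where open +-*-Solver

  0≤inv! : ∀ n → 0ℚ ℚ.≤ inv! n
  0≤inv! n = ℚₚ.nonNegative⁻¹ (inv! n) {{ℚₚ.normalize-nonNeg 1 (n !) {{n ℕₚ.!≢0}}}}

  -- For k ≥ Q each further factor of Q is absorbed by a factor of the factorial.
  ^≤^*! : ∀ Q k .{{_ : ℕ.NonZero Q}} → Q ℕ.^ k ℕ.≤ Q ℕ.^ Q ℕ.* k !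
  ^≤^*! Q zero    = ℕₚ.≤-trans (ℕₚ.m^n>0 Q Q) (ℕₚ.m≤m*n (Q ℕ.^ Q) 1)
  ^≤^*! Q (suc k) with ℕₚ.≤-total (suc k) Q
  ... | inj₁ k<Q = ℕₚ.≤-trans (ℕₚ.^-monoʳ-≤ Q k<Q) (ℕₚ.m≤m*n (Q ℕ.^ Q) (suc k !) {{suc k ℕₚ.!≢0}})
  ... | inj₂ Q≤k = subst (Q ℕ.* Q ℕ.^ k ℕ.≤_)
    (trans (sym (ℕₚ.*-assoc (suc k) (Q ℕ.^ Q) (k !)))
      (trans (cong (ℕ._* k !) (ℕₚ.*-comm (suc k) (Q ℕ.^ Q))) (ℕₚ.*-assoc (Q ℕ.^ Q) (suc k) (k !))))
    (ℕₚ.*-mono-≤ Q≤k (^≤^*! Q k))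

  -- From (4B)^k ≤ Q^k ≤ Q^Q k! follows (4B)^k / k! ≤ Q^Q; multiplying by 4^-k on both sides removes
  -- the 4.
  inv!-bound : ∀ B → ∃ λ C → 0ℚ ℚ.≤ C × ∀ k → inv! k ℚ.* fromℕ (B ℕ.^ k) ℚ.≤ C ℚ.* (½^ k ℚ.* ½^ k)
  inv!-bound B = fromℕ C , 0≤fromℕ C , λ k → subst₂ ℚ._≤_ (lhs k) (ℚₚ.*-assoc (fromℕ C) (½^ k) (½^ k))
      (ℚₚ.*-monoʳ-≤-nonNeg (½^ k) {{ℚ.nonNegative (0≤½^ k)}}
        (ℚₚ.*-monoʳ-≤-nonNeg (½^ k) {{ℚ.nonNegative (0≤½^ k)}} (Q^k k)))
    where
    open +-*-Solver
    -- The factor 4 yields both factors `½^ k`; the successor keeps Q non-zero even when B is 0.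
    Q = suc (B ℕ.* 4)
    C = Q ℕ.^ Q
    Q^k : ∀ k → inv! k ℚ.* fromℕ ((B ℕ.* 4) ℕ.^ k) ℚ.≤ fromℕ C
    Q^k k = ℚₚ.≤-trans
      (*-monoʳ (0≤inv! k) (fromℕ-mono (ℕₚ.≤-trans (ℕₚ.^-monoˡ-≤ k (ℕₚ.n≤1+n (B ℕ.* 4))) (^≤^*! Q k))))
      (ℚₚ.≤-reflexive (trans (cong (inv! k ℚ.*_) (ℚMult.×1-homo-* C (k !)))
        (trans (solve 3 (λ a b c → a :* (b :* c) := b :* (c :* a)) refl (inv! k) (fromℕ C) (fromℕ (k !)))
          (trans (cong (fromℕ C ℚ.*_) (fromℕ*inv! k)) (ℚₚ.*-identityʳ (fromℕ C))))))
    quarter : ∀ k → fromℕ ((B ℕ.* 4) ℕ.^ k) ℚ.* (½^ k ℚ.* ½^ k) ≡ fromℕ (B ℕ.^ k)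
    quarter zero    = refl
    quarter (suc k) = trans (cong (ℚ._* (½^ suc k ℚ.* ½^ suc k))
        (trans (ℚMult.×1-homo-* (B ℕ.* 4) ((B ℕ.* 4) ℕ.^ k))
          (cong (ℚ._* fromℕ ((B ℕ.* 4) ℕ.^ k)) (ℚMult.×1-homo-* B 4))))
      (trans (solve 3 (λ b p h → ((b :* con (fromℕ 4)) :* p) :* ((con ½ :* h) :* (con ½ :* h)) := b :* (p :* (h :* h)))
          refl (fromℕ B) (fromℕ ((B ℕ.* 4) ℕ.^ k)) (½^ k))
        (trans (cong (fromℕ B ℚ.*_) (quarter k)) (sym (ℚMult.×1-homo-* B (B ℕ.^ k)))))
    lhs : ∀ k → (inv! k ℚ.* fromℕ ((B ℕ.* 4) ℕ.^ k)) ℚ.* ½^ k ℚ.* ½^ k ≡ inv! k ℚ.* fromℕ (B ℕ.^ k)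
    lhs k = trans (solve 3 (λ a p h → a :* p :* h :* h := a :* (p :* (h :* h))) refl
        (inv! k) (fromℕ ((B ℕ.* 4) ℕ.^ k)) (½^ k))
      (cong (inv! k ℚ.*_) (quarter k))

  ^-distrib-* : ∀ m n k → (m ℕ.* n) ℕ.^ k ≡ m ℕ.^ k ℕ.* n ℕ.^ k
  ^-distrib-* m n zero    = refl
  ^-distrib-* m n (suc k) = trans (cong (m ℕ.* n ℕ.*_) (^-distrib-* m n k))
    (ℕₚ.[m*n]*[o*p]≡[m*o]*[n*p] m n (m ℕ.^ k) (n ℕ.^ k))

  2ℚ : ℚ
  2ℚ = 1ℚ ℚ.+ 1ℚ

  0<½^ : ∀ n → 0ℚ ℚ.< ½^ n
  0<½^ zero    = ℚₚ.positive⁻¹ 1ℚ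
  0<½^ (suc n) = ½-pos (0<½^ n)

  ½^²≤½^ : ∀ k → ½^ k ℚ.* ½^ k ℚ.≤ ½^ k
  ½^²≤½^ k = subst (½^ k ℚ.* ½^ k ℚ.≤_) (ℚₚ.*-identityʳ (½^ k)) (*-monoʳ (0≤½^ k) (½^≤1 k))

  0≤2 : 0ℚ ℚ.≤ 2ℚ
  0≤2 = ℚₚ.nonNegative⁻¹ 2ℚ

  4ℚ : ℚ
  4ℚ = 2ℚ ℚ.+ 2ℚ

  open +-*-Solver

  quarter : ∀ a h → a ℚ.* (½ ℚ.* h ℚ.* (½ ℚ.* h)) ≡ ½ ℚ.* (½ ℚ.* a) ℚ.* (h ℚ.* h)
  quarter = solve 2 (λ a h → a :* (con ½ :* h :* (con ½ :* h)) := con ½ :* (con ½ :* a) :* (h :* h)) refl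

  geometric-zero : ∀ a → 0ℚ ≡ 2ℚ ℚ.* a ℚ.- 2ℚ ℚ.* a ℚ.* 1ℚ
  geometric-zero = solve 1 (λ a → con 0ℚ := con 2ℚ :* a :- con 2ℚ :* a :* con 1ℚ) refl

  geometric-suc : ∀ a h → 2ℚ ℚ.* a ℚ.- 2ℚ ℚ.* a ℚ.* h ℚ.+ a ℚ.* h ≡ 2ℚ ℚ.* a ℚ.- 2ℚ ℚ.* a ℚ.* (½ ℚ.* h)
  geometric-suc = solve 2 (λ a h → con 2ℚ :* a :- con 2ℚ :* a :* h :+ a :* h
    := con 2ℚ :* a :- con 2ℚ :* a :* (con ½ :* h)) refl

  excess-suc : ∀ a b h →
    4ℚ ℚ.* (½ ℚ.* (½ ℚ.* a) ℚ.* b) ℚ.* h ℚ.+ 2ℚ ℚ.* (2ℚ ℚ.* (½ ℚ.* (½ ℚ.* a)) ℚ.* (b ℚ.* h))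
                       ≡ 4ℚ ℚ.* (a ℚ.* b) ℚ.* (½ ℚ.* h)
  excess-suc = solve 3 (λ a b h → con 4ℚ :* (con ½ :* (con ½ :* a) :* b) :* h
      :+ con 2ℚ :* (con 2ℚ :* (con ½ :* (con ½ :* a)) :* (b :* h))
    := con 4ℚ :* (a :* b) :* (con ½ :* h)) refl

  product-error : ∀ l m h →
    2ℚ ℚ.* (l ℚ.* h) ℚ.+ 2ℚ ℚ.* (h ℚ.* m) ℚ.+ 2ℚ ℚ.* h ≡ 2ℚ ℚ.* (l ℚ.+ m ℚ.+ 1ℚ) ℚ.* h
  product-error = solve 3 (λ l m h → con 2ℚ :* (l :* h) :+ con 2ℚ :* (h :* m) :+ con 2ℚ :* h
    := con 2ℚ :* (l :+ m :+ con 1ℚ) :* h) refl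

  swap-right : ∀ p a b c → p ℚ.* (a ℚ.* (b ℚ.* c)) ≡ p ℚ.* (b ℚ.* (a ℚ.* c))
  swap-right = solve 4 (λ p a b c → p :* (a :* (b :* c)) := p :* (b :* (a :* c))) refl

  reassoc : ∀ p c d h → p ℚ.* (c ℚ.* (d ℚ.* h)) ≡ p ℚ.* (c ℚ.* d) ℚ.* h
  reassoc = solve 4 (λ p c d h → p :* (c :* (d :* h)) := p :* (c :* d) :* h) refl

  extract : ∀ t b c p → t ℚ.* (b ℚ.* (c ℚ.* p)) ≡ c ℚ.* (t ℚ.* b ℚ.* p)
  extract = solve 4 (λ t b c p → t :* (b :* (c :* p)) := c :* (t :* b :* p)) refl

  interchange : ∀ t c x d y → t ℚ.* (c ℚ.* x ℚ.* (d ℚ.* y)) ≡ t ℚ.* (c ℚ.* d) ℚ.* (x ℚ.* y)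
  interchange = solve 5 (λ t c x d y → t :* (c :* x :* (d :* y)) := t :* (c :* d) :* (x :* y)) refl

  rotate : ∀ n t b c → n ℚ.* (t ℚ.* (b ℚ.* c)) ≡ c ℚ.* (n ℚ.* (t ℚ.* b))
  rotate = solve 4 (λ n t b c → n :* (t :* (b :* c)) := c :* (n :* (t :* b))) refl

open Rational

module PartialSum (R : RawRing 0ℓ 0ℓ) where
  open RawRing R
  psum : (ℕ → Carrier) → ℕ → Carrier
  psum f zero    = 0#
  psum f (suc n) = psum f n + f n

-- The norm is given by the relation ‖ x ‖≤ q, as suprema need not exist.
-- The factor 2 in the bound for products allows the maximum norm on ℂ.
record NormedRing : Set₁ where
  infix 4 ‖_‖≤_
  field
    commutativeRing : CommutativeRing 0ℓ 0ℓ
  open CommutativeRing commutativeRing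
  open PartialSum rawRing
  open SemiringMult semiring using () renaming (_×_ to _×#_)
  field
    ‖_‖≤_     : Carrier → ℚ → Set
    ‖‖-resp   : ∀ {x y q} → x ≈ y → ‖ x ‖≤ q → ‖ y ‖≤ q
    ‖‖-mono   : ∀ {x p q} → p ℚ.≤ q → ‖ x ‖≤ p → ‖ x ‖≤ q
    ‖‖-nonNeg : ∀ {x q} → ‖ x ‖≤ q → 0ℚ ℚ.≤ q
    ‖0‖       : ‖ 0# ‖≤ 0ℚ
    ‖‖-+      : ∀ {x y p q} → ‖ x ‖≤ p → ‖ y ‖≤ q → ‖ x + y ‖≤ p ℚ.+ q
    ‖‖-neg    : ∀ {x q} → ‖ x ‖≤ q → ‖ - x ‖≤ q
    ‖‖-*      : ∀ {x y p q} → ‖ x ‖≤ p → ‖ y ‖≤ q → ‖ x * y ‖≤ 2ℚ ℚ.* (p ℚ.* q)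
    ‖‖-finite : ∀ x → ∃ λ q → ‖ x ‖≤ q
    ‖‖-zero   : ∀ {x} → (∀ q → 0ℚ ℚ.< q → ‖ x ‖≤ q) → x ≈ 0#
    -- Completeness is asked only for geometrically bounded series, with the rate of the remainder
    -- as part of the conclusion; exponential series need no more.
    complete  : ∀ t A → (∀ k → ‖ t k ‖≤ A ℚ.* ½^ k) →
                ∃ λ l → ∀ n → ‖ psum t n - l ‖≤ 2ℚ ℚ.* A ℚ.* ½^ n
    -- The element 1 / n!, given by its recursion because the ring has no division.
    inv       : ℕ → Carrier
    inv-0     : inv 0 ≈ 1#
    inv-suc   : ∀ n → (suc n ×# 1#) * inv (suc n) ≈ inv n
    ‖inv‖     : ∀ n → ‖ inv n ‖≤ inv! n

-- Exponential series

module Exponential (𝒩 : NormedRing) where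
  open NormedRing 𝒩 public
  open CommutativeRing commutativeRing
  open PartialSum rawRing
  open SemiringMult semiring using (×1-homo-*; ×-homo-1) renaming (_×_ to _×#_)
  open SemiringSum semiring using (sum)
  open RingProperties ring using (x∙y⁻¹≈ε⇒x≈y; -0#≈0#)
  open SemiringSolver commutativeSemiring using (solve; con; _:+_; _:*_; _:=_)
  open SetoidReasoning setoid

  Sequence : Set
  Sequence = ℕ → Carrier

  infixl 7 _⋆_
  infix  4 _⇝_

  -- The Cauchy product of coefficient sequences, with the term of `f 0` split off so that indices
  -- are never subtracted.
  _⋆_ : Sequence → Sequence → Sequence
  (f ⋆ g) zero    = f 0 * g 0
  (f ⋆ g) (suc n) = f 0 * g (suc n) + ((f ∘ suc) ⋆ g) n

  deriv : Sequence → Sequence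
  deriv f n = (suc n ×# 1#) * f (suc n)

  ⋆-cong : ∀ {f f′ g g′} → (∀ n → f n ≈ f′ n) → (∀ n → g n ≈ g′ n) → ∀ n → (f ⋆ g) n ≈ (f′ ⋆ g′) n
  ⋆-cong p q zero    = *-cong (p 0) (q 0)
  ⋆-cong p q (suc n) = +-cong (*-cong (p 0) (q (suc n))) (⋆-cong (p ∘ suc) q n)

  ⋆-distribʳ-+ : ∀ f f′ g n → ((λ k → f k + f′ k) ⋆ g) n ≈ (f ⋆ g) n + (f′ ⋆ g) n
  ⋆-distribʳ-+ f f′ g zero    = distribʳ (g 0) (f 0) (f′ 0)
  ⋆-distribʳ-+ f f′ g (suc n) = begin
    (f 0 + f′ 0) * g (suc n) + ((λ k → f (suc k) + f′ (suc k)) ⋆ g) n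
      ≈⟨ +-congˡ (⋆-distribʳ-+ (f ∘ suc) (f′ ∘ suc) g n) ⟩
    (f 0 + f′ 0) * g (suc n) + (((f ∘ suc) ⋆ g) n + ((f′ ∘ suc) ⋆ g) n)
      ≈⟨ solve 5 (λ a b c x y → (a :+ b) :* c :+ (x :+ y) := (a :* c :+ x) :+ (b :* c :+ y)) refl
           (f 0) (f′ 0) (g (suc n)) (((f ∘ suc) ⋆ g) n) (((f′ ∘ suc) ⋆ g) n) ⟩
    (f ⋆ g) (suc n) + (f′ ⋆ g) (suc n) ∎

  -- The product rule for formal power series. Write n + 2 as 1 + (n + 1): the part n + 1 goes to
  -- the induction hypothesis for `f ∘ suc`, and the spare copy makes up for `deriv f` at k + 1
  -- exceeding `deriv (f ∘ suc)` at k by the coefficient of index k + 2.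
  deriv-⋆ : ∀ f g n → deriv (f ⋆ g) n ≈ (deriv f ⋆ g) n + (f ⋆ deriv g) n
  deriv-⋆ f g zero = begin
    (1# + 0#) * (f 0 * g 1 + f 1 * g 0)
      ≈⟨ solve 5 (λ o a b c d → o :* (a :* b :+ c :* d) := (o :* c) :* d :+ a :* (o :* b)) refl
           (1# + 0#) (f 0) (g 1) (f 1) (g 0) ⟩
    (1# + 0#) * f 1 * g 0 + f 0 * ((1# + 0#) * g 1) ∎
  deriv-⋆ f g (suc n) = begin
    (1# + m) * (a * b + (c * d + X))
      ≈⟨ solve 6 (λ m a b c d x → (con 1 :+ m) :* (a :* b :+ (c :* d :+ x))
           := ((con 1 :+ m) :* (a :* b) :+ (c :* d :+ x)) :+ m :* (c :* d :+ x)) refl m a b c d X ⟩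
    ((1# + m) * (a * b) + (c * d + X)) + m * (c * d + X)
      ≈⟨ +-congˡ (deriv-⋆ (f ∘ suc) g n) ⟩
    ((1# + m) * (a * b) + (c * d + X)) + (Y + Z)
      ≈⟨ solve 8 (λ m a b c d x y z → ((con 1 :+ m) :* (a :* b) :+ (c :* d :+ x)) :+ (y :+ z)
           := ((con 1 :+ con 0) :* c :* d :+ (x :+ y)) :+ (a :* ((con 1 :+ m) :* b) :+ z)) refl m a b c d X Y Z ⟩
    ((1# + 0#) * c * d + (X + Y)) + (a * ((1# + m) * b) + Z)
      ≈⟨ +-congʳ (+-congˡ (⋆-distribʳ-+ f″ (deriv (f ∘ suc)) g n)) ⟨
    ((1# + 0#) * c * d + ((λ k → f (suc (suc k)) + deriv (f ∘ suc) k) ⋆ g) n) + (a * ((1# + m) * b) + Z)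
      ≈⟨ +-congʳ (+-congˡ (⋆-cong (λ k → solve 2 (λ m x → x :+ m :* x := (con 1 :+ m) :* x) refl
            (suc k ×# 1#) (f (suc (suc k)))) (λ _ → refl) n)) ⟩
    (deriv f ⋆ g) (suc n) + (f ⋆ deriv g) (suc n) ∎
    where
    m = suc n ×# 1#
    a = f 0 ; b = g (suc (suc n)) ; c = f 1 ; d = g (suc n)
    f″ : Sequence
    f″ k = f (suc (suc k))
    X = (f″ ⋆ g) n
    Y = (deriv (f ∘ suc) ⋆ g) n
    Z = ((f ∘ suc) ⋆ deriv g) n

  -- The binomial convolution Σⱼ (n choose j) aⱼ bₙ₋ⱼ, by the Leibniz rule for
  -- the shift, which is the derivative of exponential generating functions.
  conv : Sequence → Sequence → Sequence
  conv a b zero    = a 0 * b 0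
  conv a b (suc n) = conv (a ∘ suc) b n + conv a (b ∘ suc) n

  conv-cong : ∀ {a a′ b b′} → (∀ n → a n ≈ a′ n) → (∀ n → b n ≈ b′ n) → ∀ n → conv a b n ≈ conv a′ b′ n
  conv-cong p q zero    = *-cong (p 0) (q 0)
  conv-cong p q (suc n) = +-cong (conv-cong (p ∘ suc) q n) (conv-cong p (q ∘ suc) n)

  term : Sequence → Sequence
  term a n = inv n * a n

  -- The factor n + 1 cancels against 1 / (n + 1)!, so differentiating an exponential generating
  -- function shifts its sequence.
  deriv-term : ∀ a n → deriv (term a) n ≈ term (a ∘ suc) n
  deriv-term a n = trans (sym (*-assoc (suc n ×# 1#) (inv (suc n)) (a (suc n)))) (*-congʳ (inv-suc n))

  !*inv : ∀ n → ((n !) ×# 1#) * inv n ≈ 1#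
  !*inv zero    = trans (*-cong (×-homo-1 1#) inv-0) (*-identityˡ 1#)
  !*inv (suc n) = begin
    ((suc n !) ×# 1#) * inv (suc n)                ≈⟨ *-congʳ (×1-homo-* (suc n) (n !)) ⟩
    (suc n ×# 1#) * ((n !) ×# 1#) * inv (suc n)    ≈⟨ solve 3 (λ a b c → a :* b :* c := b :* (a :* c)) refl
                                                     (suc n ×# 1#) ((n !) ×# 1#) (inv (suc n)) ⟩
    ((n !) ×# 1#) * ((suc n ×# 1#) * inv (suc n))  ≈⟨ *-congˡ (inv-suc n) ⟩
    ((n !) ×# 1#) * inv n                          ≈⟨ !*inv n ⟩
    1# ∎

  -- The shifts in the recursion of `conv` become derivatives of the generating functions, which the
  -- product rule recombines into one derivative; its factor n + 1 extends n! to (n + 1)!.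
  conv-⋆ : ∀ a b n → conv a b n ≈ ((n !) ×# 1#) * (term a ⋆ term b) n
  conv-⋆ a b zero = begin
    a 0 * b 0                                  ≈⟨ *-cong (*-identityˡ (a 0)) (*-identityˡ (b 0)) ⟨
    (1# * a 0) * (1# * b 0)                    ≈⟨ *-cong (*-congʳ inv-0) (*-congʳ inv-0) ⟨
    (inv 0 * a 0) * (inv 0 * b 0)              ≈⟨ solve 1 (λ x → x := (con 1 :+ con 0) :* x) refl _ ⟩
    (1# + 0#) * (inv 0 * a 0 * (inv 0 * b 0))  ∎
  conv-⋆ a b (suc n) = begin
    conv (a ∘ suc) b n + conv a (b ∘ suc) n
      ≈⟨ +-cong (conv-⋆ (a ∘ suc) b n) (conv-⋆ a (b ∘ suc) n) ⟩
    k * (term (a ∘ suc) ⋆ term b) n + k * (term a ⋆ term (b ∘ suc)) n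
      ≈⟨ distribˡ k _ _ ⟨
    k * ((term (a ∘ suc) ⋆ term b) n + (term a ⋆ term (b ∘ suc)) n)
      ≈⟨ *-congˡ (+-cong (⋆-cong (deriv-term a) (λ _ → refl) n) (⋆-cong {term a} (λ _ → refl) (deriv-term b) n)) ⟨
    k * ((deriv (term a) ⋆ term b) n + (term a ⋆ deriv (term b)) n)
      ≈⟨ *-congˡ (deriv-⋆ (term a) (term b) n) ⟨
    k * ((suc n ×# 1#) * (term a ⋆ term b) (suc n))
      ≈⟨ solve 3 (λ k m x → k :* (m :* x) := m :* k :* x) refl k (suc n ×# 1#) _ ⟩
    (suc n ×# 1#) * k * (term a ⋆ term b) (suc n)
      ≈⟨ *-congʳ (×1-homo-* (suc n) (n !)) ⟨
    ((suc n !) ×# 1#) * (term a ⋆ term b) (suc n) ∎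
    where k = (n !) ×# 1#

  term-conv : ∀ a b n → term (conv a b) n ≈ (term a ⋆ term b) n
  term-conv a b n = begin
    inv n * conv a b n                            ≈⟨ *-congˡ (conv-⋆ a b n) ⟩
    inv n * (((n !) ×# 1#) * (term a ⋆ term b) n)
      ≈⟨ solve 3 (λ i k x → i :* (k :* x) := k :* i :* x) refl (inv n) ((n !) ×# 1#) _ ⟩
    ((n !) ×# 1#) * inv n * (term a ⋆ term b) n     ≈⟨ *-congʳ (!*inv n) ⟩
    1# * (term a ⋆ term b) n                      ≈⟨ *-identityˡ _ ⟩
    (term a ⋆ term b) n ∎

  psum-cong : ∀ {f g} → (∀ n → f n ≈ g n) → ∀ n → psum f n ≈ psum g n
  psum-cong p zero    = refl
  psum-cong p (suc n) = +-cong (psum-cong p n) (p n)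

  psum-head : ∀ f n → psum f (suc n) ≈ f 0 + psum (f ∘ suc) n
  psum-head f zero    = +-comm 0# (f 0)
  psum-head f (suc n) = trans (+-congʳ (psum-head f n)) (+-assoc _ _ _)

  psum-⋆ : ∀ f g n → psum (f ⋆ g) (suc n) ≈ f 0 * psum g (suc n) + psum ((f ∘ suc) ⋆ g) n
  psum-⋆ f g zero    = solve 2 (λ a b → con 0 :+ a :* b := a :* (con 0 :+ b) :+ con 0) refl (f 0) (g 0)
  psum-⋆ f g (suc n) = begin
    psum (f ⋆ g) (suc n) + (f 0 * g (suc n) + ((f ∘ suc) ⋆ g) n)
      ≈⟨ +-congʳ (psum-⋆ f g n) ⟩
    (f 0 * psum g (suc n) + psum ((f ∘ suc) ⋆ g) n) + (f 0 * g (suc n) + ((f ∘ suc) ⋆ g) n)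
      ≈⟨ solve 5 (λ a s x b y → (a :* s :+ x) :+ (a :* b :+ y) := a :* (s :+ b) :+ (x :+ y)) refl
           (f 0) (psum g (suc n)) _ (g (suc n)) _ ⟩
    f 0 * psum g (suc (suc n)) + psum ((f ∘ suc) ⋆ g) (suc n) ∎

  -- The sum of fⱼ gₖ over j, k < n with j + k ≥ n.
  excess : Sequence → Sequence → Sequence
  excess f g zero    = 0#
  excess f g (suc n) = excess (f ∘ suc) g n + psum (f ∘ suc) n * g n

  -- In the square of side n + 1, remove the row of `f 0`. What is left is the square of side n for
  -- `f ∘ suc` and the column of `g n`, which belongs to the excess entirely since its first index
  -- is at least 1.
  psum-* : ∀ f g n → psum f n * psum g n ≈ psum (f ⋆ g) n + excess f g n
  psum-* f g zero    = trans (zeroˡ 0#) (sym (+-identityˡ 0#))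
  psum-* f g (suc n) = begin
    psum f (suc n) * psum g (suc n)
      ≈⟨ *-congʳ (psum-head f n) ⟩
    (f 0 + F) * (psum g n + g n)
      ≈⟨ solve 4 (λ a x s b → (a :+ x) :* (s :+ b) := a :* (s :+ b) :+ (x :* s :+ x :* b)) refl (f 0) F (psum g n) (g n) ⟩
    f 0 * psum g (suc n) + (F * psum g n + F * g n)
      ≈⟨ +-congˡ (+-congʳ (psum-* (f ∘ suc) g n)) ⟩
    f 0 * psum g (suc n) + ((psum ((f ∘ suc) ⋆ g) n + excess (f ∘ suc) g n) + F * g n)
      ≈⟨ solve 4 (λ a b c d → a :+ ((b :+ c) :+ d) := (a :+ b) :+ (c :+ d)) refl _ _ _ _ ⟩
    (f 0 * psum g (suc n) + psum ((f ∘ suc) ⋆ g) n) + excess f g (suc n)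
      ≈⟨ +-congʳ (psum-⋆ f g n) ⟨
    psum (f ⋆ g) (suc n) + excess f g (suc n) ∎
    where F = psum (f ∘ suc) n

  record Geometric (f : Sequence) (A : ℚ) : Set where
    constructor geometric
    field bound : ∀ k → ‖ f k ‖≤ A ℚ.* ½^ k

  -- The rate 4^-k is written as a product of two powers so that one of them can be given up while
  -- the other remains.
  record Dominated (f : Sequence) (A : ℚ) : Set where
    constructor dominated
    field bound : ∀ k → ‖ f k ‖≤ A ℚ.* (½^ k ℚ.* ½^ k)

    nonNeg : 0ℚ ℚ.≤ A
    nonNeg = ≡.subst (0ℚ ℚ.≤_) (ℚₚ.*-identityʳ A) (‖‖-nonNeg (bound 0))

    isGeometric : Geometric f A
    isGeometric = geometric λ k → ‖‖-mono (*-monoʳ nonNeg (½^²≤½^ k)) (bound k)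

    tail : Dominated (f ∘ suc) (½ ℚ.* (½ ℚ.* A))
    tail = record { bound = λ k → ≡.subst (‖ f (suc k) ‖≤_) (quarter A (½^ k)) (bound (suc k)) }

  psum-bound : ∀ {f A} → Geometric f A → ∀ n → ‖ psum f n ‖≤ 2ℚ ℚ.* A
  psum-bound {f} {A} (geometric h) n = ‖‖-mono
    (≡.subst (2ℚ ℚ.* A ℚ.- 2ℚ ℚ.* A ℚ.* ½^ n ℚ.≤_) (ℚₚ.+-identityʳ (2ℚ ℚ.* A))
      (ℚₚ.+-monoʳ-≤ (2ℚ ℚ.* A) (ℚₚ.neg-antimono-≤ {0ℚ} (0≤* (0≤* 0≤2 0≤A) (0≤½^ n)))))
    (go n)
    where
    0≤A : 0ℚ ℚ.≤ A
    0≤A = ≡.subst (0ℚ ℚ.≤_) (ℚₚ.*-identityʳ A) (‖‖-nonNeg (h 0))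
    -- The induction carries the exact geometric sum; its negative part is dropped only at the end.
    go : ∀ n → ‖ psum f n ‖≤ 2ℚ ℚ.* A ℚ.- 2ℚ ℚ.* A ℚ.* ½^ n
    go zero    = ≡.subst (‖ 0# ‖≤_) (geometric-zero A) ‖0‖
    go (suc n) = ≡.subst (‖ psum f (suc n) ‖≤_) (geometric-suc A (½^ n)) (‖‖-+ (go n) (h n))

  -- Shifting f divides A by 4, so the recursive part contributes A B 2^-n. The added column
  -- contributes at most 2 (2 A / 4) B 2^-n, which is the same amount, and the two add up to 4 A B
  -- 2^-(n+1).
  excess-bound : ∀ {f g A B} → Dominated f A → Dominated g B → Geometric (excess f g) (4ℚ ℚ.* (A ℚ.* B))
  excess-bound df dg = geometric (go df dg)
    where
    go : ∀ {f g A B} → Dominated f A → Dominated g B → ∀ n → ‖ excess f g n ‖≤ 4ℚ ℚ.* (A ℚ.* B) ℚ.* ½^ n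
    go df dg zero = ‖‖-mono
      (0≤* (0≤* (ℚₚ.nonNegative⁻¹ 4ℚ) (0≤* (Dominated.nonNeg df) (Dominated.nonNeg dg))) 0≤1) ‖0‖
    go {A = A} {B} df dg (suc n) = ‖‖-mono
      (ℚₚ.≤-trans
        (ℚₚ.+-monoʳ-≤ (4ℚ ℚ.* (½ ℚ.* (½ ℚ.* A) ℚ.* B) ℚ.* ½^ n)
          (*-monoʳ 0≤2 (*-monoʳ (0≤* 0≤2 (Dominated.nonNeg (Dominated.tail df)))
            (*-monoʳ (Dominated.nonNeg dg) (½^²≤½^ n)))))
        (ℚₚ.≤-reflexive (excess-suc A B (½^ n))))
      (‖‖-+ (go (Dominated.tail df) dg n)
        (‖‖-* (psum-bound (Dominated.isGeometric (Dominated.tail df)) n) (Dominated.bound dg n)))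

  -- Rational tolerances fit the relational norm; `⟶ᶜ⇒⇝` and `⇝⇒⟶ᶜ` translate to the convergence
  -- used in the statement of the theorem.
  _⇝_ : Sequence → Carrier → Set
  s ⇝ l = ∀ q → 0ℚ ℚ.< q → ∃ λ N → ∀ n → N ℕ.≤ n → ‖ s n - l ‖≤ q

  x+[y-x]≈y : ∀ x y → x + (y - x) ≈ y
  x+[y-x]≈y x y = begin
    x + (y - x)   ≈⟨ solve 3 (λ x y z → x :+ (y :+ z) := y :+ (x :+ z)) refl x y (- x) ⟩
    y + (x - x)   ≈⟨ +-congˡ (-‿inverseʳ x) ⟩
    y + 0#        ≈⟨ +-identityʳ y ⟩
    y ∎

  x≈y+z⇒x-y≈z : ∀ {x y z} → x ≈ y + z → x - y ≈ z
  x≈y+z⇒x-y≈z {x} {y} {z} p = begin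
    x - y         ≈⟨ +-congʳ p ⟩
    y + z - y     ≈⟨ +-assoc y z (- y) ⟩
    y + (z - y)   ≈⟨ x+[y-x]≈y y z ⟩
    z ∎

  ⇝-resp : ∀ {s t l m} → (∀ n → s n ≈ t n) → l ≈ m → s ⇝ l → t ⇝ m
  ⇝-resp p r h q 0<q = let (N , k) = h q 0<q in
    N , λ n N≤n → ‖‖-resp (+-cong (p n) (-‿cong r)) (k n N≤n)

  ⇝-unique : ∀ {s l m} → s ⇝ l → s ⇝ m → l ≈ m
  ⇝-unique {s} {l} {m} h k = x∙y⁻¹≈ε⇒x≈y l m (‖‖-zero λ q 0<q →
    let (N , h′) = h (½ ℚ.* q) (½-pos 0<q)
        (M , k′) = k (½ ℚ.* q) (½-pos 0<q)
        n = N ℕ.⊔ M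
        d = s n - l
        e = s n - m
    in ≡.subst (‖ l - m ‖≤_) (½+½ q) (‖‖-resp
      (sym (x≈y+z⇒x-y≈z (begin
        l                    ≈⟨ +-identityʳ l ⟨
        l + 0#               ≈⟨ +-congˡ (-‿inverseʳ d) ⟨
        l + (d - d)          ≈⟨ +-assoc l d (- d) ⟨
        l + d - d            ≈⟨ +-congʳ (x+[y-x]≈y l (s n)) ⟩
        s n - d              ≈⟨ +-congʳ (x+[y-x]≈y m (s n)) ⟨
        m + e - d            ≈⟨ +-assoc m e (- d) ⟩
        m + (e - d) ∎)))
      (‖‖-+ (k′ n (ℕₚ.m≤n⊔m N M)) (‖‖-neg (h′ n (ℕₚ.m≤m⊔n N M))))))

  ⇝-const : ∀ c → (λ _ → c) ⇝ c
  ⇝-const c q 0<q = 0 , λ n _ → ‖‖-mono (ℚₚ.<⇒≤ 0<q) (‖‖-resp (sym (-‿inverseʳ c)) ‖0‖)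

  ⇝-+ : ∀ {s t l m} → s ⇝ l → t ⇝ m → (λ n → s n + t n) ⇝ (l + m)
  ⇝-+ {s} {t} {l} {m} h k q 0<q =
    let (N , h′) = h (½ ℚ.* q) (½-pos 0<q)
        (M , k′) = k (½ ℚ.* q) (½-pos 0<q)
    in N ℕ.⊔ M , λ n N≤n → ≡.subst (‖ s n + t n - (l + m) ‖≤_) (½+½ q) (‖‖-resp
      (sym (x≈y+z⇒x-y≈z (begin
        s n + t n                          ≈⟨ +-cong (x+[y-x]≈y l (s n)) (x+[y-x]≈y m (t n)) ⟨
        (l + (s n - l)) + (m + (t n - m))
          ≈⟨ solve 4 (λ l d m e → (l :+ d) :+ (m :+ e) := (l :+ m) :+ (d :+ e)) refl
                                                l (s n - l) m (t n - m) ⟩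
        (l + m) + ((s n - l) + (t n - m))  ∎)))
      (‖‖-+ (h′ n (ℕₚ.m⊔n≤o⇒m≤o N M N≤n)) (k′ n (ℕₚ.m⊔n≤o⇒n≤o N M N≤n))))

  ⇝-* : ∀ {s t l m} → s ⇝ l → t ⇝ m → (λ n → s n * t n) ⇝ (l * m)
  ⇝-* {s} {t} {l} {m} h k q 0<q =
    let (L , ‖l‖) = ‖‖-finite l
        (M , ‖m‖) = ‖‖-finite m
        -- With d and e the two errors, the error of the product is l e + d m + d e. Each summand
        -- costs the factor 2 of `‖‖-*`, and the 1 accounts for d e, since the square of `½^ K` is
        -- at most `½^ K`.
        A = 2ℚ ℚ.* ((L ℚ.+ M) ℚ.+ 1ℚ)
        0≤A : 0ℚ ℚ.≤ A
        0≤A = 0≤* 0≤2 (ℚₚ.+-mono-≤ (ℚₚ.+-mono-≤ (‖‖-nonNeg ‖l‖) (‖‖-nonNeg ‖m‖)) 0≤1)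
        (K , small) = ½^-vanishes A 0≤A 0<q
        (N , h′) = h (½^ K) (0<½^ K)
        (N′ , k′) = k (½^ K) (0<½^ K)
    in N ℕ.⊔ N′ , λ n N≤n →
      let d = s n - l ; e = t n - m
          ‖d‖ = h′ n (ℕₚ.m⊔n≤o⇒m≤o N N′ N≤n)
          ‖e‖ = k′ n (ℕₚ.m⊔n≤o⇒n≤o N N′ N≤n)
      in ‖‖-mono
        (ℚₚ.≤-trans
          (ℚₚ.+-monoʳ-≤ (2ℚ ℚ.* (L ℚ.* ½^ K) ℚ.+ 2ℚ ℚ.* (½^ K ℚ.* M)) (*-monoʳ 0≤2 (½^²≤½^ K)))
          (ℚₚ.≤-trans (ℚₚ.≤-reflexive (product-error L M (½^ K)))
            (small K ℕₚ.≤-refl)))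
        (‖‖-resp
          (sym (x≈y+z⇒x-y≈z (begin
            s n * t n                          ≈⟨ *-cong (x+[y-x]≈y l (s n)) (x+[y-x]≈y m (t n)) ⟨
            (l + d) * (m + e)
              ≈⟨ solve 4 (λ l d m e → (l :+ d) :* (m :+ e) := l :* m :+ (l :* e :+ d :* m :+ d :* e)) refl l d m e ⟩
            l * m + (l * e + d * m + d * e)    ∎)))
          (‖‖-+ (‖‖-+ (‖‖-* ‖l‖ ‖e‖) (‖‖-* ‖d‖ ‖m‖)) (‖‖-* ‖d‖ ‖e‖)))

  ⇝-sum : ∀ {n} {s : Fin n → Sequence} {l} → (∀ u → s u ⇝ l u) → (λ k → sum (λ u → s u k)) ⇝ sum l
  ⇝-sum {zero}  h = ⇝-const 0#
  ⇝-sum {suc n} h = ⇝-+ (h Fin.zero) (⇝-sum (h ∘ Fin.suc))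

  geometric⇒⇝ : ∀ {s l A} → Geometric (λ n → s n - l) A → s ⇝ l
  geometric⇒⇝ {A = A} (geometric h) q 0<q =
    let (N , small) = ½^-vanishes A (≡.subst (0ℚ ℚ.≤_) (ℚₚ.*-identityʳ A) (‖‖-nonNeg (h 0))) 0<q in
    N , λ n N≤n → ‖‖-mono (small n N≤n) (h n)

  -- The value at 1 of the exponential generating function of a; for `pow c` it is the exponential
  -- of c.
  ExpSum : Sequence → Carrier → Set
  ExpSum a α = psum (term a) ⇝ α

  ExpSum-resp : ∀ {a b α β} → (∀ n → a n ≈ b n) → α ≈ β → ExpSum a α → ExpSum b β
  ExpSum-resp p r = ⇝-resp (psum-cong λ n → *-congˡ (p n)) r

  -- The growth condition on Taylor coefficients of entire functions of exponential type. The base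
  -- is a natural number so that `inv!-bound` applies.
  ExpType : Sequence → Set
  ExpType a = ∃ λ C → ∃ λ B → ∀ k → ‖ a k ‖≤ C ℚ.* fromℕ (B ℕ.^ k)

  ExpType-resp : ∀ {a b} → (∀ n → a n ≈ b n) → ExpType a → ExpType b
  ExpType-resp p (C , B , h) = C , B , λ k → ‖‖-resp (p k) (h k)

  ExpType⇒Dominated : ∀ {a} → ExpType a → ∃ (Dominated (term a))
  ExpType⇒Dominated {a} (C , B , h) =
    let (D , 0≤D , small) = inv!-bound B in
    2ℚ ℚ.* (C ℚ.* D) , dominated λ k → ‖‖-mono
      (≡.subst₂ ℚ._≤_ (swap-right 2ℚ C (inv! k) (fromℕ (B ℕ.^ k))) (reassoc 2ℚ C D (½^ k ℚ.* ½^ k))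
        (*-monoʳ 0≤2 (*-monoʳ 0≤C (small k))))
      (‖‖-* (‖inv‖ k) (h k))
    where
    0≤C : 0ℚ ℚ.≤ C
    0≤C = ≡.subst (0ℚ ℚ.≤_) (ℚₚ.*-identityʳ C) (‖‖-nonNeg (h 0))

  ExpSum-exists : ∀ {a} → ExpType a → ∃ (ExpSum a)
  ExpSum-exists {a} t =
    let (A , d) = ExpType⇒Dominated t
        (l , h) = complete (term a) A (Geometric.bound (Dominated.isGeometric d))
    in l , geometric⇒⇝ (geometric {A = 2ℚ ℚ.* A} h)

  -- The product of the partial sums tends to α β and differs from the partial sums of the
  -- convolution by the excess, which tends to 0.
  ExpSum-conv : ∀ {a b α β} → ExpType a → ExpType b → ExpSum a α → ExpSum b β → ExpSum (conv a b) (α * β)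
  ExpSum-conv {a} {b} {α} {β} ta tb ea eb =
    let (A , da) = ExpType⇒Dominated ta
        (B , db) = ExpType⇒Dominated tb
        excess⇝0 : (λ n → - excess (term a) (term b) n) ⇝ 0#
        excess⇝0 = geometric⇒⇝ (geometric {A = 4ℚ ℚ.* (A ℚ.* B)} λ n →
          ‖‖-resp (sym (trans (+-congˡ -0#≈0#) (+-identityʳ _)))
          (‖‖-neg (Geometric.bound (excess-bound da db) n)))
    in ⇝-resp
      (λ n → begin
        psum (term a) n * psum (term b) n - excess (term a) (term b) n
          ≈⟨ +-congʳ (trans (psum-* (term a) (term b) n) (+-comm _ _)) ⟩
        excess (term a) (term b) n + psum (term a ⋆ term b) n - excess (term a) (term b) n
          ≈⟨ x≈y+z⇒x-y≈z refl ⟩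
        psum (term a ⋆ term b) n
          ≈⟨ psum-cong (term-conv a b) n ⟨
        psum (term (conv a b)) n ∎)
      (+-identityʳ (α * β)) (⇝-+ (⇝-* ea eb) excess⇝0)

  pow : Carrier → Sequence
  pow c zero    = 1#
  pow c (suc k) = c * pow c k

  ExpType-pow : ∀ c → ExpType (pow c)
  ExpType-pow c = C , 2 ℕ.* B , bound
    where
    -- C bounds the zeroth power. Each multiplication by c then costs B together with the factor 2
    -- of the norm inequality.
    C = proj₁ (‖‖-finite 1#)
    B = proj₁ (archimedean (proj₁ (‖‖-finite c)))
    double : ∀ m → 2ℚ ℚ.* fromℕ B ℚ.* fromℕ m ≡ fromℕ (2 ℕ.* B ℕ.* m)
    double m = ≡.trans (≡.cong (ℚ._* fromℕ m) (≡.sym (ℚMult.×1-homo-* 2 B))) (≡.sym (ℚMult.×1-homo-* (2 ℕ.* B) m))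
    bound : ∀ k → ‖ pow c k ‖≤ C ℚ.* fromℕ ((2 ℕ.* B) ℕ.^ k)
    bound zero    = ≡.subst (‖ 1# ‖≤_) (≡.sym (ℚₚ.*-identityʳ C)) (proj₂ (‖‖-finite 1#))
    bound (suc k) = ≡.subst (‖ c * pow c k ‖≤_)
      (≡.trans (extract 2ℚ (fromℕ B) C (fromℕ ((2 ℕ.* B) ℕ.^ k))) (≡.cong (C ℚ.*_) (double ((2 ℕ.* B) ℕ.^ k))))
      (‖‖-* (‖‖-mono (proj₂ (archimedean (proj₁ (‖‖-finite c)))) (proj₂ (‖‖-finite c))) (bound k))

  ExpType-* : ∀ {a b} → ExpType a → ExpType b → ExpType (λ k → a k * b k)
  ExpType-* {a} {b} (C , A , h) (D , B , j) = 2ℚ ℚ.* (C ℚ.* D) , A ℕ.* B , λ k → ≡.subst (‖ a k * b k ‖≤_)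
    (≡.trans (interchange 2ℚ C (fromℕ (A ℕ.^ k)) D (fromℕ (B ℕ.^ k)))
      (≡.cong (2ℚ ℚ.* (C ℚ.* D) ℚ.*_) (≡.trans (≡.sym (ℚMult.×1-homo-* (A ℕ.^ k) (B ℕ.^ k)))
        (≡.cong fromℕ (≡.sym (^-distrib-* A B k))))))
    (‖‖-* (h k) (j k))

-- Linear algebra

uniformBound : ∀ {n} {P : Fin n → ℚ → Set} → (∀ {u p q} → p ℚ.≤ q → P u p → P u q) →
               (∀ u → ∃ (P u)) → ∃ λ q → ∀ u → P u q
uniformBound {zero}  mono h = 0ℚ , λ ()
uniformBound {suc n} {P} mono h =
  let (p , hp) = h zero
      (q , hq) = uniformBound {P = P ∘ suc} (λ {u} → mono {suc u}) (h ∘ suc)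
  in p ℚ.⊔ q , λ { zero → mono {zero} (ℚₚ.p≤p⊔q p q) hp ; (suc u) → mono {suc u} (ℚₚ.p≤q⊔p p q) (hq u) }

module Linear (𝒩 : NormedRing) where
  open Exponential 𝒩 public
  open CommutativeRing commutativeRing public hiding (zero)
  open PartialSum rawRing public
  open SemiringSum semiring
    using (sum-cong-≋; ∑-distrib-+; ∑-comm; *-distribˡ-sum; *-distribʳ-sum; sum-replicate-zero)
  open RingProperties ring using (-1*x≈-x; -‿involutive)
  open LinearAlgebra rawRing public
    using (Matrix; _≋_; _≋ₘ_; ∑; 𝟎; 𝟏; diagonal; I; _+ₘ_; _-ₘ_; _*ₘ_; _•ₘ_; _*ᵥ_; _^ₘ_; _⊗_; _⊗ₘ_; _•_)
  open SemiringSolver commutativeSemiring using (solve; con; _:+_; _:*_; _:=_)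
  open SetoidReasoning setoid

  Vec : ℕ → Set
  Vec = Vector Carrier

  infixl 6 _+ᵥ_

  _+ᵥ_ : ∀ {n} → Vec n → Vec n → Vec n
  (x +ᵥ y) u = x u + y u

  ∑-cong : ∀ {n} {f g : Vec n} → f ≋ g → ∑ f ≈ ∑ g
  ∑-cong = sum-cong-≋

  ∑-zero : ∀ {n} {f : Vec n} → (∀ u → f u ≈ 0#) → ∑ f ≈ 0#
  ∑-zero {n} p = trans (∑-cong p) (sum-replicate-zero n)

  ∑-psum : ∀ (f : Sequence) n → ∑ {n} (λ k → f (toℕ k)) ≈ psum f n
  ∑-psum f zero    = refl
  ∑-psum f (suc n) = trans (+-congˡ (∑-psum (f ∘ suc) n)) (sym (psum-head f n))

  ∑-+ᵥ : ∀ {n} (x y : Vec n) → ∑ (x +ᵥ y) ≈ ∑ x + ∑ y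
  ∑-+ᵥ = ∑-distrib-+

  ∑-• : ∀ {n} a (x : Vec n) → ∑ (a • x) ≈ a * ∑ x
  ∑-• a x = sym (*-distribˡ-sum a x)

  ∑-split : ∀ c {m} (f : Vec (c ℕ.+ m)) → ∑ f ≈ ∑ (λ a → f (a ↑ˡ m)) + ∑ (λ j → f (c ↑ʳ j))
  ∑-split zero    f = sym (+-identityˡ (∑ f))
  ∑-split (suc c) f = trans (+-congˡ (∑-split c (f ∘ suc))) (sym (+-assoc _ _ _))

  ∑-combine : ∀ n {k} (f : Vec (n ℕ.* k)) → ∑ f ≈ ∑ (λ i → ∑ (λ j → f (combine {n} i j)))
  ∑-combine zero        f = refl
  ∑-combine (suc n) {k} f = trans (∑-split k f) (+-congˡ (∑-combine n (f ∘ (k ↑ʳ_))))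

  ∑-*-∑ : ∀ {n k} (f : Vec n) (g : Vec k) → ∑ (λ i → ∑ (λ j → f i * g j)) ≈ ∑ f * ∑ g
  ∑-*-∑ f g = trans (∑-cong λ i → sym (*-distribˡ-sum (f i) g)) (sym (*-distribʳ-sum (∑ g) f))

  diagonal-*ᵥ : ∀ {n} (d x : Vec n) u → (diagonal d *ᵥ x) u ≈ d u * x u
  diagonal-*ᵥ d x zero    = trans (+-congˡ (∑-zero λ v → zeroˡ (x (suc v)))) (+-identityʳ _)
  diagonal-*ᵥ d x (suc u) = trans (+-cong (zeroˡ (x zero)) (diagonal-*ᵥ (d ∘ suc) (x ∘ suc) u)) (+-identityˡ _)

  I-*ᵥ : ∀ {n} (x : Vec n) → I *ᵥ x ≋ x
  I-*ᵥ x u = trans (diagonal-*ᵥ 𝟏 x u) (*-identityˡ (x u))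

  diagonal-scalar : ∀ {n} {d : Vec n} {a} → diagonal d ≋ₘ a •ₘ I → ∀ u → d u ≈ a
  diagonal-scalar {d = d} {a} h u = begin
    d u                          ≈⟨ *-identityʳ (d u) ⟨
    d u * 1#                     ≈⟨ diagonal-*ᵥ d 𝟏 u ⟨
    (diagonal d *ᵥ 𝟏) u          ≈⟨ ∑-cong (λ v → trans (*-congʳ (h u v)) (*-assoc a (I u v) 1#)) ⟩
    ∑ (λ v → a * (I u v * 1#))   ≈⟨ *-distribˡ-sum a (λ v → I u v * 1#) ⟨
    a * (I *ᵥ 𝟏) u               ≈⟨ *-congˡ (diagonal-*ᵥ 𝟏 𝟏 u) ⟩
    a * (1# * 1#)                ≈⟨ trans (*-congˡ (*-identityˡ 1#)) (*-identityʳ a) ⟩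
    a ∎

  *ᵥ-congʳ : ∀ {n} (A : Matrix n) {x y} → x ≋ y → A *ᵥ x ≋ A *ᵥ y
  *ᵥ-congʳ A p u = ∑-cong λ v → *-congˡ (p v)

  *ᵥ-distribˡ-+ : ∀ {n} (A : Matrix n) x y → A *ᵥ (x +ᵥ y) ≋ (A *ᵥ x) +ᵥ (A *ᵥ y)
  *ᵥ-distribˡ-+ A x y u = trans (∑-cong λ v → distribˡ (A u v) (x v) (y v))
    (∑-distrib-+ (λ v → A u v * x v) (λ v → A u v * y v))

  *ᵥ-distribʳ-+ : ∀ {n} (A B : Matrix n) x → (A +ₘ B) *ᵥ x ≋ (A *ᵥ x) +ᵥ (B *ᵥ x)
  *ᵥ-distribʳ-+ A B x u = trans (∑-cong λ v → distribʳ (x v) (A u v) (B u v))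
    (∑-distrib-+ (λ v → A u v * x v) (λ v → B u v * x v))

  *ᵥ-• : ∀ {n} (A : Matrix n) a x → A *ᵥ (a • x) ≋ a • (A *ᵥ x)
  *ᵥ-• A a x u = trans
    (∑-cong λ v → solve 3 (λ m a x → m :* (a :* x) := a :* (m :* x)) refl (A u v) a (x v))
    (sym (*-distribˡ-sum a (λ v → A u v * x v)))

  •ₘ-*ᵥ : ∀ {n} a (A : Matrix n) x → (a •ₘ A) *ᵥ x ≋ a • (A *ᵥ x)
  •ₘ-*ᵥ a A x u = trans (∑-cong λ v → *-assoc a (A u v) (x v)) (sym (*-distribˡ-sum a (λ v → A u v * x v)))

  *ₘ-*ᵥ : ∀ {n} (A B : Matrix n) x → (A *ₘ B) *ᵥ x ≋ A *ᵥ (B *ᵥ x)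
  *ₘ-*ᵥ A B x u = begin
    ∑ (λ v → ∑ (λ w → A u w * B w v) * x v)
      ≈⟨ ∑-cong (λ v → *-distribʳ-sum (x v) (λ w → A u w * B w v)) ⟩
    ∑ (λ v → ∑ (λ w → A u w * B w v * x v))
      ≈⟨ ∑-comm (λ v w → A u w * B w v * x v) ⟩
    ∑ (λ w → ∑ (λ v → A u w * B w v * x v))
      ≈⟨ ∑-cong (λ w → trans (∑-cong λ v → *-assoc (A u w) (B w v) (x v))
           (sym (*-distribˡ-sum (A u w) (λ v → B w v * x v)))) ⟩
    ∑ (λ w → A u w * ∑ (λ v → B w v * x v)) ∎

  -- `iterate` applies the map to the starting vector, so the orbit of x at k + 1 is by definition
  -- the orbit of A x at k. Inductions on k therefore leave x free.
  orbit : ∀ {n} → Matrix n → Vec n → ℕ → Vec n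
  orbit A = iterate (A *ᵥ_)

  orbit-cong : ∀ {n} (A : Matrix n) {x y} → x ≋ y → ∀ k → orbit A x k ≋ orbit A y k
  orbit-cong A p zero    = p
  orbit-cong A p (suc k) = orbit-cong A (*ᵥ-congʳ A p) k

  orbit-+ : ∀ {n} (A : Matrix n) x y k → orbit A (x +ᵥ y) k ≋ orbit A x k +ᵥ orbit A y k
  orbit-+ A x y zero    u = refl
  orbit-+ A x y (suc k) u = trans (orbit-cong A (*ᵥ-distribˡ-+ A x y) k u) (orbit-+ A (A *ᵥ x) (A *ᵥ y) k u)

  *ᵥ-orbit : ∀ {n} (A : Matrix n) x k → A *ᵥ orbit A x k ≋ orbit A x (suc k)
  *ᵥ-orbit A x zero    u = refl
  *ᵥ-orbit A x (suc k) u = *ᵥ-orbit A (A *ᵥ x) k u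

  ^ₘ-*ᵥ : ∀ {n} (A : Matrix n) x k → (A ^ₘ k) *ᵥ x ≋ orbit A x k
  ^ₘ-*ᵥ A x zero    u = trans (diagonal-*ᵥ 𝟏 x u) (*-identityˡ (x u))
  ^ₘ-*ᵥ A x (suc k) u = begin
    ((A *ₘ A ^ₘ k) *ᵥ x) u    ≈⟨ *ₘ-*ᵥ A (A ^ₘ k) x u ⟩
    (A *ᵥ ((A ^ₘ k) *ᵥ x)) u  ≈⟨ *ᵥ-congʳ A (^ₘ-*ᵥ A x k) u ⟩
    (A *ᵥ orbit A x k) u      ≈⟨ *ᵥ-orbit A x k u ⟩
    orbit A x (suc k) u ∎

  basis : ∀ {n} → Fin n → Vec n
  basis v u = I u v

  -- Makes the entries of a power into coordinates of orbits of basis vectors, so growth has to be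
  -- estimated for orbits only.
  *ᵥ-basis : ∀ {n} (A : Matrix n) u v → (A *ᵥ basis v) u ≈ A u v
  *ᵥ-basis A u v = go (A u) v
    where
    go : ∀ {n} (f : Vec n) v → ∑ (λ w → f w * I w v) ≈ f v
    go f zero    = trans (+-cong (*-identityʳ (f zero)) (∑-zero λ w → zeroʳ (f (suc w)))) (+-identityʳ (f zero))
    go f (suc v) = trans (+-cong (zeroʳ (f zero)) (go (f ∘ suc) v)) (+-identityˡ (f (suc v)))

  -- The invariant is there because padding intertwines the two matrices only on vectors of zero
  -- sum.
  orbit-transport : ∀ {m n} (A : Matrix m) (B : Matrix n) (φ : Vec m → Vec n) (Inv : Vec m → Set) →
    (∀ x → Inv x → Inv (A *ᵥ x)) → (∀ x → Inv x → B *ᵥ φ x ≋ φ (A *ᵥ x)) →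
    ∀ x → Inv x → ∀ k → orbit B (φ x) k ≋ φ (orbit A x k)
  orbit-transport A B φ Inv inv step x h zero    u = refl
  orbit-transport A B φ Inv inv step x h (suc k) u = trans (orbit-cong B (step x h) k u)
    (orbit-transport A B φ Inv inv step (A *ᵥ x) (inv x h) k u)

  -- A function obeying the Leibniz rule for two dynamical systems is a binomial convolution.
  leibniz : ∀ {X Y : Set} (f : X → X) (g : Y → Y) (α : X → Carrier) (β : Y → Carrier)
    (F : ℕ → X → Y → Carrier) →
    (∀ x y → F 0 x y ≈ α x * β y) → (∀ k x y → F (suc k) x y ≈ F k (f x) y + F k x (g y)) →
    ∀ k x y → F k x y ≈ conv (α ∘ iterate f x) (β ∘ iterate g y) k
  leibniz f g α β F p q zero    x y = p x y
  leibniz f g α β F p q (suc k) x y = trans (q k x y)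
    (+-cong (leibniz f g α β F p q k (f x) y) (leibniz f g α β F p q k x (g y)))

  orbit-⊗ : ∀ {n k} (P : Matrix n) (Q : Matrix k) (B : Matrix (n ℕ.* k)) →
    (∀ x w → B *ᵥ (x ⊗ w) ≋ (P *ᵥ x) ⊗ w +ᵥ x ⊗ (Q *ᵥ w)) →
    ∀ x w j p → orbit B (x ⊗ w) j p ≈
      conv (λ i → orbit P x i (quotient k p)) (λ i → orbit Q w i (remainder {n} k p)) j
  orbit-⊗ {n} {k} P Q B h x w j p = leibniz (P *ᵥ_) (Q *ᵥ_)
    (λ x → x (quotient k p)) (λ w → w (remainder {n} k p))
    (λ j x w → orbit B (x ⊗ w) j p) (λ _ _ → refl)
    (λ j x w → trans (orbit-cong B (h x w) j p) (orbit-+ B ((P *ᵥ x) ⊗ w) (x ⊗ (Q *ᵥ w)) j p)) j x w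

  iterate-* : ∀ μ z k → iterate (μ *_) z k ≈ pow μ k * z
  iterate-* μ z zero    = sym (*-identityˡ z)
  iterate-* μ z (suc k) = trans (iterate-* μ (μ * z) k)
    (solve 3 (λ m p z → p :* (m :* z) := (m :* p) :* z) refl μ (pow μ k) z)

  -- The scalar in front of x is treated as a dynamical system of its own, r to μ r, started at 1; T
  -- acts on r • x by the Leibniz rule for this system and B.
  orbit-shift : ∀ {n} (T B : Matrix n) μ → (∀ x → T *ᵥ x ≋ μ • x +ᵥ B *ᵥ x) →
    ∀ x k u → orbit T x k u ≈ conv (pow μ) (λ j → orbit B x j u) k
  orbit-shift T B μ h x k u = begin
    orbit T x k u
      ≈⟨ orbit-cong T (λ v → sym (*-identityˡ (x v))) k u ⟩
    orbit T (1# • x) k u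
      ≈⟨ leibniz (μ *_) (B *ᵥ_) (λ r → r) (λ x → x u) (λ k r x → orbit T (r • x) k u) (λ _ _ → refl)
           (λ k r x → trans (orbit-cong T (step r x) k u) (orbit-+ T ((μ * r) • x) (r • (B *ᵥ x)) k u)) k 1# x ⟩
    conv (iterate (μ *_) 1#) (λ j → orbit B x j u) k
      ≈⟨ conv-cong (λ j → trans (iterate-* μ 1# j) (*-identityʳ (pow μ j))) (λ _ → refl) k ⟩
    conv (pow μ) (λ j → orbit B x j u) k ∎
    where
    step : ∀ r x → T *ᵥ (r • x) ≋ (μ * r) • x +ᵥ r • (B *ᵥ x)
    step r x u = begin
      (T *ᵥ (r • x)) u                ≈⟨ *ᵥ-• T r x u ⟩
      r * (T *ᵥ x) u                  ≈⟨ *-congˡ (h x u) ⟩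
      r * (μ * x u + (B *ᵥ x) u)
        ≈⟨ solve 4 (λ r m x y → r :* (m :* x :+ y) := m :* r :* x :+ r :* y) refl r μ (x u) _ ⟩
      μ * r * x u + r * (B *ᵥ x) u ∎

  orbit-•ₘ : ∀ {n} s (A : Matrix n) x k u → orbit (s •ₘ A) x k u ≈ pow s k * orbit A x k u
  orbit-•ₘ s A x k u = trans (orbit-cong (s •ₘ A) (λ v → sym (*-identityˡ (x v))) k u)
      (trans (go 1# x k) (*-congʳ (*-identityʳ (pow s k))))
    where
    -- The scalar collected so far is carried along, as the orbit unfolds from its starting vector.
    go : ∀ r x k → orbit (s •ₘ A) (r • x) k u ≈ pow s k * r * orbit A x k u
    go r x zero    = *-congʳ (sym (*-identityˡ r))
    go r x (suc k) = begin
      orbit (s •ₘ A) ((s •ₘ A) *ᵥ (r • x)) k u   ≈⟨ orbit-cong (s •ₘ A) step k u ⟩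
      orbit (s •ₘ A) ((s * r) • (A *ᵥ x)) k u    ≈⟨ go (s * r) (A *ᵥ x) k ⟩
      pow s k * (s * r) * orbit A (A *ᵥ x) k u
        ≈⟨ solve 4 (λ p s r y → p :* (s :* r) :* y := s :* p :* r :* y) refl
                                                      (pow s k) s r _ ⟩
      pow s (suc k) * r * orbit A x (suc k) u    ∎
      where
      step : (s •ₘ A) *ᵥ (r • x) ≋ (s * r) • (A *ᵥ x)
      step v = trans (•ₘ-*ᵥ s A (r • x) v) (trans (*-congˡ (*ᵥ-• A r x v)) (sym (*-assoc s r _)))

  ‖∑‖ : ∀ {n} {f : Vec n} {q} → (∀ u → ‖ f u ‖≤ q) → ‖ ∑ f ‖≤ fromℕ n ℚ.* q
  ‖∑‖ {zero}  {f} {q} h = ≡.subst (‖ 0# ‖≤_) (≡.sym (ℚₚ.*-zeroˡ q)) ‖0‖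
  ‖∑‖ {suc n} {f} {q} h = ≡.subst (‖ ∑ f ‖≤_)
    (≡.trans (≡.cong (ℚ._+ fromℕ n ℚ.* q) (≡.sym (ℚₚ.*-identityˡ q))) (≡.sym (ℚₚ.*-distribʳ-+ q 1ℚ (fromℕ n))))
    (‖‖-+ (h zero) (‖∑‖ (h ∘ suc)))

  ExpType-orbit : ∀ {n} (A : Matrix n) x u → ExpType (λ k → orbit A x k u)
  ExpType-orbit {n} A x u =
    let (C , ‖x‖)  = uniformBound {P = λ v → ‖ x v ‖≤_} ‖‖-mono (λ v → ‖‖-finite (x v))
        (b , ‖A‖)  = uniformBound {P = λ v q → ∀ w → ‖ A v w ‖≤ q} (λ p h w → ‖‖-mono p (h w))
                       (λ v → uniformBound {P = λ w → ‖ A v w ‖≤_} ‖‖-mono (λ w → ‖‖-finite (A v w)))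
        (B , b≤B)  = archimedean b
    -- A coordinate of A x is a sum of n products, each at most 2 B times the bound on x.
    in C , n ℕ.* (2 ℕ.* B) , λ k → go B (λ v w → ‖‖-mono b≤B (‖A‖ v w)) k x C ‖x‖ u
    where
    go : ∀ B → (∀ v w → ‖ A v w ‖≤ fromℕ B) → ∀ k x C → (∀ v → ‖ x v ‖≤ C) →
         ∀ u → ‖ orbit A x k u ‖≤ C ℚ.* fromℕ ((n ℕ.* (2 ℕ.* B)) ℕ.^ k)
    go B ‖A‖ zero    x C ‖x‖ u = ≡.subst (‖ x u ‖≤_) (≡.sym (ℚₚ.*-identityʳ C)) (‖x‖ u)
    go B ‖A‖ (suc k) x C ‖x‖ u = ≡.subst (‖ orbit A (A *ᵥ x) k u ‖≤_) (step D (D ℕ.^ k))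
      (go B ‖A‖ k (A *ᵥ x) (C ℚ.* fromℕ D) (λ v → ≡.subst (‖ (A *ᵥ x) v ‖≤_) collect
        (‖∑‖ λ w → ‖‖-* (‖A‖ v w) (‖x‖ w))) u)
      where
      D = n ℕ.* (2 ℕ.* B)
      collect : fromℕ n ℚ.* (2ℚ ℚ.* (fromℕ B ℚ.* C)) ≡ C ℚ.* fromℕ D
      collect = ≡.trans (rotate (fromℕ n) 2ℚ (fromℕ B) C)
        (≡.cong (C ℚ.*_) (≡.trans (≡.cong (fromℕ n ℚ.*_) (≡.sym (ℚMult.×1-homo-* 2 B)))
          (≡.sym (ℚMult.×1-homo-* n (2 ℕ.* B)))))
      step : ∀ a b → C ℚ.* fromℕ a ℚ.* fromℕ b ≡ C ℚ.* fromℕ (a ℕ.* b)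
      step a b = ≡.trans (ℚₚ.*-assoc C (fromℕ a) (fromℕ b)) (≡.cong (C ℚ.*_) (≡.sym (ℚMult.×1-homo-* a b)))

  -- Each M is ε Δ + σ A.
  ε σ : MatrixKind → Carrier
  ε adjacency         = 0#
  ε laplacian         = 1#
  ε signlessLaplacian = 1#
  σ adjacency         = 1#
  σ laplacian         = - 1#
  σ signlessLaplacian = 1#

  -- Degrees are written as W *ᵥ 𝟏, so that the lemmas on the action of W also compute degrees.
  op : ∀ {n} → MatrixKind → Matrix n → Vec n → Vec n
  op M W x u = ε M * ((W *ᵥ 𝟏) u * x u) + σ M * (W *ᵥ x) u

  -1*-1≈1 : - 1# * - 1# ≈ 1#
  -1*-1≈1 = trans (-1*x≈-x (- 1#)) (-‿involutive 1#)

  *ᵥ-𝟏 : ∀ {n} (W : Matrix n) u → (W *ᵥ 𝟏) u ≈ ∑ (W u)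
  *ᵥ-𝟏 W u = ∑-cong λ v → *-identityʳ (W u v)

  -- `⟦_⟧` for a bare weight matrix over any of the rings; at ℝ the two agree by computation once M
  -- is a constructor.
  kind : ∀ {n} → MatrixKind → Matrix n → Matrix n
  kind adjacency         W = W
  kind laplacian         W = diagonal (λ u → ∑ (W u)) -ₘ W
  kind signlessLaplacian W = diagonal (λ u → ∑ (W u)) +ₘ W

  kind-*ᵥ : ∀ {n} M (W : Matrix n) x → kind M W *ᵥ x ≋ op M W x
  kind-*ᵥ adjacency         W x u = solve 2 (λ a b → b := con 0 :* a :+ con 1 :* b) refl
    ((W *ᵥ 𝟏) u * x u) ((W *ᵥ x) u)
  kind-*ᵥ laplacian         W x u = trans (*ᵥ-distribʳ-+ (diagonal (λ u → ∑ (W u))) (λ u v → - W u v) x u)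
    (+-cong
      (trans (diagonal-*ᵥ (λ u → ∑ (W u)) x u) (trans (*-congʳ (sym (*ᵥ-𝟏 W u))) (sym (*-identityˡ _))))
      (trans (∑-cong λ v → trans (*-congʳ (sym (-1*x≈-x (W u v)))) (*-assoc (- 1#) (W u v) (x v)))
        (sym (*-distribˡ-sum (- 1#) (λ v → W u v * x v)))))
  kind-*ᵥ signlessLaplacian W x u = trans (*ᵥ-distribʳ-+ (diagonal (λ u → ∑ (W u))) W x u)
    (+-cong
      (trans (diagonal-*ᵥ (λ u → ∑ (W u)) x u) (trans (*-congʳ (sym (*ᵥ-𝟏 W u))) (sym (*-identityˡ _))))
      (sym (*-identityˡ _)))

  σ-ratio : ∀ M M′ → ∃ λ s → (s ≈ 1# ⊎ s ≈ - 1#) × (s * σ M ≈ σ M′)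
  σ-ratio adjacency         M′ = σ M′ , ± M′ , *-identityʳ (σ M′)
    where
    ± : ∀ M → σ M ≈ 1# ⊎ σ M ≈ - 1#
    ± adjacency         = inj₁ refl
    ± laplacian         = inj₂ refl
    ± signlessLaplacian = inj₁ refl
  σ-ratio laplacian         laplacian         = 1# , inj₁ refl , *-identityˡ (- 1#)
  σ-ratio laplacian         adjacency         = - 1# , inj₂ refl , -1*-1≈1
  σ-ratio laplacian         signlessLaplacian = - 1# , inj₂ refl , -1*-1≈1
  σ-ratio signlessLaplacian M′ = σ-ratio adjacency M′

  -- Regular graphs

  module _ {n} {W : Matrix n} {d : Carrier} (regular : ∀ u → (W *ᵥ 𝟏) u ≈ d) where

    op-regular : ∀ M x u → op M W x u ≈ ε M * d * x u + σ M * (W *ᵥ x) u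
    op-regular M x u = +-congʳ (trans (*-congˡ (*-congʳ (regular u))) (sym (*-assoc (ε M) d (x u))))

    -- Here Δ is the scalar d. If s is the ratio of the signs of A in M′ and M, then A cancels in M′
    -- - s M and the scalar (ε M′ - s ε M) d is left.
    op-change : ∀ M M′ → ∃ λ μ → ∃ λ s → (s ≈ 1# ⊎ s ≈ - 1#) ×
                (∀ x u → op M′ W x u ≈ μ * x u + s * op M W x u)
    op-change M M′ = let (s , s² , e) = σ-ratio M M′
                         μ = ε M′ * d - s * (ε M * d) in
      μ , s , s² , λ x u → begin
        op M′ W x u
          ≈⟨ op-regular M′ x u ⟩
        ε M′ * d * x u + σ M′ * (W *ᵥ x) u
          ≈⟨ +-cong (*-congʳ (x+[y-x]≈y (s * (ε M * d)) (ε M′ * d))) (*-congʳ e) ⟨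
        (s * (ε M * d) + μ) * x u + s * σ M * (W *ᵥ x) u
          ≈⟨ solve 6 (λ s e m x t y → (s :* e :+ m) :* x :+ s :* t :* y := m :* x :+ s :* (e :* x :+ t :* y)) refl
               s (ε M * d) μ (x u) (σ M) ((W *ᵥ x) u) ⟩
        μ * x u + s * (ε M * d * x u + σ M * (W *ᵥ x) u)
          ≈⟨ +-congˡ (*-congˡ (op-regular M x u)) ⟨
        μ * x u + s * op M W x u ∎

    -- By symmetry the column sums are d too, so the operator multiplies the total ∑ x by (ε M + σ
    -- M) d.
    op-∑≈0 : (∀ u v → W u v ≈ W v u) → ∀ M x → ∑ x ≈ 0# → ∑ (op M W x) ≈ 0#
    op-∑≈0 W-sym M x ∑x≈0 = begin
      ∑ (op M W x)
        ≈⟨ ∑-cong (op-regular M x) ⟩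
      ∑ (λ u → ε M * d * x u + σ M * (W *ᵥ x) u)
        ≈⟨ ∑-distrib-+ (λ u → ε M * d * x u) (λ u → σ M * (W *ᵥ x) u) ⟩
      ∑ (λ u → ε M * d * x u) + ∑ (λ u → σ M * (W *ᵥ x) u)
        ≈⟨ +-cong (sym (*-distribˡ-sum (ε M * d) x)) (sym (*-distribˡ-sum (σ M) (W *ᵥ x))) ⟩
      ε M * d * ∑ x + σ M * ∑ (W *ᵥ x)
        ≈⟨ +-congˡ (*-congˡ ∑Wx) ⟩
      ε M * d * ∑ x + σ M * (d * ∑ x)
        ≈⟨ solve 4 (λ e d s t → e :* d :* t :+ s :* (d :* t) := (e :* d :+ s :* d) :* t) refl (ε M) d (σ M) (∑ x) ⟩
      (ε M * d + σ M * d) * ∑ x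
        ≈⟨ trans (*-congˡ ∑x≈0) (zeroʳ _) ⟩
      0# ∎
      where
      ∑Wx : ∑ (W *ᵥ x) ≈ d * ∑ x
      ∑Wx = begin
        ∑ (λ u → ∑ (λ v → W u v * x v))   ≈⟨ ∑-comm (λ u v → W u v * x v) ⟩
        ∑ (λ v → ∑ (λ u → W u v * x v))   ≈⟨ ∑-cong (λ v → sym (*-distribʳ-sum (x v) (λ u → W u v))) ⟩
        ∑ (λ v → ∑ (λ u → W u v) * x v)   ≈⟨ ∑-cong (λ v → *-congʳ (trans (∑-cong λ u →
                                               trans (W-sym u v) (sym (*-identityʳ (W v u)))) (regular v))) ⟩
        ∑ (λ v → d * x v)                 ≈⟨ *-distribˡ-sum d x ⟨
        d * ∑ x ∎

  -- Cartesian products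

  module _ {n k} (W₁ : Matrix n) (W₂ : Matrix k) where

    private
      W : Matrix (n ℕ.* k)
      W = W₁ ⊗ₘ I {k} +ₘ I {n} ⊗ₘ W₂

    cartesian-*ᵥ : ∀ x w → W *ᵥ (x ⊗ w) ≋ (W₁ *ᵥ x) ⊗ w +ᵥ x ⊗ (W₂ *ᵥ w)
    cartesian-*ᵥ x w p = begin
      ∑ (λ q → W p q * (x ⊗ w) q)
        ≈⟨ ∑-combine n (λ q → W p q * (x ⊗ w) q) ⟩
      ∑ (λ a → ∑ (λ b → W p (combine {n} a b) * (x ⊗ w) (combine {n} a b)))
        ≈⟨ ∑-cong (λ a → ∑-cong (λ b → entry a b)) ⟩
      ∑ (λ a → ∑ (λ b → W₁ i a * x a * (I j b * w b) + I i a * x a * (W₂ j b * w b)))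
        ≈⟨ ∑-cong (λ a → ∑-distrib-+ (λ b → W₁ i a * x a * (I j b * w b)) (λ b → I i a * x a * (W₂ j b * w b))) ⟩
      ∑ (λ a → ∑ (λ b → W₁ i a * x a * (I j b * w b)) + ∑ (λ b → I i a * x a * (W₂ j b * w b)))
        ≈⟨ ∑-distrib-+ (λ a → ∑ (λ b → W₁ i a * x a * (I j b * w b))) (λ a → ∑ (λ b → I i a * x a * (W₂ j b * w b))) ⟩
      ∑ (λ a → ∑ (λ b → W₁ i a * x a * (I j b * w b))) + ∑ (λ a → ∑ (λ b → I i a * x a * (W₂ j b * w b)))
        ≈⟨ +-cong (∑-*-∑ (λ a → W₁ i a * x a) (λ b → I j b * w b)) (∑-*-∑ (λ a → I i a * x a) (λ b → W₂ j b * w b)) ⟩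
      (W₁ *ᵥ x) i * (I *ᵥ w) j + (I *ᵥ x) i * (W₂ *ᵥ w) j
        ≈⟨ +-cong (*-congˡ (I-*ᵥ w j)) (*-congʳ (I-*ᵥ x i)) ⟩
      (W₁ *ᵥ x) i * w j + x i * (W₂ *ᵥ w) j ∎
      where
      i = quotient k p
      j = remainder {n} k p
      entry : ∀ a b → W p (combine {n} a b) * (x ⊗ w) (combine {n} a b) ≈
                      W₁ i a * x a * (I j b * w b) + I i a * x a * (W₂ j b * w b)
      entry a b = trans
        -- `quotient` and `remainder` are the two projections of `remQuot`, so a single equation of
        -- pairs evaluates both at `combine a b`.
        (reflexive (≡.cong (λ (a , b) → (W₁ i a * I j b + I i a * W₂ j b) * (x a * w b)) (Finₚ.remQuot-combine {n} a b)))
        (solve 6 (λ u δ η v x w → (u :* δ :+ η :* v) :* (x :* w) := u :* x :* (δ :* w) :+ η :* x :* (v :* w)) refl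
          (W₁ i a) (I j b) (I i a) (W₂ j b) (x a) (w b))

    -- Degrees add in the product: 𝟏 is 𝟏 ⊗ 𝟏, so `cartesian-*ᵥ` handles the degree part as well.
    op-cartesian : ∀ M x w → op M W (x ⊗ w) ≋ op M W₁ x ⊗ w +ᵥ x ⊗ op M W₂ w
    op-cartesian M x w p = begin
      ε M * ((W *ᵥ 𝟏) p * (x i * w j)) + σ M * (W *ᵥ (x ⊗ w)) p
        ≈⟨ +-cong (*-congˡ (*-congʳ (*ᵥ-congʳ W {𝟏} {𝟏 {n} ⊗ 𝟏 {k}} (λ _ → sym (*-identityˡ 1#)) p))) refl ⟩
      ε M * ((W *ᵥ (𝟏 {n} ⊗ 𝟏 {k})) p * (x i * w j)) + σ M * (W *ᵥ (x ⊗ w)) p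
        ≈⟨ +-cong (*-congˡ (*-congʳ (cartesian-*ᵥ 𝟏 𝟏 p))) (*-congˡ (cartesian-*ᵥ x w p)) ⟩
      ε M * ((D₁ * 1# + 1# * D₂) * (x i * w j)) + σ M * ((W₁ *ᵥ x) i * w j + x i * (W₂ *ᵥ w) j)
        ≈⟨ solve 8 (λ e d₁ d₂ x w s y z →
             e :* ((d₁ :* con 1 :+ con 1 :* d₂) :* (x :* w)) :+ s :* (y :* w :+ x :* z)
             := (e :* (d₁ :* x) :+ s :* y) :* w :+ x :* (e :* (d₂ :* w) :+ s :* z)) refl
             (ε M) D₁ D₂ (x i) (w j) (σ M) ((W₁ *ᵥ x) i) ((W₂ *ᵥ w) j) ⟩
      op M W₁ x i * w j + x i * op M W₂ w j ∎
      where
      i = quotient k p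
      j = remainder {n} k p
      D₁ = (W₁ *ᵥ 𝟏) i
      D₂ = (W₂ *ᵥ 𝟏) j

  -- Padded vectors and clusters

  pad : ∀ {c} m → Vec c → Vec (c ℕ.+ m)
  pad m x = x ++ 𝟎 {m}

  pad-cong : ∀ {c} m {x y : Vec c} → x ≋ y → pad m x ≋ pad m y
  pad-cong {c} m h u with splitAt c u
  ... | inj₁ a = h a
  ... | inj₂ _ = refl

  pad-ˡ : ∀ {c} m (x : Vec c) a → pad m x (a ↑ˡ m) ≡ x a
  pad-ˡ m x = Vectorₚ.lookup-++ˡ x (𝟎 {m})

  pad-ʳ : ∀ {c} m (x : Vec c) j → pad m x (c ↑ʳ j) ≡ 0#
  pad-ʳ m x = Vectorₚ.lookup-++ʳ x (𝟎 {m})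

  -- The vertices a ↑ˡ m form the set C of a cluster of the graph with weights W,
  -- and L is the matrix of weights V on C, padded by zeros.
  module _ {c m} {W L : Matrix (c ℕ.+ m)} {V : Matrix c}
    (W-sym   : ∀ u v → W u v ≈ W v u)
    (W-const : ∀ a b v → W (a ↑ˡ m) v ≈ W (b ↑ˡ m) v)
    (L-ˡˡ    : ∀ a b → L (a ↑ˡ m) (b ↑ˡ m) ≈ V a b)
    (L-ˡʳ    : ∀ a j → L (a ↑ˡ m) (c ↑ʳ j) ≈ 0#)
    (L-ʳ     : ∀ j v → L (c ↑ʳ j) v ≈ 0#) where

    ∑-pad : ∀ (f : Vec (c ℕ.+ m)) x → ∑ (λ u → f u * pad m x u) ≈ ∑ (λ a → f (a ↑ˡ m) * x a)
    ∑-pad f x = begin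
      ∑ (λ u → f u * pad m x u)
        ≈⟨ ∑-split c (λ u → f u * pad m x u) ⟩
      ∑ (λ a → f (a ↑ˡ m) * pad m x (a ↑ˡ m)) + ∑ (λ j → f (c ↑ʳ j) * pad m x (c ↑ʳ j))
        ≈⟨ +-cong (∑-cong λ a → *-congˡ (reflexive (pad-ˡ m x a)))
             (∑-zero λ j → trans (*-congˡ (reflexive (pad-ʳ m x j))) (zeroʳ _)) ⟩
      ∑ (λ a → f (a ↑ˡ m) * x a) + 0#
        ≈⟨ +-identityʳ _ ⟩
      ∑ (λ a → f (a ↑ˡ m) * x a) ∎

    -- By symmetry and `W-const` each row of W is constant on C, so it pairs with x to a multiple of
    -- ∑ x.
    W-pad : ∀ x → ∑ x ≈ 0# → ∀ u → (W *ᵥ pad m x) u ≈ 0#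
    W-pad x ∑x≈0 u = trans (∑-pad (W u) x) (constant (λ a → W u (a ↑ˡ m)) x ∑x≈0
        λ a b → trans (W-sym u (a ↑ˡ m)) (trans (W-const a b u) (W-sym (b ↑ˡ m) u)))
      where
      constant : ∀ {c} (f x : Vec c) → ∑ x ≈ 0# → (∀ a b → f a ≈ f b) → ∑ (λ a → f a * x a) ≈ 0#
      constant {zero}  f x _    _    = refl
      constant {suc c} f x ∑x≈0 same = trans (∑-cong λ a → *-congʳ {x a} (same a zero))
        (trans (sym (*-distribˡ-sum (f zero) x)) (trans (*-congˡ ∑x≈0) (zeroʳ (f zero))))

    L-*ᵥˡ : ∀ x a → (L *ᵥ pad m x) (a ↑ˡ m) ≈ (V *ᵥ x) a
    L-*ᵥˡ x a = trans (∑-pad (L (a ↑ˡ m)) x) (∑-cong λ b → *-congʳ (L-ˡˡ a b))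

    L-𝟏 : ∀ a → (L *ᵥ 𝟏) (a ↑ˡ m) ≈ (V *ᵥ 𝟏) a
    L-𝟏 a = trans (∑-split c (λ u → L (a ↑ˡ m) u * 1#)) (trans (+-cong (∑-cong λ b → *-congʳ (L-ˡˡ a b))
      (∑-zero λ j → trans (*-congʳ (L-ˡʳ a j)) (zeroˡ 1#))) (+-identityʳ _))

    degree-const : ∃ λ g → ∀ a → (W *ᵥ 𝟏) (a ↑ˡ m) ≈ g
    degree-const = go c (λ a → (W *ᵥ 𝟏) (a ↑ˡ m)) (λ a b → ∑-cong λ v → *-congʳ (W-const a b v))
      where
      go : ∀ c (f : Vec c) → (∀ a b → f a ≈ f b) → ∃ λ g → ∀ a → f a ≈ g
      -- For an empty C any value serves.
      go zero    f same = 0# , λ ()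
      go (suc c) f same = f zero , λ a → same a zero

    -- A vertex of C has degree g in W plus its degree in V, and g gives μ = ε M g. The matrix W
    -- itself kills the padded vector. Outside C the vector vanishes and L has zero rows, so nothing
    -- leaks out of C.
    op-cluster : ∀ M → ∃ λ μ → ∀ x → ∑ x ≈ 0# → op M (W +ₘ L) (pad m x) ≋ pad m (μ • x +ᵥ op M V x)
    op-cluster M = let (g , hg) = degree-const in ε M * g , λ x ∑x≈0 u → go g hg x ∑x≈0 u (splitAt c u) ≡.refl
      where
      go : ∀ g → (∀ a → (W *ᵥ 𝟏) (a ↑ˡ m) ≈ g) → ∀ x → ∑ x ≈ 0# → ∀ u (s : Fin c ⊎ Fin m) → splitAt c u ≡ s →
           op M (W +ₘ L) (pad m x) u ≈ pad m ((ε M * g) • x +ᵥ op M V x) u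
      go g hg x ∑x≈0 u (inj₁ a) eq with Finₚ.splitAt⁻¹-↑ˡ eq
      ... | ≡.refl = begin
        ε M * (((W +ₘ L) *ᵥ 𝟏) v * pad m x v) + σ M * ((W +ₘ L) *ᵥ pad m x) v
          ≈⟨ +-cong
               (*-congˡ (*-cong (trans (*ᵥ-distribʳ-+ W L 𝟏 v) (+-cong (hg a) (L-𝟏 a))) (reflexive (pad-ˡ m x a))))
               (*-congˡ (trans (*ᵥ-distribʳ-+ W L (pad m x) v)
                 (trans (+-cong (W-pad x ∑x≈0 v) (L-*ᵥˡ x a)) (+-identityˡ _)))) ⟩
        ε M * ((g + (V *ᵥ 𝟏) a) * x a) + σ M * (V *ᵥ x) a
          ≈⟨ solve 6 (λ e g d x s y → e :* ((g :+ d) :* x) :+ s :* y := e :* g :* x :+ (e :* (d :* x) :+ s :* y)) refl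
               (ε M) g ((V *ᵥ 𝟏) a) (x a) (σ M) ((V *ᵥ x) a) ⟩
        ε M * g * x a + op M V x a
          ≡⟨ pad-ˡ m ((ε M * g) • x +ᵥ op M V x) a ⟨
        pad m ((ε M * g) • x +ᵥ op M V x) v ∎
        where v = a ↑ˡ m
      go g hg x ∑x≈0 u (inj₂ j) eq with Finₚ.splitAt⁻¹-↑ʳ eq
      ... | ≡.refl = begin
        ε M * (((W +ₘ L) *ᵥ 𝟏) v * pad m x v) + σ M * ((W +ₘ L) *ᵥ pad m x) v
          ≈⟨ +-cong
               (*-congˡ (trans (*-congˡ (reflexive (pad-ʳ m x j))) (zeroʳ _)))
               (*-congˡ (trans (*ᵥ-distribʳ-+ W L (pad m x) v) (trans (+-cong (W-pad x ∑x≈0 v)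
                 (∑-zero λ w → trans (*-congʳ (L-ʳ j w)) (zeroˡ _))) (+-identityˡ 0#)))) ⟩
        ε M * 0# + σ M * 0#
          ≈⟨ trans (+-cong (zeroʳ (ε M)) (zeroʳ (σ M))) (+-identityˡ 0#) ⟩
        0#
          ≡⟨ pad-ʳ m ((ε M * g) • x +ᵥ op M V x) j ⟨
        pad m ((ε M * g) • x +ᵥ op M V x) v ∎
        where v = c ↑ʳ j

-- Exponentials of matrices

-- Abstracts from the inclusion of ℝ in ℂ: matrices and state vectors live in 𝒩, only the scalar c
-- and the transfer factors need 𝒦.
record Complexification (𝒩 𝒦 : NormedRing) : Set where
  private
    module N = Linear 𝒩
    module K = Linear 𝒦
  open K
  field
    ι         : N.Carrier → Carrier
    ι-cong    : ∀ {x y} → x N.≈ y → ι x ≈ ι y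
    ι-+       : ∀ x y → ι (x N.+ y) ≈ ι x + ι y
    ι-*       : ∀ x y → ι (x N.* y) ≈ ι x * ι y
    ι-neg     : ∀ x → ι (N.- x) ≈ - ι x
    ι-0       : ι N.0# ≈ 0#
    ι-1       : ι N.1# ≈ 1#
    conj      : Carrier → Carrier
    conj-cong : ∀ {z w} → z ≈ w → conj z ≈ conj w
    conj-+    : ∀ z w → conj (z + w) ≈ conj z + conj w
    conj-*    : ∀ z w → conj (z * w) ≈ conj z * conj w
    conj-ι    : ∀ x → conj (ι x) ≈ ι x
    conj-inv  : ∀ n → conj (inv n) ≈ inv n
    ‖conj‖    : ∀ {z q} → ‖ z ‖≤ q → ‖ conj z ‖≤ q
    ‖ι‖       : ∀ {x q} → N.‖ x ‖≤ q → ‖ ι x ‖≤ q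

module Evolution {𝒩 𝒦 : NormedRing} (ℭ : Complexification 𝒩 𝒦) where
  open Complexification ℭ
  module N = Linear 𝒩
  open Linear 𝒦
  open SemiringSum semiring using (*-distribˡ-sum; ∑-distrib-+)
  open RingProperties ring using (-‿distribʳ-*)
  open SemiringSolver commutativeSemiring using (solve; con; _:+_; _:*_; _:=_)
  open SetoidReasoning setoid

  ι-∑ : ∀ {n} (x : N.Vec n) → ι (N.∑ x) ≈ ∑ (ι ∘ x)
  ι-∑ {zero}  x = ι-0
  ι-∑ {suc n} x = trans (ι-+ _ _) (+-congˡ (ι-∑ (x ∘ suc)))

  ι-conv : ∀ a b k → ι (N.conv a b k) ≈ conv (ι ∘ a) (ι ∘ b) k
  ι-conv a b zero    = ι-* (a 0) (b 0)
  ι-conv a b (suc k) = trans (ι-+ _ _) (+-cong (ι-conv (a ∘ suc) b k) (ι-conv a (b ∘ suc) k))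

  conv-*ˡ : ∀ c a b k → conv (λ j → c * a j) b k ≈ c * conv a b k
  conv-*ˡ c a b zero    = *-assoc c (a 0) (b 0)
  conv-*ˡ c a b (suc k) = trans (+-cong (conv-*ˡ c (a ∘ suc) b k) (conv-*ˡ c a (b ∘ suc) k)) (sym (distribˡ c _ _))

  conv-*ʳ : ∀ c a b k → conv a (λ j → c * b j) k ≈ c * conv a b k
  conv-*ʳ c a b zero    = solve 3 (λ a c b → a :* (c :* b) := c :* (a :* b)) refl (a 0) c (b 0)
  conv-*ʳ c a b (suc k) = trans (+-cong (conv-*ʳ c (a ∘ suc) b k) (conv-*ʳ c a (b ∘ suc) k)) (sym (distribˡ c _ _))

  -- Every term of the convolution carries the powers c^j and c^(k-j), hence the common factor c^k.
  conv-pow : ∀ c a b k → conv (λ j → pow c j * a j) (λ j → pow c j * b j) k ≈ pow c k * conv a b k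
  conv-pow c a b zero    = solve 2 (λ a b → (con 1 :* a) :* (con 1 :* b) := con 1 :* (a :* b)) refl (a 0) (b 0)
  conv-pow c a b (suc k) = begin
    conv (λ j → c * pow c j * a (suc j)) (λ j → pow c j * b j) k +
    conv (λ j → pow c j * a j) (λ j → c * pow c j * b (suc j)) k
      ≈⟨ +-cong
           (trans (conv-cong {b = λ j → pow c j * b j} (λ j → *-assoc c (pow c j) (a (suc j))) (λ _ → refl) k)
             (conv-*ˡ c (λ j → pow c j * a (suc j)) (λ j → pow c j * b j) k))
           (trans (conv-cong {a = λ j → pow c j * a j} (λ _ → refl) (λ j → *-assoc c (pow c j) (b (suc j))) k)
             (conv-*ʳ c (λ j → pow c j * a j) (λ j → pow c j * b (suc j)) k)) ⟩
    c * conv (λ j → pow c j * a (suc j)) (λ j → pow c j * b j) k +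
    c * conv (λ j → pow c j * a j) (λ j → pow c j * b (suc j)) k
      ≈⟨ +-cong (*-congˡ (conv-pow c (a ∘ suc) b k)) (*-congˡ (conv-pow c a (b ∘ suc) k)) ⟩
    c * (pow c k * conv (a ∘ suc) b k) + c * (pow c k * conv a (b ∘ suc) k)
      ≈⟨ solve 4 (λ c p x y → c :* (p :* x) :+ c :* (p :* y) := c :* p :* (x :+ y)) refl c (pow c k) _ _ ⟩
    pow c (suc k) * conv a b (suc k) ∎

  pow-cong : ∀ {c d} → c ≈ d → ∀ k → pow c k ≈ pow d k
  pow-cong p zero    = refl
  pow-cong p (suc k) = *-cong p (pow-cong p k)

  pow-*ι : ∀ c s k → pow (c * ι s) k ≈ pow c k * ι (N.pow s k)
  pow-*ι c s zero    = sym (trans (*-identityˡ _) ι-1)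
  pow-*ι c s (suc k) = begin
    c * ι s * pow (c * ι s) k              ≈⟨ *-congˡ (pow-*ι c s k) ⟩
    c * ι s * (pow c k * ι (N.pow s k))
      ≈⟨ solve 4 (λ c s p q → c :* s :* (p :* q) := c :* p :* (s :* q)) refl c (ι s) (pow c k) _ ⟩
    pow c (suc k) * (ι s * ι (N.pow s k))  ≈⟨ *-congˡ (ι-* s (N.pow s k)) ⟨
    pow c (suc k) * ι (N.pow s (suc k)) ∎

  conj-pow : ∀ c k → conj (pow c k) ≈ pow (conj c) k
  conj-pow c zero    = trans (conj-cong (sym ι-1)) (trans (conj-ι N.1#) ι-1)
  conj-pow c (suc k) = trans (conj-* c (pow c k)) (*-congˡ (conj-pow c k))

  conj-psum : ∀ f n → conj (psum f n) ≈ psum (conj ∘ f) n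
  conj-psum f zero    = trans (conj-cong (sym ι-0)) (trans (conj-ι N.0#) ι-0)
  conj-psum f (suc n) = trans (conj-+ _ _) (+-congʳ (conj-psum f n))

  -- Conjugation is additive, fixes 1 / k! and preserves norm bounds, so it passes through partial
  -- sums and limits.
  ExpSum-conj : ∀ {a α} → ExpSum a α → ExpSum (conj ∘ a) (conj α)
  ExpSum-conj {a} {α} h q 0<q = let (N , k) = h q 0<q in
    N , λ n N≤n → ‖‖-resp (sym (x≈y+z⇒x-y≈z (begin
      psum (term (conj ∘ a)) n
        ≈⟨ psum-cong (λ k → trans (conj-* (inv k) (a k)) (*-congʳ (conj-inv k))) n ⟨
      psum (conj ∘ term a) n                       ≈⟨ conj-psum (term a) n ⟨
      conj (psum (term a) n)                       ≈⟨ conj-cong (x+[y-x]≈y α (psum (term a) n)) ⟨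
      conj (α + (psum (term a) n - α))             ≈⟨ conj-+ α _ ⟩
      conj α + conj (psum (term a) n - α)          ∎)))
      (‖conj‖ (k n N≤n))

  ExpSum-zero : ExpSum (λ _ → 0#) 0#
  ExpSum-zero = ⇝-resp (λ n → sym (zero-psum n)) refl (⇝-const 0#)
    where
    zero-psum : ∀ n → psum (term (λ _ → 0#)) n ≈ 0#
    zero-psum zero    = refl
    zero-psum (suc n) = trans (+-cong (zero-psum n) (zeroʳ (inv n))) (+-identityˡ 0#)

  ExpSum-*ᵥ : ∀ {n} (Z : ℕ → Matrix n) (U : Matrix n) x → (∀ u v → ExpSum (λ k → Z k u v) (U u v)) →
              ∀ u → ExpSum (λ k → (Z k *ᵥ x) u) ((U *ᵥ x) u)
  ExpSum-*ᵥ {n} Z U x h u = ⇝-resp (λ N → sym (split N)) refl (⇝-sum λ v → ⇝-* (h u v) (⇝-const (x v)))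
    where
    split : ∀ N → psum (term (λ k → (Z k *ᵥ x) u)) N ≈ ∑ (λ v → psum (term (λ k → Z k u v)) N * x v)
    split zero    = sym (∑-zero λ v → zeroˡ (x v))
    split (suc N) = begin
      psum (term (λ k → (Z k *ᵥ x) u)) N + inv N * (Z N *ᵥ x) u
        ≈⟨ +-cong (split N) (*-distribˡ-sum (inv N) (λ v → Z N u v * x v)) ⟩
      ∑ (λ v → psum (term (λ k → Z k u v)) N * x v) + ∑ (λ v → inv N * (Z N u v * x v))
        ≈⟨ ∑-distrib-+ (λ v → psum (term (λ k → Z k u v)) N * x v) (λ v → inv N * (Z N u v * x v)) ⟨
      ∑ (λ v → psum (term (λ k → Z k u v)) N * x v + inv N * (Z N u v * x v))
        ≈⟨ ∑-cong (λ v → solve 4 (λ s x i z → s :* x :+ i :* (z :* x) := (s :+ i :* z) :* x) refl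
             (psum (term (λ k → Z k u v)) N) (x v) (inv N) (Z N u v)) ⟩
      ∑ (λ v → psum (term (λ k → Z k u v)) (suc N) * x v) ∎

  -- The coordinate u of (cA)^k x, with the complex scalar kept apart from the real orbit.
  flow : ∀ {n} → Carrier → N.Matrix n → N.Vec n → Fin n → Sequence
  flow c A x u k = pow c k * ι (N.orbit A x k u)

  -- exp (cA) maps x to a multiple of y.
  Transfers : ∀ {n} → Carrier → N.Matrix n → N.Vec n → N.Vec n → Set
  Transfers c A x y = ∃ λ γ → ∀ u → ExpSum (flow c A x u) (γ * ι (y u))

  ExpType-ι : ∀ {a} → N.ExpType a → ExpType (ι ∘ a)
  ExpType-ι (C , B , h) = C , B , λ k → ‖ι‖ (h k)

  ExpType-flow : ∀ {n} c (A : N.Matrix n) x u → ExpType (flow c A x u)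
  ExpType-flow c A x u = ExpType-* (ExpType-pow c) (ExpType-ι (N.ExpType-orbit A x u))

  -- For c = `i* τ` this is by definition the matrix whose exponential `IsTransition` describes.
  generator : ∀ {n} → Carrier → N.Matrix n → Matrix n
  generator c A = c •ₘ λ u v → ι (A u v)

  generator-orbit : ∀ {n} c (A : N.Matrix n) x k u → orbit (generator c A) (ι ∘ x) k u ≈ flow c A x u k
  generator-orbit c A x k u = begin
    orbit Z (ι ∘ x) k u                       ≈⟨ orbit-cong Z (λ v → sym (*-identityˡ (ι (x v)))) k u ⟩
    orbit Z (1# • (ι ∘ x)) k u                ≈⟨ go 1# x k ⟩
    pow c k * 1# * ι (N.orbit A x k u)        ≈⟨ *-congʳ (*-identityʳ (pow c k)) ⟩
    flow c A x u k                            ∎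
    where
    Z = generator c A
    go : ∀ z x k → orbit Z (z • (ι ∘ x)) k u ≈ pow c k * z * ι (N.orbit A x k u)
    go z x zero    = *-congʳ (sym (*-identityˡ z))
    go z x (suc k) = begin
      orbit Z (Z *ᵥ (z • (ι ∘ x))) k u              ≈⟨ orbit-cong Z step k u ⟩
      orbit Z ((c * z) • (ι ∘ (A N.*ᵥ x))) k u      ≈⟨ go (c * z) (A N.*ᵥ x) k ⟩
      pow c k * (c * z) * ι (N.orbit A x (suc k) u)
        ≈⟨ *-congʳ (solve 3 (λ p c z → p :* (c :* z) := c :* p :* z) refl (pow c k) c z) ⟩
      pow c (suc k) * z * ι (N.orbit A x (suc k) u) ∎
      where
      step : Z *ᵥ (z • (ι ∘ x)) ≋ (c * z) • (ι ∘ (A N.*ᵥ x))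
      step v = begin
        ∑ (λ w → c * ι (A v w) * (z * ι (x w)))
          ≈⟨ ∑-cong (λ w → trans (solve 4 (λ c a z x → c :* a :* (z :* x) := c :* z :* (a :* x)) refl
                 c (ι (A v w)) z (ι (x w)))
               (*-congˡ (sym (ι-* (A v w) (x w))))) ⟩
        ∑ (λ w → c * z * ι (A v w N.* x w))
          ≈⟨ *-distribˡ-sum (c * z) (λ w → ι (A v w N.* x w)) ⟨
        c * z * ∑ (λ w → ι (A v w N.* x w))
          ≈⟨ *-congˡ (ι-∑ (λ w → A v w N.* x w)) ⟨
        c * z * ι ((A N.*ᵥ x) v) ∎

  IsExponential : ∀ {n} → Matrix n → Matrix n → Set
  IsExponential Z U = ∀ u v → ExpSum (λ k → (Z ^ₘ k) u v) (U u v)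

  -- `PST` contains a transition matrix as data; this supplies the one of the product graph.
  exponential : ∀ {n} (Z : Matrix n) → ∃ (IsExponential Z)
  exponential Z = (λ u v → proj₁ (entry u v)) , λ u v → proj₂ (entry u v)
    where
    entry : ∀ u v → ∃ (ExpSum (λ k → (Z ^ₘ k) u v))
    entry u v = ExpSum-exists (ExpType-resp
      (λ k → trans (sym (^ₘ-*ᵥ Z (basis v) k u)) (*ᵥ-basis (Z ^ₘ k) u v))
      (ExpType-orbit Z (basis v) u))

  exponential-*ᵥ : ∀ {n} c (A : N.Matrix n) {U} → IsExponential (generator c A) U →
                   ∀ x u → ExpSum (flow c A x u) ((U *ᵥ (ι ∘ x)) u)
  exponential-*ᵥ c A {U} h x u = ExpSum-resp
    (λ k → trans (^ₘ-*ᵥ (generator c A) (ι ∘ x) k u) (generator-orbit c A x k u)) refl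
    (ExpSum-*ᵥ (generator c A ^ₘ_) U (ι ∘ x) h u)

  Transfers-intro : ∀ {n c} {A : N.Matrix n} {U x y γ} → IsExponential (generator c A) U →
                    U *ᵥ (ι ∘ x) ≋ γ • (ι ∘ y) → Transfers c A x y
  Transfers-intro {c = c} {A} {x = x} {γ = γ} h t = γ , λ u →
    ExpSum-resp (λ _ → refl) (t u) (exponential-*ᵥ c A h x u)

  Transfers-elim : ∀ {n c} {A : N.Matrix n} {U x y} → IsExponential (generator c A) U →
                   Transfers c A x y → ∃ λ γ → U *ᵥ (ι ∘ x) ≋ γ • (ι ∘ y)
  Transfers-elim {c = c} {A} {x = x} h (γ , t) = γ , λ u → ⇝-unique (exponential-*ᵥ c A h x u) (t u)

  -- With c = iτ, complex conjugation turns evolution under A into evolution under − A.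
  Transfers-sign : ∀ {n c s} {A : N.Matrix n} {x y} → conj c ≈ - c → s N.≈ N.1# ⊎ s N.≈ N.- N.1# →
                   Transfers c A x y → Transfers c (s N.•ₘ A) x y
  Transfers-sign {c = c} {s} {A} {x} {y} c̄ (inj₁ s≈1) (γ , t) = γ , λ u → ExpSum-resp
    (λ k → begin
      pow c k * ι (N.orbit A x k u)
        ≈⟨ *-congʳ (pow-cong (trans (*-congˡ (trans (ι-cong s≈1) ι-1)) (*-identityʳ c)) k) ⟨
      pow (c * ι s) k * ι (N.orbit A x k u)
        ≈⟨ *-congʳ (pow-*ι c s k) ⟩
      pow c k * ι (N.pow s k) * ι (N.orbit A x k u)
        ≈⟨ trans (*-assoc (pow c k) _ _) (*-congˡ (sym (ι-* _ _))) ⟩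
      pow c k * ι (N.pow s k N.* N.orbit A x k u)
        ≈⟨ *-congˡ (ι-cong (N.orbit-•ₘ s A x k u)) ⟨
      pow c k * ι (N.orbit (s N.•ₘ A) x k u) ∎) refl (t u)
  Transfers-sign {c = c} {s} {A} {x} {y} c̄ (inj₂ s≈-1) (γ , t) = conj γ , λ u → ExpSum-resp
    (λ k → begin
      conj (pow c k * ι (N.orbit A x k u))
        ≈⟨ trans (conj-* (pow c k) _) (*-cong (conj-pow c k) (conj-ι _)) ⟩
      pow (conj c) k * ι (N.orbit A x k u)
        ≈⟨ *-congʳ (pow-cong (begin
             c * ι s              ≈⟨ *-congˡ (trans (ι-cong s≈-1) (trans (ι-neg N.1#) (-‿cong ι-1))) ⟩
             c * (- 1#)           ≈⟨ -‿distribʳ-* c 1# ⟨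
             - (c * 1#)           ≈⟨ -‿cong (*-identityʳ c) ⟩
             - c                  ≈⟨ c̄ ⟨
             conj c ∎) k) ⟨
      pow (c * ι s) k * ι (N.orbit A x k u)
        ≈⟨ *-congʳ (pow-*ι c s k) ⟩
      pow c k * ι (N.pow s k) * ι (N.orbit A x k u)
        ≈⟨ trans (*-assoc (pow c k) _ _) (*-congˡ (sym (ι-* _ _))) ⟩
      pow c k * ι (N.pow s k N.* N.orbit A x k u)
        ≈⟨ *-congˡ (ι-cong (N.orbit-•ₘ s A x k u)) ⟨
      pow c k * ι (N.orbit (s N.•ₘ A) x k u) ∎)
    (trans (conj-* γ (ι (y u))) (*-congˡ (conj-ι (y u)))) (ExpSum-conj (t u))

  flow-conv : ∀ {n c} {A : N.Matrix n} {x u} (a b : N.Sequence) → (∀ k → N.orbit A x k u N.≈ N.conv a b k) →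
              ∀ k → conv (λ j → pow c j * ι (a j)) (λ j → pow c j * ι (b j)) k ≈ flow c A x u k
  flow-conv {c = c} a b h k = trans (conv-pow c (ι ∘ a) (ι ∘ b) k)
    (*-congˡ (trans (sym (ι-conv a b k)) (ι-cong (N.sym (h k)))))

  Transfers-shift : ∀ {n c} (T B : N.Matrix n) μ {x y} →
    (∀ x → T N.*ᵥ x N.≋ μ N.• x N.+ᵥ B N.*ᵥ x) → Transfers c B x y → Transfers c T x y
  Transfers-shift {c = c} T B μ {x} {y} h (γ , t) =
    let typeμ = ExpType-* (ExpType-pow c) (ExpType-ι (N.ExpType-pow μ))
        -- e is the exponential of c μ, the phase that the scalar matrix contributes.
        (e , he) = ExpSum-exists typeμ
    in e * γ , λ u → ExpSum-resp
      (flow-conv (N.pow μ) (λ j → N.orbit B x j u) (λ k → N.orbit-shift T B μ h x k u))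
      (sym (*-assoc e γ (ι (y u))))
      (ExpSum-conv typeμ (ExpType-flow c B x u) he (t u))

  -- Each coordinate of the evolved tensor is the Cauchy product of a coordinate of either
  -- evolution, and the transfer factors multiply.
  Transfers-⊗ : ∀ {n k c} (P : N.Matrix n) (Q : N.Matrix k) (B : N.Matrix (n ℕ.* k)) {x y w z} →
    (∀ x w → B N.*ᵥ (x N.⊗ w) N.≋ (P N.*ᵥ x) N.⊗ w N.+ᵥ x N.⊗ (Q N.*ᵥ w)) →
    Transfers c P x y → Transfers c Q w z → Transfers c B (x N.⊗ w) (y N.⊗ z)
  Transfers-⊗ {n} {k} {c} P Q B {x} {y} {w} {z} h (γ , s) (δ , t) = γ * δ , λ p →
    let a = quotient k p
        b = remainder {n} k p
    in ExpSum-resp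
      (flow-conv (λ j → N.orbit P x j a) (λ j → N.orbit Q w j b) (λ j → N.orbit-⊗ P Q B h x w j p))
      (trans (solve 4 (λ g y d z → g :* y :* (d :* z) := g :* d :* (y :* z)) refl γ (ι (y a)) δ (ι (z b)))
        (*-congˡ (sym (ι-* (y a) (z b)))))
      (ExpSum-conv (ExpType-flow c P x a) (ExpType-flow c Q w b) (s a) (t b))

  Transfers-pad : ∀ {n m c} {P : N.Matrix (n ℕ.+ m)} {T : N.Matrix n} {x y} →
    (∀ k → N.orbit P (x ++ N.𝟎 {m}) k N.≋ N.orbit T x k ++ N.𝟎 {m}) →
    Transfers c T x y → Transfers c P (x ++ N.𝟎 {m}) (y ++ N.𝟎 {m})
  Transfers-pad {n} {m} {c} {P} {T} {x} {y} h (γ , t) = γ , λ u → ExpSum-resp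
      (λ k → *-congˡ (ι-cong (N.sym (h k u)))) refl (padded u (splitAt n u) ≡.refl)
    where
    padded : ∀ u s → splitAt n u ≡ s →
             ExpSum (λ k → pow c k * ι ((N.orbit T x k ++ N.𝟎 {m}) u)) (γ * ι ((y ++ N.𝟎 {m}) u))
    padded u s eq rewrite eq with s
    ... | inj₁ a = t a
    ... | inj₂ j = ExpSum-resp (λ k → sym (trans (*-congˡ ι-0) (zeroʳ (pow c k))))
                     (sym (trans (*-congˡ ι-0) (zeroʳ γ))) ExpSum-zero

  module _ {n} {W : N.Matrix n} {d} (regular : ∀ u → (W N.*ᵥ N.𝟏) u N.≈ d) where

    Transfers-kind : ∀ {c} M M′ {A A′ : N.Matrix n} {x y} → conj c ≈ - c →
      (∀ x → A N.*ᵥ x N.≋ N.op M W x) → (∀ x → A′ N.*ᵥ x N.≋ N.op M′ W x) →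
      Transfers c A x y → Transfers c A′ x y
    Transfers-kind M M′ {A} {A′} c̄ hA hA′ t =
      let (μ , s , s≈±1 , h) = N.op-change {W = W} regular M M′ in
      Transfers-shift A′ (s N.•ₘ A) μ
        (λ x u → N.trans (hA′ x u) (N.trans (h x u)
          (N.+-congˡ (N.trans (N.*-congˡ (N.sym (hA x u))) (N.sym (N.•ₘ-*ᵥ s A x u))))))
        (Transfers-sign c̄ s≈±1 t)

  Transfers-cartesian : ∀ {n k c} M (W₁ : N.Matrix n) (W₂ : N.Matrix k) {P Q B x y w z} →
    (∀ x → P N.*ᵥ x N.≋ N.op M W₁ x) → (∀ x → Q N.*ᵥ x N.≋ N.op M W₂ x) →
    (∀ x → B N.*ᵥ x N.≋ N.op M (W₁ N.⊗ₘ N.I {k} N.+ₘ N.I {n} N.⊗ₘ W₂) x) →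
    Transfers c P x y → Transfers c Q w z → Transfers c B (x N.⊗ w) (y N.⊗ z)
  Transfers-cartesian {n} {k} M W₁ W₂ {P} {Q} {B} hP hQ hB = Transfers-⊗ P Q B λ x w p →
    N.trans (hB (x N.⊗ w) p) (N.trans (N.op-cartesian W₁ W₂ M x w p)
      (N.+-cong (N.*-congʳ (N.sym (hP x (quotient k p)))) (N.*-congˡ (N.sym (hQ w (remainder {n} k p))))))

  Transfers-cluster : ∀ {c m z} {W L : N.Matrix (c ℕ.+ m)} {V : N.Matrix c} {d}
    (W-sym   : ∀ u v → W u v N.≈ W v u)
    (W-const : ∀ a b v → W (a ↑ˡ m) v N.≈ W (b ↑ˡ m) v)
    (L-ˡˡ    : ∀ a b → L (a ↑ˡ m) (b ↑ˡ m) N.≈ V a b)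
    (L-ˡʳ    : ∀ a j → L (a ↑ˡ m) (c ↑ʳ j) N.≈ N.0#)
    (L-ʳ     : ∀ j v → L (c ↑ʳ j) v N.≈ N.0#)
    (V-sym   : ∀ a b → V a b N.≈ V b a) →
    (∀ a → (V N.*ᵥ N.𝟏) a N.≈ d) →
    ∀ M {P : N.Matrix (c ℕ.+ m)} {A : N.Matrix c} {x y} →
    (∀ x → P N.*ᵥ x N.≋ N.op M (W N.+ₘ L) x) → (∀ x → A N.*ᵥ x N.≋ N.op M V x) → N.∑ x N.≈ N.0# →
    Transfers z A x y → Transfers z P (N.pad m x) (N.pad m y)
  Transfers-cluster {m = m} {V = V} W-sym W-const L-ˡˡ L-ˡʳ L-ʳ V-sym regular M {P} {A} {x} hP hA ∑x≈0 t =
    let (μ , h) = N.op-cluster {V = V} W-sym W-const L-ˡˡ L-ˡʳ L-ʳ M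
        -- On zero-sum vectors padding intertwines P with μ I + A. So the orbits of T pad to those
        -- of P, and T differs from A by a scalar matrix only.
        T : N.Matrix _
        T = μ N.•ₘ N.I N.+ₘ A
        T-*ᵥ : ∀ x → T N.*ᵥ x N.≋ μ N.• x N.+ᵥ A N.*ᵥ x
        T-*ᵥ x u = N.trans (N.*ᵥ-distribʳ-+ (μ N.•ₘ N.I) A x u)
          (N.+-congʳ (N.trans (N.•ₘ-*ᵥ μ N.I x u) (N.*-congˡ (N.I-*ᵥ x u))))
        T-op : ∀ x → T N.*ᵥ x N.≋ μ N.• x N.+ᵥ N.op M V x
        T-op x u = N.trans (T-*ᵥ x u) (N.+-congˡ (hA x u))
    in Transfers-pad {P = P} {T}
      (N.orbit-transport T P (N.pad m) (λ x → N.∑ x N.≈ N.0#)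
        (λ x ∑x≈0 → N.trans (N.∑-cong (T-op x)) (N.trans (N.∑-+ᵥ (μ N.• x) (N.op M V x))
          (N.trans (N.+-cong (N.trans (N.∑-• μ x) (N.trans (N.*-congˡ ∑x≈0) (N.zeroʳ μ)))
            (N.op-∑≈0 {W = V} regular V-sym M x ∑x≈0)) (N.+-identityˡ N.0#))))
        (λ x ∑x≈0 u → N.trans (hP (N.pad m x) u) (N.trans (h x ∑x≈0 u)
          (N.pad-cong m (λ a → N.sym (T-op x a)) u)))
        x ∑x≈0)
      (Transfers-shift T A μ T-*ᵥ t)

-- Real and complex numbers

open import Defs
open ≡ using (refl; sym; trans; cong; cong₂; subst; subst₂)
open ℚSolver using (module +-*-Solver)
open Real using (_·_; 𝟏; _⊗_)

abstract
  neg-cong : ∀ {x y} → x ≈ y → - x ≈ - y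
  neg-cong {x} {y} p ε 0<ε = let (N , h) = p ε 0<ε in
    N , λ n N≤n → subst (ℚ._< ε)
      (trans (sym (ℚₚ.∣-p∣≡∣p∣ (seq x n ℚ.- seq y n)))
        (cong ℚ.∣_∣ (solve 2 (λ a b → :- (a :- b) := (:- a) :- (:- b)) refl (seq x n) (seq y n))))
      (h n N≤n)
    where open +-*-Solver

  *-congʳ : ∀ {x y} z → x ≈ y → z * x ≈ z * y
  *-congʳ {x} {y} z p ε 0<ε =
    let (B , 0<B , M , b)  = bounded z
        (δ , 0<δ , Bδ≡ε)   = shrink 0<ε 0<B
        (N , h)            = p δ 0<δ
    in M ℕ.⊔ N , λ n k≤n → subst₂ (λ v w → ℚ.∣ v ∣ ℚ.< w)
      (solve 3 (λ z a b → z :* (a :- b) := z :* a :- z :* b) refl (seq z n) (seq x n) (seq y n)) Bδ≡ε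
      (*-estimate (seq z n) (seq x n ℚ.- seq y n) B 0<B
        (b n (ℕₚ.m⊔n≤o⇒m≤o M N k≤n)) (h n (ℕₚ.m⊔n≤o⇒n≤o M N k≤n)))
    where open +-*-Solver

  *-cong : ∀ {x y u v} → x ≈ y → u ≈ v → x * u ≈ y * v
  *-cong {x} {y} {u} {v} p q = ≈-trans {x * u} {x * v} {y * v} (*-congʳ {u} {v} x q)
    (≈-trans {x * v} {v * x} {y * v} (*-comm x v)
      (≈-trans {v * x} {v * y} {y * v} (*-congʳ {x} {y} v p) (*-comm v y)))

ℝ-commutativeRing : CommutativeRing 0ℓ 0ℓ
ℝ-commutativeRing = record
  { Carrier = ℝ ; _≈_ = _≈_ ; _+_ = _+_ ; _*_ = _*_ ; -_ = -_ ; 0# = 0ℝ ; 1# = 1ℝ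
  ; isCommutativeRing = record
    { isRing = record
      { +-isAbelianGroup = record
        { isGroup = record
          { isMonoid = record
            { isSemigroup = record
              { isMagma = record
                { isEquivalence = record
                  { refl  = λ {x} → ≈-refl {x}
                  ; sym   = λ {x} {y} → ≈-sym {x} {y}
                  ; trans = λ {x} {y} {z} → ≈-trans {x} {y} {z}
                  }
                ; ∙-cong = λ {x} {y} {u} {v} → +-cong {x} {y} {u} {v}
                }
              ; assoc = λ x y z → ≡⇒≈ {x + y + z} {x + (y + z)} λ n → ℚₚ.+-assoc (seq x n) (seq y n) (seq z n)
              }
            ; identity = (λ x → ≡⇒≈ {0ℝ + x} {x} λ n → ℚₚ.+-identityˡ (seq x n))
                       , (λ x → ≡⇒≈ {x + 0ℝ} {x} λ n → ℚₚ.+-identityʳ (seq x n))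
            }
          ; inverse = (λ x → ≡⇒≈ {(- x) + x} {0ℝ} λ n → ℚₚ.+-inverseˡ (seq x n))
                    , (λ x → ≡⇒≈ {x - x} {0ℝ} λ n → ℚₚ.+-inverseʳ (seq x n))
          ; ⁻¹-cong = λ {x} {y} → neg-cong {x} {y}
          }
        ; comm = λ x y → ≡⇒≈ {x + y} {y + x} λ n → ℚₚ.+-comm (seq x n) (seq y n)
        }
      ; *-cong = λ {x} {y} {u} {v} → *-cong {x} {y} {u} {v}
      ; *-assoc = λ x y z → ≡⇒≈ {x * y * z} {x * (y * z)} λ n → ℚₚ.*-assoc (seq x n) (seq y n) (seq z n)
      ; *-identity = (λ x → ≡⇒≈ {1ℝ * x} {x} λ n → ℚₚ.*-identityˡ (seq x n))
                   , (λ x → ≡⇒≈ {x * 1ℝ} {x} λ n → ℚₚ.*-identityʳ (seq x n))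
      ; distrib = (λ x y z → ≡⇒≈ {x * (y + z)} {x * y + x * z} λ n → ℚₚ.*-distribˡ-+ (seq x n) (seq y n) (seq z n))
                , (λ x y z → ≡⇒≈ {(y + z) * x} {y * x + z * x} λ n → ℚₚ.*-distribʳ-+ (seq x n) (seq y n) (seq z n))
      }
    ; *-comm = *-comm
    }
  }

private module ℝᴿ = CommutativeRing ℝ-commutativeRing

-- ∣ x ∣ ≤ q: the sequence of x can be chosen within [-q , q].
record Boundedℝ (x : ℝ) (q : ℚ) : Set where
  constructor boundedBy
  field
    rep     : ℝ
    ≈rep    : x ≈ rep
    ∣rep∣≤ : ∀ n → ℚ.∣ seq rep n ∣ ℚ.≤ q

open Boundedℝ

abstract
  -- Dropping an initial segment turns an eventual bound into one at every index, as `Boundedℝ`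
  -- asks.
  shift : ℕ → ℝ → ℝ
  shift N x = mkℝ (λ n → seq x (N ℕ.+ n)) λ ε 0<ε → let (M , h) = cauchy x ε 0<ε in
    M , λ m n M≤m M≤n → h (N ℕ.+ m) (N ℕ.+ n) (ℕₚ.m≤n⇒m≤o+n N M≤m) (ℕₚ.m≤n⇒m≤o+n N M≤n)

  ≈shift : ∀ N x → x ≈ shift N x
  ≈shift N x ε 0<ε = let (M , h) = cauchy x ε 0<ε in
    M , λ n M≤n → h n (N ℕ.+ n) M≤n (ℕₚ.m≤n⇒m≤o+n N M≤n)

  eventually⇒bounded : ∀ x q N → (∀ n → N ℕ.≤ n → ℚ.∣ seq x n ∣ ℚ.≤ q) → Boundedℝ x q
  eventually⇒bounded x q N h = boundedBy (shift N x) (≈shift N x) λ n → h (N ℕ.+ n) (ℕₚ.m≤m+n N n)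

  bounded⇒eventually : ∀ {x q} → Boundedℝ x q → ∀ δ → 0ℚ ℚ.< δ →
                       ∃ λ N → ∀ n → N ℕ.≤ n → ℚ.∣ seq x n ∣ ℚ.< q ℚ.+ δ
  bounded⇒eventually {x} {q} (boundedBy y x≈y y≤q) δ 0<δ = let (N , h) = x≈y δ 0<δ in
    N , λ n N≤n → ℚₚ.≤-<-trans
      (subst (λ z → ℚ.∣ z ∣ ℚ.≤ ℚ.∣ seq y n ∣ ℚ.+ ℚ.∣ seq x n ℚ.- seq y n ∣)
        (solve 2 (λ a b → b :+ (a :- b) := a) refl (seq x n) (seq y n))
        (ℚₚ.∣p+q∣≤∣p∣+∣q∣ (seq y n) (seq x n ℚ.- seq y n)))
      (ℚₚ.+-mono-≤-< (y≤q n) (h n N≤n))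
    where open +-*-Solver

  bounded-zero : ∀ {x} → (∀ q → 0ℚ ℚ.< q → Boundedℝ x q) → x ≈ 0ℝ
  bounded-zero {x} h ε 0<ε =
    let (N , k) = bounded⇒eventually (h (½ ℚ.* ε) (½-pos 0<ε)) (½ ℚ.* ε) (½-pos 0<ε) in
    N , λ n N≤n → subst₂ (λ a b → ℚ.∣ a ∣ ℚ.< b) (sym (ℚₚ.+-identityʳ (seq x n))) (½+½ ε) (k n N≤n)

Σℚ : (ℕ → ℚ) → ℕ → ℚ
Σℚ = PartialSum.psum (CommutativeRing.rawRing ℚₚ.+-*-commutativeRing)

Σℝ : (ℕ → ℝ) → ℕ → ℝ
Σℝ = PartialSum.psum ℝ-rawRing

abstract
  -- The exact remainder of the geometric series is what an induction on M can carry.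
  geometric-tail′ : ∀ f A → (∀ k → ℚ.∣ f k ∣ ℚ.≤ A ℚ.* ½^ k) → ∀ {N M} → N ℕ.≤′ M →
    ℚ.∣ Σℚ f M ℚ.- Σℚ f N ∣ ℚ.≤ 2ℚ ℚ.* A ℚ.* ½^ N ℚ.- 2ℚ ℚ.* A ℚ.* ½^ M
  geometric-tail′ f A h {N} ℕ.≤′-refl = ℚₚ.≤-reflexive
    (trans (x-x≡0 (Σℚ f N)) (sym (ℚₚ.+-inverseʳ (2ℚ ℚ.* A ℚ.* ½^ N))))
  geometric-tail′ f A h {N} {suc M} (ℕ.≤′-step p) = subst₂ (λ a b → ℚ.∣ a ∣ ℚ.≤ b)
    (solve 3 (λ s t u → (s :- t) :+ u := (s :+ u) :- t) refl (Σℚ f M) (Σℚ f N) (f M))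
    (solve 3 (λ a x y → (con 2ℚ :* a :* x :- con 2ℚ :* a :* y) :+ a :* y
                     := con 2ℚ :* a :* x :- con 2ℚ :* a :* (con ½ :* y)) refl A (½^ N) (½^ M))
    (ℚₚ.≤-trans (ℚₚ.∣p+q∣≤∣p∣+∣q∣ (Σℚ f M ℚ.- Σℚ f N) (f M))
      (ℚₚ.+-mono-≤ (geometric-tail′ f A h p) (h M)))
    where open +-*-Solver

  geometric-tail : ∀ f A → (∀ k → ℚ.∣ f k ∣ ℚ.≤ A ℚ.* ½^ k) → ∀ {N M} → N ℕ.≤ M →
    ℚ.∣ Σℚ f M ℚ.- Σℚ f N ∣ ℚ.≤ 2ℚ ℚ.* A ℚ.* ½^ N
  geometric-tail f A h {N} {M} N≤M = ℚₚ.≤-trans (geometric-tail′ f A h (ℕₚ.≤⇒≤′ N≤M))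
    (subst (2ℚ ℚ.* A ℚ.* ½^ N ℚ.- 2ℚ ℚ.* A ℚ.* ½^ M ℚ.≤_) (ℚₚ.+-identityʳ _)
      (ℚₚ.+-monoʳ-≤ (2ℚ ℚ.* A ℚ.* ½^ N)
        (ℚₚ.neg-antimono-≤ {0ℚ} (0≤* (0≤* (ℚₚ.nonNegative⁻¹ 2ℚ) 0≤A) (0≤½^ M)))))
    where
    0≤A : 0ℚ ℚ.≤ A
    0≤A = subst (0ℚ ℚ.≤_) (ℚₚ.*-identityʳ A) (ℚₚ.≤-trans (ℚₚ.0≤∣p∣ (f 0)) (h 0))

  seq-Σℝ : ∀ (y : ℕ → ℝ) N n → seq (Σℝ y N) n ≡ Σℚ (λ k → seq (y k) n) N
  seq-Σℝ y zero    n = refl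
  seq-Σℝ y (suc N) n = cong (ℚ._+ seq (y N) n) (seq-Σℝ y N n)

  Σℝ-cong : ∀ {s t : ℕ → ℝ} → (∀ k → s k ≈ t k) → ∀ N → Σℝ s N ≈ Σℝ t N
  Σℝ-cong h zero    = ≈-refl {0ℝ}
  Σℝ-cong {s} {t} h (suc N) = +-cong {Σℝ s N} {Σℝ t N} {s N} {t N} (Σℝ-cong {s} {t} h N) (h N)

  -- The limit is the diagonal: the n-th rational approximation to the n-th partial sum. It works
  -- because the chosen representatives obey their bounds at every index, so the tails are small
  -- uniformly in that index.
  completeℝ : ∀ (t : ℕ → ℝ) A → (∀ k → Boundedℝ (t k) (A ℚ.* ½^ k)) →
    ∃ λ l → ∀ n → Boundedℝ (Σℝ t n - l) (2ℚ ℚ.* A ℚ.* ½^ n)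
  completeℝ t A h = l , λ N → transport N (eventually⇒bounded (Σℝ y N - l) _ N (close N))
    where
    open +-*-Solver
    y : ℕ → ℝ
    y k = rep (h k)
    f : ℕ → ℕ → ℚ
    f n k = seq (y k) n
    diag : ℕ → ℚ
    diag n = Σℚ (f n) n
    tail : ∀ n {N M} → N ℕ.≤ M → ℚ.∣ Σℚ (f n) M ℚ.- Σℚ (f n) N ∣ ℚ.≤ 2ℚ ℚ.* A ℚ.* ½^ N
    tail n = geometric-tail (f n) A (λ k → ∣rep∣≤ (h k) n)
    0≤2A : 0ℚ ℚ.≤ 2ℚ ℚ.* A
    0≤2A = subst (0ℚ ℚ.≤_) (ℚₚ.*-identityʳ (2ℚ ℚ.* A))
      (ℚₚ.≤-trans (ℚₚ.0≤∣p∣ (Σℚ (f 0) 0 ℚ.- Σℚ (f 0) 0)) (tail 0 {0} {0} z≤n))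
    diag-cauchy : IsCauchy diag
    -- Both diagonal terms are compared with the partial sum of fixed length N₀. The tails cost ε/4
    -- each, and ε/2 is left for the Cauchy sequence `Σℝ y N₀`.
    diag-cauchy ε 0<ε =
      let ε/2 = ½ ℚ.* ε
          ε/4 = ½ ℚ.* ε/2
          (N₀ , small) = ½^-vanishes (2ℚ ℚ.* A) 0≤2A (½-pos (½-pos 0<ε))
          (N₁ , near)  = cauchy (Σℝ y N₀) ε/2 (½-pos 0<ε)
      in N₀ ℕ.⊔ N₁ , λ m n N≤m N≤n →
        let a  = diag m ; b = Σℚ (f m) N₀ ; c = Σℚ (f n) N₀ ; d = diag n
            ab : ℚ.∣ a ℚ.- b ∣ ℚ.≤ ε/4
            ab = ℚₚ.≤-trans (tail m (ℕₚ.m⊔n≤o⇒m≤o N₀ N₁ N≤m)) (small N₀ ℕₚ.≤-refl)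
            dc : ℚ.∣ d ℚ.- c ∣ ℚ.≤ ε/4
            dc = ℚₚ.≤-trans (tail n (ℕₚ.m⊔n≤o⇒m≤o N₀ N₁ N≤n)) (small N₀ ℕₚ.≤-refl)
            cd : ℚ.∣ c ℚ.- d ∣ ℚ.≤ ε/4
            cd = subst (ℚ._≤ ε/4) (∣-∣-swap d c) dc
            bc : ℚ.∣ b ℚ.- c ∣ ℚ.< ε/2
            bc = subst₂ (λ v w → ℚ.∣ v ℚ.- w ∣ ℚ.< ε/2) (seq-Σℝ y N₀ m) (seq-Σℝ y N₀ n)
              (near m n (ℕₚ.m⊔n≤o⇒n≤o N₀ N₁ N≤m) (ℕₚ.m⊔n≤o⇒n≤o N₀ N₁ N≤n))
        in ℚₚ.≤-<-trans (triangle a b d)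
          (ℚₚ.≤-<-trans (ℚₚ.+-monoʳ-≤ ℚ.∣ a ℚ.- b ∣ (triangle b c d))
            (subst (ℚ.∣ a ℚ.- b ∣ ℚ.+ (ℚ.∣ b ℚ.- c ∣ ℚ.+ ℚ.∣ c ℚ.- d ∣) ℚ.<_)
              (solve 1 (λ e → con ½ :* (con ½ :* e) :+ (con ½ :* e :+ con ½ :* (con ½ :* e)) := e) refl ε)
              (ℚₚ.+-mono-≤-< ab (ℚₚ.+-mono-<-≤ bc cd))))
    l : ℝ
    l = mkℝ diag diag-cauchy
    close : ∀ N n → N ℕ.≤ n → ℚ.∣ seq (Σℝ y N) n ℚ.- diag n ∣ ℚ.≤ 2ℚ ℚ.* A ℚ.* ½^ N
    close N n N≤n = subst (ℚ._≤ 2ℚ ℚ.* A ℚ.* ½^ N)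
      (trans (∣-∣-swap (diag n) (Σℚ (f n) N)) (cong (λ z → ℚ.∣ z ℚ.- diag n ∣) (sym (seq-Σℝ y N n))))
      (tail n N≤n)
    transport : ∀ N → Boundedℝ (Σℝ y N - l) (2ℚ ℚ.* A ℚ.* ½^ N) → Boundedℝ (Σℝ t N - l) (2ℚ ℚ.* A ℚ.* ½^ N)
    transport N (boundedBy z p b) = boundedBy z
      (≈-trans {Σℝ t N - l} {Σℝ y N - l} {z}
        (+-cong {Σℝ t N} {Σℝ y N} { - l} { - l} (Σℝ-cong {t} {y} (λ k → ≈rep (h k)) N) (≈-refl { - l})) p) b

  bounded-+ : ∀ {x y p q} → Boundedℝ x p → Boundedℝ y q → Boundedℝ (x + y) (p ℚ.+ q)
  bounded-+ {x} {y} (boundedBy x′ a b) (boundedBy y′ c d) = boundedBy (x′ + y′) (+-cong {x} {x′} {y} {y′} a c)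
    λ n → ℚₚ.≤-trans (ℚₚ.∣p+q∣≤∣p∣+∣q∣ (seq x′ n) (seq y′ n)) (ℚₚ.+-mono-≤ (b n) (d n))

  bounded-nonNeg : ∀ {x q} → Boundedℝ x q → 0ℚ ℚ.≤ q
  bounded-nonNeg (boundedBy x′ _ b) = ℚₚ.≤-trans (ℚₚ.0≤∣p∣ (seq x′ 0)) (b 0)

  bounded-* : ∀ {x y p q} → Boundedℝ x p → Boundedℝ y q → Boundedℝ (x * y) (p ℚ.* q)
  bounded-* {x} {y} {p} {q} bx@(boundedBy x′ a b) by@(boundedBy y′ c d) =
    boundedBy (x′ * y′) (*-cong {x} {x′} {y} {y′} a c)
    λ n → subst (ℚ._≤ p ℚ.* q) (sym (ℚₚ.∣p*q∣≡∣p∣*∣q∣ (seq x′ n) (seq y′ n)))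
      (*-mono-≤ (ℚₚ.0≤∣p∣ (seq x′ n)) (bounded-nonNeg by) (b n) (d n))

  bounded-neg : ∀ {x q} → Boundedℝ x q → Boundedℝ (- x) q
  bounded-neg {x} {q} (boundedBy x′ a b) = boundedBy (- x′) (neg-cong {x} {x′} a)
    λ n → subst (ℚ._≤ q) (sym (ℚₚ.∣-p∣≡∣p∣ (seq x′ n))) (b n)

  bounded-resp : ∀ {x y q} → x ≈ y → Boundedℝ x q → Boundedℝ y q
  bounded-resp {x} {y} p (boundedBy x′ a b) = boundedBy x′ (≈-trans {y} {x} {x′} (≈-sym {x} {y} p) a) b

  bounded-mono : ∀ {x p q} → p ℚ.≤ q → Boundedℝ x p → Boundedℝ x q
  bounded-mono p≤q (boundedBy x′ a b) = boundedBy x′ a λ n → ℚₚ.≤-trans (b n) p≤q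

  bounded-fromℚ : ∀ {q} → 0ℚ ℚ.≤ q → Boundedℝ (fromℚ q) q
  bounded-fromℚ {q} 0≤q = boundedBy (fromℚ q) (≈-refl {fromℚ q}) λ _ → ℚₚ.≤-reflexive (ℚₚ.0≤p⇒∣p∣≡p 0≤q)

  bounded-finite : ∀ x → ∃ λ q → Boundedℝ x q
  bounded-finite x = let (B , _ , N , h) = bounded x in B , eventually⇒bounded x B N h

  p≤2p : ∀ {p} → 0ℚ ℚ.≤ p → p ℚ.≤ 2ℚ ℚ.* p
  p≤2p {p} 0≤p = subst₂ ℚ._≤_ (ℚₚ.+-identityʳ p)
    (solve 1 (λ p → p :+ p := con 2ℚ :* p) refl p) (ℚₚ.+-monoʳ-≤ p 0≤p)
    where open +-*-Solver

private
  module ℝMult = SemiringMult ℝᴿ.semiring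

abstract
  seq-× : ∀ n k → seq (n ℝMult.× 1ℝ) k ≡ fromℕ n
  seq-× zero    k = refl
  seq-× (suc n) k = cong (1ℚ ℚ.+_) (seq-× n k)

ℝ-normedRing : NormedRing
ℝ-normedRing = record
  { commutativeRing = ℝ-commutativeRing
  ; ‖_‖≤_     = Boundedℝ
  ; ‖‖-resp   = λ {x} {y} → bounded-resp {x} {y}
  ; ‖‖-mono   = bounded-mono
  ; ‖‖-nonNeg = bounded-nonNeg
  ; ‖0‖       = bounded-fromℚ ℚₚ.≤-refl
  ; ‖‖-+      = bounded-+
  ; ‖‖-neg    = bounded-neg
  ; ‖‖-*      = λ bx by → bounded-mono (p≤2p (0≤* (bounded-nonNeg bx) (bounded-nonNeg by))) (bounded-* bx by)
  ; ‖‖-finite = bounded-finite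
  ; ‖‖-zero   = λ {x} → bounded-zero {x}
  ; complete  = completeℝ
  ; inv       = λ n → fromℚ (inv! n)
  ; inv-0     = ≈-refl {1ℝ}
  ; inv-suc   = λ n → ≡⇒≈ {(suc n ℝMult.× 1ℝ) * fromℚ (inv! (suc n))} {fromℚ (inv! n)}
                  λ k → trans (cong (ℚ._* inv! (suc n)) (seq-× (suc n) k)) (inv!-suc n)
  ; ‖inv‖     = λ n → bounded-fromℚ (0≤inv! n)
  }

-- Ring laws and completeness of the complex numbers

module ℂLaws where
  open RawRing ℂ-rawRing public using () renaming (_+_ to _⊕_; _*_ to _⊛_; -_ to ⊖_; 0# to 0ℂ; 1# to 1ℂ)
  open +-*-Solver

  abstract
    ⊕-cong : ∀ {x y u v} → x ≈ᶜ y → u ≈ᶜ v → x ⊕ u ≈ᶜ y ⊕ v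
    ⊕-cong {a +i b} {a′ +i b′} {c +i d} {c′ +i d′} (p , q) (r , s) =
      +-cong {a} {a′} {c} {c′} p r , +-cong {b} {b′} {d} {d′} q s

    ⊛-cong : ∀ {x y u v} → x ≈ᶜ y → u ≈ᶜ v → x ⊛ u ≈ᶜ y ⊛ v
    ⊛-cong {a +i b} {a′ +i b′} {c +i d} {c′ +i d′} (p , q) (r , s) =
      +-cong {a * c} {a′ * c′} { - (b * d)} { - (b′ * d′)} (*-cong {a} {a′} {c} {c′} p r)
        (neg-cong {b * d} {b′ * d′} (*-cong {b} {b′} {d} {d′} q s)) ,
      +-cong {a * d} {a′ * d′} {b * c} {b′ * c′} (*-cong {a} {a′} {d} {d′} p s) (*-cong {b} {b′} {c} {c′} q r)

    ≡⇒≈ᶜ : ∀ {x y} → (∀ n → seq (re x) n ≡ seq (re y) n) → (∀ n → seq (im x) n ≡ seq (im y) n) → x ≈ᶜ y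
    ≡⇒≈ᶜ {a +i b} {c +i d} p q = ≡⇒≈ {a} {c} p , ≡⇒≈ {b} {d} q

    ⊛-assoc : ∀ x y z → (x ⊛ y) ⊛ z ≈ᶜ x ⊛ (y ⊛ z)
    ⊛-assoc x@(a +i b) y@(c +i d) z@(e +i f) = ≡⇒≈ᶜ {(x ⊛ y) ⊛ z} {x ⊛ (y ⊛ z)}
      (λ n → solve 6 (λ a b c d e f → (a :* c :- b :* d) :* e :- (a :* d :+ b :* c) :* f
                       := a :* (c :* e :- d :* f) :- b :* (c :* f :+ d :* e))
               refl (seq a n) (seq b n) (seq c n) (seq d n) (seq e n) (seq f n))
      (λ n → solve 6 (λ a b c d e f → (a :* c :- b :* d) :* f :+ (a :* d :+ b :* c) :* e
                       := a :* (c :* f :+ d :* e) :+ b :* (c :* e :- d :* f))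
               refl (seq a n) (seq b n) (seq c n) (seq d n) (seq e n) (seq f n))

    ⊛-comm : ∀ x y → x ⊛ y ≈ᶜ y ⊛ x
    ⊛-comm x@(a +i b) y@(c +i d) = ≡⇒≈ᶜ {x ⊛ y} {y ⊛ x}
      (λ n → solve 4 (λ a b c d → a :* c :- b :* d := c :* a :- d :* b)
               refl (seq a n) (seq b n) (seq c n) (seq d n))
      (λ n → solve 4 (λ a b c d → a :* d :+ b :* c := c :* b :+ d :* a)
               refl (seq a n) (seq b n) (seq c n) (seq d n))

    ⊛-identityˡ : ∀ x → 1ℂ ⊛ x ≈ᶜ x
    ⊛-identityˡ x@(a +i b) = ≡⇒≈ᶜ {1ℂ ⊛ x} {x}
      (λ n → solve 2 (λ a b → con 1ℚ :* a :- con 0ℚ :* b := a) refl (seq a n) (seq b n))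
      (λ n → solve 2 (λ a b → con 1ℚ :* b :+ con 0ℚ :* a := b) refl (seq a n) (seq b n))

    ⊛-identityʳ : ∀ x → x ⊛ 1ℂ ≈ᶜ x
    ⊛-identityʳ x@(a +i b) = ≡⇒≈ᶜ {x ⊛ 1ℂ} {x}
      (λ n → solve 2 (λ a b → a :* con 1ℚ :- b :* con 0ℚ := a) refl (seq a n) (seq b n))
      (λ n → solve 2 (λ a b → a :* con 0ℚ :+ b :* con 1ℚ := b) refl (seq a n) (seq b n))

    distribˡ : ∀ x y z → x ⊛ (y ⊕ z) ≈ᶜ (x ⊛ y) ⊕ (x ⊛ z)
    distribˡ x@(a +i b) y@(c +i d) z@(e +i f) = ≡⇒≈ᶜ {x ⊛ (y ⊕ z)} {(x ⊛ y) ⊕ (x ⊛ z)}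
      (λ n → solve 6 (λ a b c d e f → a :* (c :+ e) :- b :* (d :+ f)
                       := (a :* c :- b :* d) :+ (a :* e :- b :* f))
               refl (seq a n) (seq b n) (seq c n) (seq d n) (seq e n) (seq f n))
      (λ n → solve 6 (λ a b c d e f → a :* (d :+ f) :+ b :* (c :+ e)
                       := (a :* d :+ b :* c) :+ (a :* f :+ b :* e))
               refl (seq a n) (seq b n) (seq c n) (seq d n) (seq e n) (seq f n))

    distribʳ : ∀ x y z → (y ⊕ z) ⊛ x ≈ᶜ (y ⊛ x) ⊕ (z ⊛ x)
    distribʳ x@(a +i b) y@(c +i d) z@(e +i f) = ≡⇒≈ᶜ {(y ⊕ z) ⊛ x} {(y ⊛ x) ⊕ (z ⊛ x)}
      (λ n → solve 6 (λ a b c d e f → (c :+ e) :* a :- (d :+ f) :* b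
                       := (c :* a :- d :* b) :+ (e :* a :- f :* b))
               refl (seq a n) (seq b n) (seq c n) (seq d n) (seq e n) (seq f n))
      (λ n → solve 6 (λ a b c d e f → (c :+ e) :* b :+ (d :+ f) :* a
                       := (c :* b :+ d :* a) :+ (e :* b :+ f :* a))
               refl (seq a n) (seq b n) (seq c n) (seq d n) (seq e n) (seq f n))

ℂ-commutativeRing : CommutativeRing 0ℓ 0ℓ
ℂ-commutativeRing = record
  { RawRing ℂ-rawRing
  ; isCommutativeRing = record
    { isRing = record
      { +-isAbelianGroup = record
        { isGroup = record
          { isMonoid = record
            { isSemigroup = record
              { isMagma = record
                { isEquivalence = record
                  { refl  = λ {x} → ≈-refl {re x} , ≈-refl {im x}
                  ; sym   = λ {x} {y} (p , q) → ≈-sym {re x} {re y} p , ≈-sym {im x} {im y} q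
                  ; trans = λ {x} {y} {z} (p , q) (r , s) →
                      ≈-trans {re x} {re y} {re z} p r , ≈-trans {im x} {im y} {im z} q s
                  }
                ; ∙-cong = λ {x} {y} {u} {v} → ⊕-cong {x} {y} {u} {v}
                }
              ; assoc = λ x y z → ℝᴿ.+-assoc (re x) (re y) (re z) , ℝᴿ.+-assoc (im x) (im y) (im z)
              }
            ; identity = (λ x → ℝᴿ.+-identityˡ (re x) , ℝᴿ.+-identityˡ (im x))
                       , (λ x → ℝᴿ.+-identityʳ (re x) , ℝᴿ.+-identityʳ (im x))
            }
          ; inverse = (λ x → ℝᴿ.-‿inverseˡ (re x) , ℝᴿ.-‿inverseˡ (im x))
                    , (λ x → ℝᴿ.-‿inverseʳ (re x) , ℝᴿ.-‿inverseʳ (im x))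
          ; ⁻¹-cong = λ {x} {y} (p , q) → neg-cong {re x} {re y} p , neg-cong {im x} {im y} q
          }
        ; comm = λ x y → ℝᴿ.+-comm (re x) (re y) , ℝᴿ.+-comm (im x) (im y)
        }
      ; *-cong = λ {x} {y} {u} {v} → ⊛-cong {x} {y} {u} {v}
      ; *-assoc = ⊛-assoc
      ; *-identity = ⊛-identityˡ , ⊛-identityʳ
      ; distrib = distribˡ , distribʳ
      }
    ; *-comm = ⊛-comm
    }
  }
  where open ℂLaws

private
  module ℂᴿ = CommutativeRing ℂ-commutativeRing
  module ℂMult = SemiringMult ℂᴿ.semiring

Boundedℂ : ℂ → ℚ → Set
Boundedℂ z q = Boundedℝ (re z) q × Boundedℝ (im z) q

Σℂ : (ℕ → ℂ) → ℕ → ℂ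
Σℂ = PartialSum.psum ℂ-rawRing

abstract
  re-Σℂ : ∀ t n → re (Σℂ t n) ≡ Σℝ (λ k → re (t k)) n
  re-Σℂ t zero    = refl
  re-Σℂ t (suc n) = cong (_+ re (t n)) (re-Σℂ t n)

  im-Σℂ : ∀ t n → im (Σℂ t n) ≡ Σℝ (λ k → im (t k)) n
  im-Σℂ t zero    = refl
  im-Σℂ t (suc n) = cong (_+ im (t n)) (im-Σℂ t n)

  completeℂ : ∀ (t : ℕ → ℂ) A → (∀ k → Boundedℂ (t k) (A ℚ.* ½^ k)) →
    ∃ λ l → ∀ n → Boundedℂ (Σℂ t n ℂᴿ.- l) (2ℚ ℚ.* A ℚ.* ½^ n)
  completeℂ t A h =
    let (a , p) = completeℝ (λ k → re (t k)) A (λ k → proj₁ (h k))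
        (b , q) = completeℝ (λ k → im (t k)) A (λ k → proj₂ (h k))
    in (a +i b) , λ n →
      subst (λ z → Boundedℝ (z - a) (2ℚ ℚ.* A ℚ.* ½^ n)) (sym (re-Σℂ t n)) (p n) ,
      subst (λ z → Boundedℝ (z - b) (2ℚ ℚ.* A ℚ.* ½^ n)) (sym (im-Σℂ t n)) (q n)

  boundedℂ-* : ∀ {z w p q} → Boundedℂ z p → Boundedℂ w q → Boundedℂ (z ℂᴿ.* w) (2ℚ ℚ.* (p ℚ.* q))
  boundedℂ-* {z} {w} {p} {q} (a , b) (c , d) =
    bounded-mono two (bounded-+ (bounded-* a c) (bounded-neg (bounded-* b d))) ,
    bounded-mono two (bounded-+ (bounded-* a d) (bounded-* b c))
    where
    open +-*-Solver
    two : p ℚ.* q ℚ.+ p ℚ.* q ℚ.≤ 2ℚ ℚ.* (p ℚ.* q)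
    two = ℚₚ.≤-reflexive (solve 1 (λ r → r :+ r := con 2ℚ :* r) refl (p ℚ.* q))

  bounded-fromℝ : ∀ {x q} → Boundedℝ x q → Boundedℂ (fromℝ x) q
  bounded-fromℝ b = b , bounded-mono (bounded-nonNeg b) (bounded-fromℚ ℚₚ.≤-refl)

  boundedℂ-finite : ∀ z → ∃ λ q → Boundedℂ z q
  boundedℂ-finite z =
    let (p , a) = bounded-finite (re z)
        (q , b) = bounded-finite (im z)
    in p ℚ.⊔ q , bounded-mono (ℚₚ.p≤p⊔q p q) a , bounded-mono (ℚₚ.p≤q⊔p p q) b

  seq-re-× : ∀ n k → seq (re (n ℂMult.× ℂᴿ.1#)) k ≡ fromℕ n
  seq-re-× zero    k = refl
  seq-re-× (suc n) k = cong (1ℚ ℚ.+_) (seq-re-× n k)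

  seq-im-× : ∀ n k → seq (im (n ℂMult.× ℂᴿ.1#)) k ≡ 0ℚ
  seq-im-× zero    k = refl
  seq-im-× (suc n) k = cong (0ℚ ℚ.+_) (seq-im-× n k)

  fromℝ-inv!-suc : ∀ n → (suc n ℂMult.× ℂᴿ.1#) ℂᴿ.* fromℝ (fromℚ (inv! (suc n))) ≈ᶜ fromℝ (fromℚ (inv! n))
  fromℝ-inv!-suc n = ℂLaws.≡⇒≈ᶜ {(suc n ℂMult.× ℂᴿ.1#) ℂᴿ.* fromℝ (fromℚ (inv! (suc n)))} {fromℝ (fromℚ (inv! n))}
    (λ k → trans (cong₂ (λ a b → a ℚ.* inv! (suc n) ℚ.- b ℚ.* 0ℚ) (seq-re-× (suc n) k) (seq-im-× (suc n) k))
      (trans (ℚₚ.+-identityʳ _) (inv!-suc n)))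
    (λ k → trans (cong₂ (λ a b → a ℚ.* 0ℚ ℚ.+ b ℚ.* inv! (suc n)) (seq-re-× (suc n) k) (seq-im-× (suc n) k))
      (solve 2 (λ a b → a :* con 0ℚ :+ con 0ℚ :* b := con 0ℚ) refl (fromℕ (suc n)) (inv! (suc n))))
    where open +-*-Solver

ℂ-normedRing : NormedRing
ℂ-normedRing = record
  { commutativeRing = ℂ-commutativeRing
  ; ‖_‖≤_     = Boundedℂ
  ; ‖‖-resp   = λ {x} {y} (p , q) (a , b) → bounded-resp {re x} {re y} p a , bounded-resp {im x} {im y} q b
  ; ‖‖-mono   = λ p≤q (a , b) → bounded-mono p≤q a , bounded-mono p≤q b
  ; ‖‖-nonNeg = λ (a , _) → bounded-nonNeg a
  ; ‖0‖       = bounded-fromℝ (bounded-fromℚ ℚₚ.≤-refl)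
  ; ‖‖-+      = λ (a , b) (c , d) → bounded-+ a c , bounded-+ b d
  ; ‖‖-neg    = λ (a , b) → bounded-neg a , bounded-neg b
  ; ‖‖-*      = boundedℂ-*
  ; ‖‖-finite = boundedℂ-finite
  ; ‖‖-zero   = λ {x} h → bounded-zero {re x} (λ q 0<q → proj₁ (h q 0<q)) ,
                        bounded-zero {im x} (λ q 0<q → proj₂ (h q 0<q))
  ; complete  = completeℂ
  ; inv       = λ n → fromℝ (fromℚ (inv! n))
  ; inv-0     = ≈-refl {1ℝ} , ≈-refl {0ℝ}
  ; inv-suc   = fromℝ-inv!-suc
  ; ‖inv‖     = λ n → bounded-fromℝ (bounded-fromℚ (0≤inv! n))
  }

private
  module ℝᴸ = Linear ℝ-normedRing
  module ℂᴸ = Linear ℂ-normedRing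

conjugate : ℂ → ℂ
conjugate z = re z +i (- im z)

complexification : Complexification ℝ-normedRing ℂ-normedRing
complexification = record
  { ι         = fromℝ
  ; ι-cong    = λ p → p , ≈-refl {0ℝ}
  ; ι-+       = λ x y → ≈-refl {x + y} , ≡⇒≈ {0ℝ} {0ℝ + 0ℝ} (λ _ → refl)
  ; ι-*       = λ x y →
      ≡⇒≈ {x * y} {x * y - 0ℝ * 0ℝ} (λ n → sym (ℚₚ.+-identityʳ (seq x n ℚ.* seq y n))) ,
      ≡⇒≈ {0ℝ} {x * 0ℝ + 0ℝ * y} (λ n →
        solve 2 (λ a b → con 0ℚ := a :* con 0ℚ :+ con 0ℚ :* b) refl (seq x n) (seq y n))
  ; ι-neg     = λ x → ≈-refl { - x} , ≡⇒≈ {0ℝ} { - 0ℝ} (λ _ → refl)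
  ; ι-0       = ≈-refl {0ℝ} , ≈-refl {0ℝ}
  ; ι-1       = ≈-refl {1ℝ} , ≈-refl {0ℝ}
  ; conj      = conjugate
  ; conj-cong = λ {z} {w} (p , q) → p , neg-cong {im z} {im w} q
  ; conj-+    = λ z w → ≈-refl {re z + re w} , ≡⇒≈ { - (im z + im w)} { - im z + - im w}
      (λ n → ℚₚ.neg-distrib-+ (seq (im z) n) (seq (im w) n))
  ; conj-*    = λ z w →
      ≡⇒≈ {re z * re w - im z * im w} {re z * re w - (- im z) * (- im w)} (λ n →
        solve 4 (λ a b c d → a :* c :- b :* d := a :* c :- (:- b) :* (:- d)) refl
          (seq (re z) n) (seq (im z) n) (seq (re w) n) (seq (im w) n)) ,
      ≡⇒≈ { - (re z * im w + im z * re w)} {re z * (- im w) + (- im z) * re w} (λ n →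
        solve 4 (λ a b c d → :- (a :* d :+ b :* c) := a :* (:- d) :+ (:- b) :* c) refl
          (seq (re z) n) (seq (im z) n) (seq (re w) n) (seq (im w) n))
  ; conj-ι    = λ x → ≈-refl {x} , ≡⇒≈ { - 0ℝ} {0ℝ} (λ _ → refl)
  ; conj-inv  = λ n → ≈-refl {fromℚ (inv! n)} , ≡⇒≈ { - 0ℝ} {0ℝ} (λ _ → refl)
  ; ‖conj‖    = λ (a , b) → a , bounded-neg b
  ; ‖ι‖       = bounded-fromℝ
  }
  where open +-*-Solver

-- State transfer

open Evolution complexification using (Transfers; Transfers-intro; Transfers-elim; Transfers-kind;
  Transfers-cluster; Transfers-cartesian; IsExponential; exponential; generator)

_⇝ᴿ_ : (ℕ → ℝ) → ℝ → Set
s ⇝ᴿ l = ∀ q → 0ℚ ℚ.< q → ∃ λ N → ∀ n → N ℕ.≤ n → Boundedℝ (s n - l) q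

abstract
  fromℚ-positive : ∀ {q} → 0ℚ ℚ.< q → 0ℝ < fromℚ q
  fromℚ-positive {q} 0<q = ½ ℚ.* q , ½-pos 0<q , 0 , λ _ _ → subst₂ ℚ._<_
    (trans (ℚₚ.+-identityʳ (½ ℚ.* q)) (sym (ℚₚ.+-identityˡ (½ ℚ.* q)))) (½+½ q)
    (ℚₚ.+-monoʳ-< (½ ℚ.* q) (½-pos 0<q))

  ⟶⇒⇝ : ∀ {s l} → s ⟶ l → s ⇝ᴿ l
  ⟶⇒⇝ {s} {l} h q 0<q =
    let (N , k) = h (fromℚ q) (fromℚ-positive 0<q) in
    N , λ n N≤n → let (δ , 0<δ , M , b) = k n N≤n in
      eventually⇒bounded (s n - l) q M λ m M≤m → ℚₚ.<⇒≤ (ℚₚ.<-trans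
        (subst (ℚ._< ℚ.∣ seq (s n) m ℚ.- seq l m ∣ ℚ.+ δ) (ℚₚ.+-identityʳ _)
          (ℚₚ.+-monoʳ-< ℚ.∣ seq (s n) m ℚ.- seq l m ∣ 0<δ))
        (b m M≤m))

  ⇝⇒⟶ : ∀ {s l} → s ⇝ᴿ l → s ⟶ l
  ⇝⇒⟶ {s} {l} h ε (δ , 0<δ , M , b) =
    -- Eventually ε exceeds δ. A quarter of δ bounds the norm, a quarter is the slack of
    -- `bounded⇒eventually`, and half is the gap that the strict order on ℝ demands.
    let δ/2 = ½ ℚ.* δ
        δ/4 = ½ ℚ.* δ/2
        0<δ/4 = ½-pos (½-pos 0<δ)
        (N , k) = h δ/4 0<δ/4
    in N , λ n N≤n → let (M′ , j) = bounded⇒eventually (k n N≤n) δ/4 0<δ/4 in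
      δ/2 , ½-pos 0<δ , M ℕ.⊔ M′ , λ m M≤m → ℚₚ.<-trans
        (subst (ℚ.∣ seq (s n) m ℚ.- seq l m ∣ ℚ.+ δ/2 ℚ.<_)
          (trans (cong (ℚ._+ δ/2) (½+½ δ/2)) (trans (½+½ δ) (sym (ℚₚ.+-identityˡ δ))))
          (ℚₚ.+-monoˡ-< δ/2 (j m (ℕₚ.m⊔n≤o⇒n≤o M M′ M≤m))))
        (b m (ℕₚ.m⊔n≤o⇒m≤o M M′ M≤m))

⟶ᶜ⇒⇝ : ∀ {s l} → s ⟶ᶜ l → s ℂᴸ.⇝ l
⟶ᶜ⇒⇝ {s} {l} (p , q) ε 0<ε =
  let (N , h) = ⟶⇒⇝ {λ n → re (s n)} {re l} p ε 0<ε
      (M , k) = ⟶⇒⇝ {λ n → im (s n)} {im l} q ε 0<ε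
  in N ℕ.⊔ M , λ n N≤n → h n (ℕₚ.m⊔n≤o⇒m≤o N M N≤n) , k n (ℕₚ.m⊔n≤o⇒n≤o N M N≤n)

⇝⇒⟶ᶜ : ∀ {s l} → s ℂᴸ.⇝ l → s ⟶ᶜ l
⇝⇒⟶ᶜ {s} {l} h =
  ⇝⇒⟶ {λ n → re (s n)} {re l} (λ ε 0<ε → let (N , k) = h ε 0<ε in N , λ n N≤n → proj₁ (k n N≤n)) ,
  ⇝⇒⟶ {λ n → im (s n)} {im l} (λ ε 0<ε → let (N , k) = h ε 0<ε in N , λ n N≤n → proj₂ (k n N≤n))

expPartial-psum : ∀ {n} (Z : Matrixℂ n) u v N →
                  expPartial Z N u v ≈ᶜ ℂᴸ.psum (ℂᴸ.term λ k → (Z Complex.^ₘ k) u v) N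
expPartial-psum Z u v N = ℂᴸ.∑-psum (ℂᴸ.term λ k → (Z Complex.^ₘ k) u v) N

i*_ : ℝ → ℂ
i* τ = i Complex.*# fromℝ τ

IsTransition⇒IsExponential : ∀ {n} {A : Matrixℝ n} {τ U} →
                             IsTransition A τ U → IsExponential (generator (i* τ) A) U
IsTransition⇒IsExponential {A = A} {τ} {U} h u v = ℂᴸ.⇝-resp
  {λ N → expPartial (generator (i* τ) A) N u v}
  {ℂᴸ.psum (ℂᴸ.term λ k → (generator (i* τ) A Complex.^ₘ k) u v)} {U u v} {U u v}
  (expPartial-psum (generator (i* τ) A) u v) (ℂᴸ.refl {U u v})
  (⟶ᶜ⇒⇝ {λ N → expPartial (generator (i* τ) A) N u v} {U u v} (h u v))

IsExponential⇒IsTransition : ∀ {n} {A : Matrixℝ n} {τ U} →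
                             IsExponential (generator (i* τ) A) U → IsTransition A τ U
IsExponential⇒IsTransition {A = A} {τ} {U} h u v = ⇝⇒⟶ᶜ {λ N → expPartial (generator (i* τ) A) N u v} {U u v}
  (ℂᴸ.⇝-resp
    {ℂᴸ.psum (ℂᴸ.term λ k → (generator (i* τ) A Complex.^ₘ k) u v)}
    {λ N → expPartial (generator (i* τ) A) N u v} {U u v} {U u v}
    (λ N → ℂᴸ.sym {expPartial (generator (i* τ) A) N u v}
      {ℂᴸ.psum (ℂᴸ.term λ k → (generator (i* τ) A Complex.^ₘ k) u v) N}
      (expPartial-psum (generator (i* τ) A) u v N))
    (ℂᴸ.refl {U u v}) (h u v))

conj-i* : ∀ τ → conjugate (i* τ) ≈ᶜ ℂᴸ.-_ (i* τ)
conj-i* τ =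
  ≡⇒≈ {0ℝ * τ - 1ℝ * 0ℝ} { - (0ℝ * τ - 1ℝ * 0ℝ)} (λ n →
    solve 1 (λ t → con 0ℚ :* t :- con 1ℚ :* con 0ℚ := :- (con 0ℚ :* t :- con 1ℚ :* con 0ℚ)) refl (seq τ n)) ,
  ≈-refl { - (0ℝ * 0ℝ + 1ℝ * τ)}
  where open +-*-Solver

⟦⟧-*ᵥ : ∀ {n} M (X : Graph n) x → ⟦ M ⟧ X Real.*ᵥ x Real.≋ ℝᴸ.op M (weight X) x
⟦⟧-*ᵥ adjacency         X = ℝᴸ.kind-*ᵥ adjacency (weight X)
⟦⟧-*ᵥ laplacian         X = ℝᴸ.kind-*ᵥ laplacian (weight X)
⟦⟧-*ᵥ signlessLaplacian X = ℝᴸ.kind-*ᵥ signlessLaplacian (weight X)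

regular⇒degree : ∀ {n} {X : Graph n} ((d , _) : Regular X) → ∀ u → (weight X Real.*ᵥ 𝟏) u ≈ d
regular⇒degree {X = X} (d , h) u = ≈-trans {(weight X Real.*ᵥ 𝟏) u} {Real.∑ (weight X u)} {d}
  (ℝᴸ.*ᵥ-𝟏 (weight X) u) (ℝᴸ.diagonal-scalar {d = λ u → Real.∑ (weight X u)} {d} h u)

PST⇒Transfers : ∀ {n M} {X : Graph n} {x y τ} → PST M X x y τ → Transfers (i* τ) (⟦ M ⟧ X) x y
PST⇒Transfers {M = M} {X} {x} {y} {τ} p =
  Transfers-intro {c = i* τ} {⟦ M ⟧ X} {PST.U p} {x} {y} {PST.γ p}
    (IsTransition⇒IsExponential {A = ⟦ M ⟧ X} {τ} {PST.U p} (PST.isTransition p)) (PST.transfer p)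

Transfers⇒PST : ∀ {n M} {X : Graph n} {x y τ} → ¬ x Real.≋ Real.𝟎 → ¬ y Real.≋ Real.𝟎 → 0ℝ < τ →
                Transfers (i* τ) (⟦ M ⟧ X) x y → PST M X x y τ
Transfers⇒PST {M = M} {X} {x} {y} {τ} x≢0 y≢0 0<τ t =
  let (U , h) = exponential (generator (i* τ) (⟦ M ⟧ X))
      (γ , e) = Transfers-elim {c = i* τ} {⟦ M ⟧ X} {U} {x} {y} h t
  in record
    { source≢0     = x≢0
    ; target≢0     = y≢0
    ; τ-positive   = 0<τ
    ; U            = U
    ; isTransition = IsExponential⇒IsTransition {A = ⟦ M ⟧ X} {τ} {U} h
    ; γ            = γ
    ; transfer     = e
    }

-- Tensor products of non-zero vectors

Apart0 : ℝ → Set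
Apart0 x = ∃ λ δ → 0ℚ ℚ.< δ × ∃ λ N → ∀ n → N ℕ.≤ n → δ ℚ.≤ ℚ.∣ seq x n ∣

abstract
  ∣p∣≤∣p-q∣+∣q∣ : ∀ p q → ℚ.∣ p ∣ ℚ.≤ ℚ.∣ p ℚ.- q ∣ ℚ.+ ℚ.∣ q ∣
  ∣p∣≤∣p-q∣+∣q∣ p q = subst (λ z → ℚ.∣ z ∣ ℚ.≤ ℚ.∣ p ℚ.- q ∣ ℚ.+ ℚ.∣ q ∣)
    (solve 2 (λ a b → (a :- b) :+ b := a) refl p q) (ℚₚ.∣p+q∣≤∣p∣+∣q∣ (p ℚ.- q) q)
    where open +-*-Solver

  stays-away : ∀ p q e → e ℚ.+ e ℚ.≤ ℚ.∣ p ∣ → ℚ.∣ p ℚ.- q ∣ ℚ.≤ e → e ℚ.≤ ℚ.∣ q ∣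
  stays-away p q e 2e≤p p-q≤e = subst₂ ℚ._≤_
    (solve 1 (λ e → e :+ e :- e := e) refl e)
    (solve 2 (λ a b → (a :+ b) :- a := b) refl e ℚ.∣ q ∣)
    (ℚₚ.+-monoˡ-≤ (ℚ.- e) (ℚₚ.≤-trans 2e≤p
      (ℚₚ.≤-trans (∣p∣≤∣p-q∣+∣q∣ p q) (ℚₚ.+-monoˡ-≤ ℚ.∣ q ∣ p-q≤e))))
    where open +-*-Solver

  -- Were the term at N at least 2 e in absolute value, all later terms would be at least e and x
  -- would be apart from 0. The order on ℚ is decidable, so that term is below 2 e, and later terms
  -- differ from it by less than e.
  ¬apart⇒small : ∀ {x} → ¬ Apart0 x → ∀ e → 0ℚ ℚ.< e →
                 ∃ λ N → ∀ n → N ℕ.≤ n → ℚ.∣ seq x n ∣ ℚ.< e ℚ.+ (e ℚ.+ e)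
  ¬apart⇒small {x} ¬apart e 0<e = let (N , h) = cauchy x e 0<e in
    N , λ n N≤n → ℚₚ.≤-<-trans (∣p∣≤∣p-q∣+∣q∣ (seq x n) (seq x N))
      (ℚₚ.+-mono-< (h n N N≤n ℕₚ.≤-refl) (ℚₚ.≰⇒> λ large → ¬apart (e , 0<e , N , λ k N≤k →
        stays-away (seq x N) (seq x k) e large (ℚₚ.<⇒≤ (h N k ℕₚ.≤-refl N≤k)))))

  ¬apart⇒≈0 : ∀ {x} → ¬ Apart0 x → x ≈ 0ℝ
  ¬apart⇒≈0 {x} ¬apart ε 0<ε =
    -- A quarter of ε, so that 3 e stays strictly below ε.
    let e = ½ ℚ.* (½ ℚ.* ε)
        0<e = ½-pos (½-pos 0<ε)
        (N , h) = ¬apart⇒small {x} ¬apart e 0<e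
    in N , λ n N≤n → subst (λ z → ℚ.∣ z ∣ ℚ.< ε) (sym (ℚₚ.+-identityʳ (seq x n)))
      (ℚₚ.<-trans (h n N≤n)
        (subst₂ ℚ._<_ (ℚₚ.+-identityˡ _) (trans (cong₂ ℚ._+_ (½+½ (½ ℚ.* ε)) (½+½ (½ ℚ.* ε))) (½+½ ε))
          (subst (λ z → 0ℚ ℚ.+ (e ℚ.+ (e ℚ.+ e)) ℚ.< z) (sym (ℚₚ.+-assoc e e (e ℚ.+ e)))
            (ℚₚ.+-monoˡ-< (e ℚ.+ (e ℚ.+ e)) 0<e))))

  apart-cancelˡ : ∀ {x y} → Apart0 x → x * y ≈ 0ℝ → y ≈ 0ℝ
  apart-cancelˡ {x} {y} (δ , 0<δ , N , b) xy≈0 ε 0<ε =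
    let instance δ⁺ = ℚ.positive 0<δ
        (M , h) = xy≈0 (δ ℚ.* ε) (subst (ℚ._< δ ℚ.* ε) (ℚₚ.*-zeroʳ δ) (ℚₚ.*-monoʳ-<-pos δ 0<ε))
    in N ℕ.⊔ M , λ n N≤n → subst (λ z → ℚ.∣ z ∣ ℚ.< ε) (sym (ℚₚ.+-identityʳ (seq y n)))
      (ℚₚ.*-cancelˡ-<-nonNeg δ {{ℚₚ.pos⇒nonNeg δ}} (ℚₚ.≤-<-trans
        (ℚₚ.*-monoʳ-≤-nonNeg ℚ.∣ seq y n ∣ {{ℚₚ.∣-∣-nonNeg (seq y n)}} (b n (ℕₚ.m⊔n≤o⇒m≤o N M N≤n)))
        (subst (ℚ._< δ ℚ.* ε)
          (trans (cong ℚ.∣_∣ (ℚₚ.+-identityʳ (seq x n ℚ.* seq y n))) (ℚₚ.∣p*q∣≡∣p∣*∣q∣ (seq x n) (seq y n)))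
          (h n (ℕₚ.m⊔n≤o⇒n≤o N M N≤n)))))

-- No coordinate apart from 0 can be extracted from x ≢ 0, but if x ⊗ w vanishes, a coordinate of x
-- apart from 0 could be cancelled and would force w to vanish. So no coordinate of x is apart from
-- 0, and all of them are 0.
⊗-≢0 : ∀ {n k} {x : Vector ℝ n} {w : Vector ℝ k} →
       ¬ x Real.≋ Real.𝟎 → ¬ w Real.≋ Real.𝟎 → ¬ x ⊗ w Real.≋ Real.𝟎
⊗-≢0 {n} {k} {x} {w} x≢0 w≢0 h = x≢0 λ a → ¬apart⇒≈0 {x a} λ x#0 → w≢0 λ b → apart-cancelˡ {x a} {w b} x#0
  (subst (λ (a , b) → x a * w b ≈ 0ℝ) (Finₚ.remQuot-combine {n} a b) (h (combine {n} a b)))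

extend-≢0 : ∀ {c} m {x : Vector ℝ c} → ¬ x Real.≋ Real.𝟎 → ¬ extend m x Real.≋ Real.𝟎
extend-≢0 m {x} x≢0 h = x≢0 λ a → subst (_≈ 0ℝ) (ℝᴸ.pad-ˡ m x a) (h (a ↑ˡ m))

-- Clusters in graphs and the transfer in the product

∈-first : ∀ {c} m (a : Fin c) → a ↑ˡ m ∈ first c m
∈-first {c} m a = Vecₚ.lookup⇒[]= (a ↑ˡ m) (first c m)
  (trans (Vecₚ.lookup-++ˡ (Vec.replicate c inside) (Vec.replicate m outside) a) (Vecₚ.lookup-replicate a inside))

-- If v is a neighbour of a it lies in S, where the cluster condition applies. Otherwise it is no
-- neighbour of b either, both neighbourhoods being S, and both weights vanish.
cluster-weight : ∀ {n} {G : Graph n} {C S} → IsCluster G C S →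
                 ∀ {a b} → a ∈ C → b ∈ C → ∀ v → weight G a v ≈ weight G b v
cluster-weight {G = G} cl {a} {b} a∈C b∈C v with adj? G a v
... | yes e = IsCluster.constant cl (Equivalence.to (IsCluster.neighbours cl a∈C v) e) a∈C b∈C
... | no ¬e = ≈-trans {weight G a v} {0ℝ} {weight G b v} (weight-zero G ¬e)
  (≈-sym {weight G b v} {0ℝ} (weight-zero G λ e →
    ¬e (Equivalence.from (IsCluster.neighbours cl a∈C v) (Equivalence.to (IsCluster.neighbours cl b∈C v) e))))

module _ {c m : ℕ} (H : Graph c) where

  private
    L : Matrixℝ (c +ℕ m)
    L = weight (withIsolated m H)

  withIsolated-ˡˡ : ∀ a b → L (a ↑ˡ m) (b ↑ˡ m) ≈ weight H a b
  withIsolated-ˡˡ a b rewrite Finₚ.splitAt-↑ˡ c a m | Finₚ.splitAt-↑ˡ c b m = ≈-refl {weight H a b}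

  withIsolated-ˡʳ : ∀ a j → L (a ↑ˡ m) (c ↑ʳ j) ≈ 0ℝ
  withIsolated-ˡʳ a j rewrite Finₚ.splitAt-↑ˡ c a m | Finₚ.splitAt-↑ʳ c m j = ≈-refl {0ℝ}

  withIsolated-ʳ : ∀ j v → L (c ↑ʳ j) v ≈ 0ℝ
  withIsolated-ʳ j v rewrite Finₚ.splitAt-↑ʳ c m j = ≈-refl {0ℝ}

-- Covers both parts of the theorem, as periodicity is transfer from w to itself. The hypotheses on
-- H and K may use kinds different from M; `change` brings both to M before the cluster and product
-- lemmas are applied.
PST-cluster-cartesian : ∀ {c m k} {G : Graph (c +ℕ m)} {S} {H : Graph c} {K : Graph k} →
  IsCluster G (first c m) S → Regular H → Regular K →
  ∀ {Mᴴ Mᴷ x y τ w z} → 𝟏 · x ≈ 0ℝ → PST Mᴴ H x y τ → PST Mᴷ K w z τ →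
  ∀ M → PST M ((G ⟨ H ⟩) □ K) (extend m x ⊗ w) (extend m y ⊗ z) τ
PST-cluster-cartesian {c} {m} {k} {G} {S} {H} {K} cl regH regK {Mᴴ} {Mᴷ} {x} {y} {τ} {w} {z} 𝟏·x≈0 pH pK M =
  Transfers⇒PST {M = M} {(G ⟨ H ⟩) □ K} {extend m x ⊗ w} {extend m y ⊗ z}
    (⊗-≢0 {x = extend m x} {w} (extend-≢0 m {x} (PST.source≢0 pH)) (PST.source≢0 pK))
    (⊗-≢0 {x = extend m y} {z} (extend-≢0 m {y} (PST.target≢0 pH)) (PST.target≢0 pK))
    (PST.τ-positive pH)
    (Transfers-cartesian M (weight (G ⟨ H ⟩)) (weight K) {⟦ M ⟧ (G ⟨ H ⟩)} {⟦ M ⟧ K} {⟦ M ⟧ ((G ⟨ H ⟩) □ K)}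
      {extend m x} {extend m y} {w} {z}
      (⟦⟧-*ᵥ M (G ⟨ H ⟩)) (⟦⟧-*ᵥ M K) (⟦⟧-*ᵥ M ((G ⟨ H ⟩) □ K))
      (Transfers-cluster {z = i* τ} {W = weight G} {weight (withIsolated m H)} {weight H} {proj₁ regH}
        (weight-sym G) (λ a b → cluster-weight {G = G} cl (∈-first m a) (∈-first m b))
        (withIsolated-ˡˡ H) (withIsolated-ˡʳ H) (withIsolated-ʳ H) (weight-sym H) (regular⇒degree {X = H} regH)
        M {⟦ M ⟧ (G ⟨ H ⟩)} {⟦ M ⟧ H} {x} {y} (⟦⟧-*ᵥ M (G ⟨ H ⟩)) (⟦⟧-*ᵥ M H)
        (≈-trans {Real.∑ x} {𝟏 · x} {0ℝ}
          (ℝᴸ.∑-cong {f = x} {λ u → 1ℝ * x u} (λ u → ℝᴸ.sym {1ℝ * x u} {x u} (ℝᴸ.*-identityˡ (x u)))) 𝟏·x≈0)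
        (change H regH pH))
      (change K regK pK))
  where
  change : ∀ {n} (X : Graph n) → Regular X → ∀ {M′ x y} → PST M′ X x y τ → Transfers (i* τ) (⟦ M ⟧ X) x y
  change X reg {M′} {x} {y} p = Transfers-kind {W = weight X} {proj₁ reg} (regular⇒degree {X = X} reg)
    M′ M {⟦ M′ ⟧ X} {⟦ M ⟧ X} {x} {y} (conj-i* τ) (⟦⟧-*ᵥ M′ X) (⟦⟧-*ᵥ M X)
    (PST⇒Transfers {M = M′} {X} {x} {y} p)

theorem18 : ∀ {c m k : ℕ} (G : Graph (c +ℕ m)) (S : Subset (c +ℕ m)) (H : Graph c) (K : Graph k) →
    Connected G → IsCluster G (first c m) S → Regular H → Regular K →
    ∀ (Mᴴ Mᴷ : MatrixKind) (x y : Vector ℝ c) (τ : ℝ) →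
    𝟏 · x ≈ 0ℝ → 𝟏 · y ≈ 0ℝ → PST Mᴴ H x y τ →
    ∀ (M : MatrixKind) →
    (∀ w → Periodic Mᴷ K w τ →
    PST M ((G ⟨ H ⟩) □ K) (extend m x ⊗ w) (extend m y ⊗ w) τ)
    ×
    (∀ w₁ w₂ → PST Mᴷ K w₁ w₂ τ →
    PST M ((G ⟨ H ⟩) □ K) (extend m x ⊗ w₁) (extend m y ⊗ w₂) τ)
theorem18 G S H K _ cl regH regK Mᴴ Mᴷ x y τ 𝟏·x≈0 _ pH M =
  (λ w pK → PST-cluster-cartesian {G = G} {S} {H} {K} cl regH regK 𝟏·x≈0 pH pK M) ,
  λ w₁ w₂ pK → PST-cluster-cartesian {G = G} {S} {H} {K} cl regH regK 𝟏·x≈0 pH pK M
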